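{- Let $H$ be a catacondensed hexagonal system possessing a tail $T(t_1,t_2,t_3)$ with respect to a hexagon $h$, and let $H_1^T,H_2^T,H_3^T,H_4^T$ be as defined in the context. Then: (1) if $t_2=-1$, then $$Af(H,x)=x\,Af(H_2^T,x)+x\,Af(H_3^T,x)+\alpha_T;$$ (2) if $t_2\ge 0$, then $$Af(H,x)=x^2Af(H_1^T,x)+\big(3x^2+2(t_1+t_2)x^3+t_1t_2x^4\big)Af(H_2^T,x)-x^3Af(H_3^T,x)+\beta_T,$$ where $\alpha_T=0$ if $t_1=-1$, and $\alpha_T=x\,Af(H_1^T,x)+t_1x^2Af(H_2^T,x)-x^2Af(H_3^T,x)$ if $t_1\ge 0$; and $\beta_T=x\,Af(H_2^T,x)-x^2Af(H_4^T,x)$ if $t_3=0$, and $\beta_T=x^2Af(H_3^T,x)$ if $t_3\ge 1$.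
   Context: Perfect matchings and anti-forcing: for a finite graph $G$ with set of perfect matchings $\mathcal{M}(G)$ and $M\in\mathcal{M}(G)$, an anti-forcing set of $M$ is $S\subseteq E(G)\setminus M$ such that $G-S$ has $M$ as its unique perfect matching; $af(G,M)$ is the minimum size of such $S$; the anti-forcing polynomial is $Af(G,x)=\sum_{M\in\mathcal{M}(G)}x^{af(G,M)}$, with the convention $Af(\emptyset,x)=1$ for the empty graph. Hexagonal systems: a hexagonal system is a 2-connected finite plane graph in which every interior face is bounded by a regular hexagon of side length one (these faces are called hexagons). Two hexagons are neighboring if they share an edge. $H$ is catacondensed if no three of its hexagons share a common vertex. A hexagon is terminal if it has exactly one neighboring hexagon (or if $H$ consists of a single hexagon), branched if it has three neighboring hexagons; a hexagon with exactly two neighboring hexagons is a kink if it contains two adjacent vertices of degree two in $H$, and linear otherwise. A linear hexagonal chain in $H$ is a sequence of hexagons of $H$, consecutive ones neighboring, whose centers all lie on one straight line (equivalently a catacondensed subsystem with no branched hexagons and no kinks); it is maximal if it is contained in no other linear hexagonal chain of $H$. Its length is its number of hexagons; its vertical edges are the edges intersecting the straight line through the centers of its hexagons; its last vertical edge is the vertical edge of its last hexagon not shared with the preceding hexagon. A kink $h$ is an end kink if $H$ contains a maximal linear hexagonal chain starting from $h$ and ending at a terminal hexagon. A branched hexagon $h$ is an end branched hexagon if $H$ contains two maximal linear hexagonal chains starting from $h$ and ending at terminal hexagons. Tails: a tail $T(t_1,t_2,t_3)$ with respect to $h$ is a subgraph $T_1\cup T_2\cup T_3$ of $H$ defined as follows.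 (a) If $H$ is a linear hexagonal chain, $h$ is a terminal hexagon of $H$, $T_1=H$, $T_2=T_3=h$, $t_1+2$ ($t_1\ge -1$) is the length of $T_1$ and $t_2=t_3=-1$. (b) If $h$ is an end kink, $T_2=h$, and $T_1,T_3$ are the maximal linear hexagonal chains starting from $h$, with $T_1$ ending at a terminal hexagon; $t_2=-1$ and $t_1+2$, $t_3+2$ ($t_1,t_3\ge 0$) are the lengths of $T_1,T_3$. (c) If $h$ is an end branched hexagon, $T_1,T_2,T_3$ are the maximal linear hexagonal chains starting from $h$, with $T_1,T_2$ ending at terminal hexagons; $t_1+2,t_2+2,t_3+2$ ($t_1,t_2,t_3\ge 0$) are their lengths. "Deleting hexagons" from $H$ means taking the subgraph formed by the union of the remaining hexagons (the empty graph if none remain). $H_1^T$ is obtained from $H$ by deleting all hexagons of $T_1\cup T_2$ except $h$; $H_2^T$ by deleting all hexagons of $T_1\cup T_2$; $H_3^T$ by deleting all hexagons of $T_1\cup T_2\cup T_3$. In case (c), let $L$ be the last hexagon of $T_3$, $v$ the last vertical edge of $T_3$, and $u_1,u_2$ the two edges of $L$ adjacent to $v$; $H_4^T$ is obtained from $H_3^T$ by deleting all hexagons in the maximal linear hexagonal chains starting from the hexagon containing $u_1$ and from the hexagon containing $u_2$ (i.e., for each $i$, the hexagons other than $L$ of the maximal linear hexagonal chain of $H$ containing $L$ and the hexagon other than $L$ that contains $u_i$, if such a hexagon exists). -}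

module Defs where

open import Data.Bool using (Bool; true; false; not; _∧_; _∨_; if_then_else_)
open import Data.Nat as ℕ using (ℕ; zero; suc; _∸_)
open import Data.Nat.Properties as ℕP using ()
open import Data.Integer as ℤ using (ℤ; +_; 0ℤ; -1ℤ)
import Data.Integer.Properties as ℤP
open import Data.Fin using (Fin; zero; suc)
open import Data.Fin.Properties as FinP using ()
open import Data.List using (List; []; _∷_; _++_; map; concatMap; length; allFin; foldr)
open import Data.List.Membership.Propositional using (_∈_)
open import Data.Product using (_×_; _,_; proj₁; proj₂; ∃-syntax; Σ)
open import Data.Product.Properties using (≡-dec)
open import Data.Sum using (_⊎_)
open import Relation.Binary.PropositionalEquality using (_≡_)
open import Relation.Binary.Definitions using (DecidableEquality)
open import Relation.Nullary using (¬_; does)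

-- Hexagonal (honeycomb) lattice, encoded through its hexagons (cells).
-- A cell is given by axial coordinates (a , b) : its centre is
-- a·e₁ + b·e₂ where e₁, e₂ are centre-to-centre vectors at 60°.

Cell : Set
Cell = ℤ × ℤ

_≟C_ : DecidableEquality Cell
_≟C_ = ≡-dec ℤ._≟_ ℤ._≟_

_⊕C_ : Cell → Cell → Cell
(a , b) ⊕C (c , d) = (a ℤ.+ c , b ℤ.+ d)

-- the six unit directions, in counter-clockwise cyclic order
vec : Fin 6 → Cell
vec zero = (+ 1 , 0ℤ)
vec (suc zero) = (0ℤ , + 1)
vec (suc (suc zero)) = (-1ℤ , + 1)
vec (suc (suc (suc zero))) = (-1ℤ , 0ℤ)
vec (suc (suc (suc (suc zero)))) = (0ℤ , -1ℤ)
vec (suc (suc (suc (suc (suc zero))))) = (+ 1 , -1ℤ)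

-- A lattice vertex is a point where three mutually neighbouring cells
-- meet: (a , b , true) is the meeting point of (a,b),(a+1,b),(a,b+1);
-- (a , b , false) is the meeting point of (a+1,b),(a,b+1),(a+1,b+1).
Vertex : Set
Vertex = Cell × Bool

_≟V_ : DecidableEquality Vertex
_≟V_ = ≡-dec _≟C_ Data.Bool._≟_
  where import Data.Bool

vertexCells : Vertex → Cell × Cell × Cell
vertexCells ((a , b) , true) = (a , b) , (a ℤ.+ + 1 , b) , (a , b ℤ.+ + 1)
vertexCells ((a , b) , false) =
  (a ℤ.+ + 1 , b) , (a , b ℤ.+ + 1) , (a ℤ.+ + 1 , b ℤ.+ + 1)

-- A lattice edge is the common edge of two neighbouring cells; it is
-- stored canonically as (c , j), the common edge of c and c ⊕ vec j,
-- j ∈ {0,1,2}.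
Edge : Set
Edge = Cell × Fin 3

_≟E_ : DecidableEquality Edge
_≟E_ = ≡-dec _≟C_ FinP._≟_

-- the edge of cell c shared with the neighbouring cell c ⊕ vec i
edge : Cell → Fin 6 → Edge
edge c zero = c , zero
edge c (suc zero) = c , suc zero
edge c (suc (suc zero)) = c , suc (suc zero)
edge c (suc (suc (suc zero))) = (c ⊕C vec (suc (suc (suc zero)))) , zero
edge c (suc (suc (suc (suc zero)))) = (c ⊕C vec (suc (suc (suc (suc zero))))) , suc zero
edge c (suc (suc (suc (suc (suc zero))))) = (c ⊕C vec (suc (suc (suc (suc (suc zero)))))) , suc (suc zero)

ends : Edge → Vertex × Vertex
ends ((a , b) , zero) = ((a , b) , true) , ((a , b ℤ.- + 1) , false)
ends ((a , b) , suc zero) = ((a , b) , true) , ((a ℤ.- + 1 , b) , false)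
ends ((a , b) , suc (suc zero)) = ((a ℤ.- + 1 , b) , true) , ((a ℤ.- + 1 , b) , false)

IsEnd : Vertex → Edge → Set
IsEnd w e = w ≡ proj₁ (ends e) ⊎ w ≡ proj₂ (ends e)

elemB : {A : Set} → DecidableEquality A → A → List A → Bool
elemB eq x [] = false
elemB eq x (y ∷ ys) = does (eq x y) ∨ elemB eq x ys

filterB : {A : Set} → (A → Bool) → List A → List A
filterB p [] = []
filterB p (x ∷ xs) = if p x then x ∷ filterB p xs else filterB p xs

dedup : {A : Set} → DecidableEquality A → List A → List A
dedup eq [] = []
dedup eq (x ∷ xs) = if elemB eq x xs then dedup eq xs else x ∷ dedup eq xs

allB : {A : Set} → (A → Bool) → List A → Bool
allB p [] = true
allB p (x ∷ xs) = p x ∧ allB p xs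

subsets : {A : Set} → List A → List (List A)
subsets [] = [] ∷ []
subsets (x ∷ xs) = map (x ∷_) (subsets xs) ++ subsets xs

minus : {A : Set} → DecidableEquality A → List A → List A → List A
minus eq xs ys = filterB (λ x → not (elemB eq x ys)) xs

_==_ : ℕ → ℕ → Bool
m == n = does (m ℕ.≟ n)

-- The graph of a set of hexagons (given as a list; only membership
-- matters): the union of the boundaries of the hexagons.

edgesOf : List Cell → List Edge
edgesOf H = dedup _≟E_ (concatMap (λ c → map (edge c) (allFin 6)) H)

verticesOf : List Cell → List Vertex
verticesOf H =
  dedup _≟V_ (concatMap (λ e → proj₁ (ends e) ∷ proj₂ (ends e) ∷ []) (edgesOf H))

incidentB : Vertex → Edge → Bool
incidentB v e = does (v ≟V proj₁ (ends e)) ∨ does (v ≟V proj₂ (ends e))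

degIn : List Edge → Vertex → ℕ
degIn M v = length (filterB (incidentB v) M)

isPM : List Vertex → List Edge → Bool
isPM V M = allB (λ v → degIn M v == 1) V

perfectMatchings : List Vertex → List Edge → List (List Edge)
perfectMatchings V E = filterB (isPM V) (subsets E)

-- S is an anti-forcing set of the perfect matching M of G = (V , E)
-- (S is taken among the subsets of E ∖ M): G - S has M as its unique
-- perfect matching (M is always one of them, so: exactly one).
isAntiForcing : List Vertex → List Edge → List Edge → List Edge → Bool
isAntiForcing V E M S = length (perfectMatchings V (minus _≟E_ E S)) == 1

minimumℕ : ℕ → List ℕ → ℕ
minimumℕ d = foldr ℕ._⊓_ d

-- af(G , M): minimum size of an anti-forcing set of M
-- (the default |E| is never smaller than the true minimum, which is
-- attained since E ∖ M itself is an anti-forcing set)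
af : List Vertex → List Edge → List Edge → ℕ
af V E M =
  minimumℕ (length E)
    (map length (filterB (isAntiForcing V E M) (subsets (minus _≟E_ E M))))

Poly : Set
Poly = ℕ → ℤ

_≈P_ : Poly → Poly → Set
p ≈P q = ∀ k → p k ≡ q k

infixl 6 _+P_ _-P_
infix 4 _≈P_

_+P_ : Poly → Poly → Poly
(p +P q) k = p k ℤ.+ q k

_-P_ : Poly → Poly → Poly
(p -P q) k = p k ℤ.- q k

_·P_ : ℤ → Poly → Poly
(z ·P p) k = z ℤ.* p k
infixr 7 _·P_

shiftP : Poly → Poly
shiftP p zero = 0ℤ
shiftP p (suc k) = p k

xpow : ℕ → Poly → Poly
xpow zero p = p
xpow (suc j) p = shiftP (xpow j p)

-- The anti-forcing polynomial of the graph formed by the union of the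
-- hexagons in H (for H = [] this is the empty graph, and Af = 1).
-- Coefficient of x^k = number of perfect matchings M with af(G,M) = k.
Af : List Cell → Poly
Af H k =
  + length (filterB (λ M → af V E M == k) (perfectMatchings V E))
  where
    V = verticesOf H
    E = edgesOf H

data Walk (P : Cell → Set) : Cell → Cell → Set where
  here : ∀ {c} → P c → Walk P c c
  step : ∀ {c d} (i : Fin 6) → P c → Walk P (c ⊕C vec i) d → Walk P c d

-- H (the list of its hexagons) is a hexagonal system:
-- nonempty, its union is connected (equivalently 2-connected on the
-- honeycomb lattice), and every interior face is one of its hexagons,
-- i.e. every cell not in H lies in the unbounded region (it can be
-- joined, avoiding H, to a cell to the right of all hexagons of H).
HexSystem : List Cell → Set
HexSystem H =
  (∃[ c ] c ∈ H)
  × (∀ c d → c ∈ H → d ∈ H → Walk (_∈ H) c d)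
  × (∀ c → ¬ (c ∈ H) →
       ∃[ d ] (Walk (λ x → ¬ (x ∈ H)) c d
               × (∀ e → e ∈ H → proj₁ e ℤ.< proj₁ d)))

Catacondensed : List Cell → Set
Catacondensed H =
  ∀ (v : Vertex) → ¬ (proj₁ (vertexCells v) ∈ H
                      × proj₁ (proj₂ (vertexCells v)) ∈ H
                      × proj₂ (proj₂ (vertexCells v)) ∈ H)

memB : Cell → List Cell → Bool
memB = elemB _≟C_

numNbrs : List Cell → Cell → ℕ
numNbrs H c = length (filterB (λ i → memB (c ⊕C vec i) H) (allFin 6))

degree : List Cell → Vertex → ℕ
degree H v = degIn (edgesOf H) v

Terminal : List Cell → Cell → Set
Terminal H c = c ∈ H × (numNbrs H c ≡ 1 ⊎ (∀ d → d ∈ H → d ≡ c))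

Branched : List Cell → Cell → Set
Branched H c = c ∈ H × numNbrs H c ≡ 3

Kink : List Cell → Cell → Set
Kink H c = c ∈ H × numNbrs H c ≡ 2
  × ∃[ i ] (degree H (proj₁ (ends (edge c i))) ≡ 2
            × degree H (proj₂ (ends (edge c i))) ≡ 2)

record Chain : Set where
  constructor chain
  field
    start : Cell
    dir   : Fin 6
    len   : ℕ
open Chain public

_⊛_ : ℕ → Cell → Cell
n ⊛ (a , b) = (+ n ℤ.* a , + n ℤ.* b)

cellAt : Chain → ℕ → Cell
cellAt ch i = start ch ⊕C (i ⊛ vec (dir ch))

lastCell : Chain → Cell
lastCell ch = cellAt ch (len ch ∸ 1)

InChain : Cell → Chain → Set
InChain c ch = ∃[ i ] (i ℕ.< len ch × c ≡ cellAt ch i)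

LinChain : List Cell → Chain → Set
LinChain H ch = 1 ℕ.≤ len ch × (∀ i → i ℕ.< len ch → cellAt ch i ∈ H)

Contains : Chain → Chain → Set
Contains big small = ∀ c → InChain c small → InChain c big

MaxChain : List Cell → Chain → Set
MaxChain H ch = LinChain H ch
  × (∀ ch' → LinChain H ch' → Contains ch' ch → len ch' ℕ.≤ len ch)

SingleAt : Chain → Cell → Set
SingleAt ch h = start ch ≡ h × len ch ≡ 1

lenℤ : Chain → ℤ
lenℤ ch = + len ch

TailA : List Cell → Cell → Chain → Chain → Chain → ℤ → ℤ → ℤ → Set
TailA H h T₁ T₂ T₃ t₁ t₂ t₃ =
  LinChain H T₁ × (∀ c → c ∈ H → InChain c T₁)
  × Terminal H h × SingleAt T₂ h × SingleAt T₃ h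
  × t₁ ≡ lenℤ T₁ ℤ.- + 2 × t₂ ≡ -1ℤ × t₃ ≡ -1ℤ

TailB : List Cell → Cell → Chain → Chain → Chain → ℤ → ℤ → ℤ → Set
TailB H h T₁ T₂ T₃ t₁ t₂ t₃ =
  Kink H h
  × MaxChain H T₁ × start T₁ ≡ h × Terminal H (lastCell T₁)
  × MaxChain H T₃ × start T₃ ≡ h × ¬ (dir T₁ ≡ dir T₃)
  × SingleAt T₂ h
  × t₁ ≡ lenℤ T₁ ℤ.- + 2 × t₂ ≡ -1ℤ × t₃ ≡ lenℤ T₃ ℤ.- + 2
  × 0ℤ ℤ.≤ t₁ × 0ℤ ℤ.≤ t₃

TailC : List Cell → Cell → Chain → Chain → Chain → ℤ → ℤ → ℤ → Set
TailC H h T₁ T₂ T₃ t₁ t₂ t₃ =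
  Branched H h
  × MaxChain H T₁ × start T₁ ≡ h × Terminal H (lastCell T₁)
  × MaxChain H T₂ × start T₂ ≡ h × Terminal H (lastCell T₂)
  × MaxChain H T₃ × start T₃ ≡ h
  × ¬ (dir T₁ ≡ dir T₂) × ¬ (dir T₁ ≡ dir T₃) × ¬ (dir T₂ ≡ dir T₃)
  × t₁ ≡ lenℤ T₁ ℤ.- + 2 × t₂ ≡ lenℤ T₂ ℤ.- + 2 × t₃ ≡ lenℤ T₃ ℤ.- + 2
  × 0ℤ ℤ.≤ t₁ × 0ℤ ℤ.≤ t₂ × 0ℤ ℤ.≤ t₃

IsTail : List Cell → Cell → Chain → Chain → Chain → ℤ → ℤ → ℤ → Set
IsTail H h T₁ T₂ T₃ t₁ t₂ t₃ =
  TailA H h T₁ T₂ T₃ t₁ t₂ t₃ ⊎ TailB H h T₁ T₂ T₃ t₁ t₂ t₃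
  ⊎ TailC H h T₁ T₂ T₃ t₁ t₂ t₃

_⇔_ : Set → Set → Set
A ⇔ B = (A → B) × (B → A)
infix 3 _⇔_

IsH₁ : List Cell → Cell → Chain → Chain → List Cell → Set
IsH₁ H h T₁ T₂ H₁ = ∀ c →
  c ∈ H₁ ⇔ (c ∈ H × ((InChain c T₁ ⊎ InChain c T₂) → c ≡ h))

IsH₂ : List Cell → Chain → Chain → List Cell → Set
IsH₂ H T₁ T₂ H₂ = ∀ c →
  c ∈ H₂ ⇔ (c ∈ H × ¬ (InChain c T₁ ⊎ InChain c T₂))

IsH₃ : List Cell → Chain → Chain → Chain → List Cell → Set
IsH₃ H T₁ T₂ T₃ H₃ = ∀ c →
  c ∈ H₃ ⇔ (c ∈ H × ¬ (InChain c T₁ ⊎ InChain c T₂ ⊎ InChain c T₃))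

-- hexagons deleted from H₃ᵀ to form H₄ᵀ: L = last hexagon of T₃,
-- v = last vertical edge of T₃ (the edge of L shared with L + dir T₃),
-- u = an edge of L adjacent to v (sharing an end vertex with v, u ≠ v),
-- L ⊕ vec i = the hexagon other than L containing u (if it is in H);
-- delete the hexagons of the maximal linear chain of H containing
-- L and L ⊕ vec i.
Deleted₄ : List Cell → Chain → Cell → Set
Deleted₄ H T₃ c =
  ∃[ i ] (¬ (edge L i ≡ v)
          × (∃[ w ] (IsEnd w (edge L i) × IsEnd w v))
          × (L ⊕C vec i) ∈ H
          × ∃[ ch ] (MaxChain H ch × InChain L ch
                     × InChain (L ⊕C vec i) ch × InChain c ch))
  where
    L = lastCell T₃
    v = edge L (dir T₃)

IsH₄ : List Cell → Chain → Chain → Chain → List Cell → Set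
IsH₄ H T₁ T₂ T₃ H₄ = ∀ c →
  c ∈ H₄ ⇔ ((c ∈ H × ¬ (InChain c T₁ ⊎ InChain c T₂ ⊎ InChain c T₃))
            × ¬ Deleted₄ H T₃ c)

{-# OPTIONS --safe #-}
{-
A perfect matching selects one side of every triangle of mutually adjacent cells.  For an edge shared by two
hexagons, both of its ends are matched into the same one of the two hexagons, or the edge itself is used:
the discrepancies form a divergence-free flow on the hexagons, which vanishes because no cell outside the
system is enclosed.  Hence the matching along a straight chain is determined by the position of its vertical
edge, and the perfect matchings of H split into classes according to the vertical edges of T₁ and T₂.

Cutting off a straight chain, or the two chains leaving a hexagon, lowers the anti-forcing number of every
matching of a class by exactly one.  An alternating hexagon of the part cut off must be hit outside of the
rest, since toggling it gives another perfect matching; conversely, deleting one well-chosen edge forces the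
part cut off as soon as the rest is forced.  At a branched hexagon none of whose edges to the tails is used,
two toggles are needed for the lower bound.  Summing over the classes gives the formulas.
-}
module Submission where

open import Defs
open import Data.Bool using (Bool; true; false; not; _∧_; _∨_; if_then_else_)
open import Data.Bool.Properties using (∧-comm; ∨-comm; not-involutive)
open import Data.Empty using (⊥; ⊥-elim)
open import Data.Fin using (Fin; zero; suc)
open import Data.Integer using (ℤ; +_; -[1+_]; 0ℤ; -1ℤ; _≤_; _<_; _+_; _*_; _-_; -_; ∣_∣)
import Data.Integer as ℤ
import Data.Integer.Properties as ℤP
open import Data.Integer.Tactic.RingSolver using (solve-∀)
open import Data.List using (List; []; _∷_; _++_; length; map; concatMap; allFin; upTo)
open import Data.List.Membership.Propositional using (_∈_)
open import Data.List.Membership.Propositional.Properties using (∈-++⁻; ∈-++⁺ˡ; ∈-++⁺ʳ; ∈-map⁻; ∈-map⁺; ∈-concatMap⁺; ∈-concatMap⁻; ∈-allFin; ∈-upTo⁻; ∈-∃++)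
open import Data.List.Properties using (length-++; length-upTo)
open import Data.List.Relation.Unary.All as All using (All; []; _∷_)
open import Data.List.Relation.Unary.AllPairs using ([]; _∷_)
open import Data.List.Relation.Unary.Any using (Any; here; there)
open import Data.List.Relation.Unary.Unique.Propositional using (Unique)
import Data.List.Relation.Unary.Unique.Propositional.Properties as Unique
open import Data.Nat as ℕ using (ℕ; zero; suc; s≤s; z≤n)
import Data.Nat.Properties as ℕP
open import Data.Product using (_×_; _,_; proj₁; proj₂; ∃-syntax)
open import Data.Sum using (_⊎_; inj₁; inj₂; swap)
open import Relation.Binary.Definitions using (DecidableEquality)
open import Relation.Binary.PropositionalEquality hiding (J)
open import Relation.Nullary using (Dec; ¬_; yes; no; does)
open import Relation.Nullary.Decidable using (_⊎-dec_)

-- The minus signs come from classes that a single deletion does not describe. If a tail is cut off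
-- a matching that uses its entrance edge, the rest is a matching of the smaller system that must
-- still use this edge. Such classes are counted by polynomials `A X P` restricted by a predicate.
-- The smaller system is then split at the same edge, and its complementary class is again cut along
-- straight chains: `A H₁ every` is a restricted polynomial plus x times `A H₃ every`. Solving for
-- the restricted one produces the negative multiple of Af(H₃). The term with Af(H₄) arises from H₂
-- in the same way when t₃ = 0.
--
-- Deleting hexagons may disconnect a system, and what remains need not be a hexagonal system.
-- Planarity is therefore a property of one ambient cell set `H`, and the flux statements concern
-- arbitrary `X ⊆ H`: the flow of `X` is supported in `H`, and every cell outside `H` escapes.
--
-- Matchings are Boolean functions on all lattice edges, compared pointwise; the lists of the
-- definition enter only for counting.

pattern d0 = zero
pattern d1 = suc zero
pattern d2 = suc (suc zero)
pattern d3 = suc (suc (suc zero))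
pattern d4 = suc (suc (suc (suc zero)))
pattern d5 = suc (suc (suc (suc (suc zero))))

six : {P : Fin 6 → Set} → P d0 → P d1 → P d2 → P d3 → P d4 → P d5 → ∀ i → P i
six p _ _ _ _ _ d0 = p
six _ p _ _ _ _ d1 = p
six _ _ p _ _ _ d2 = p
six _ _ _ p _ _ d3 = p
six _ _ _ _ p _ d4 = p
six _ _ _ _ _ p d5 = p

-- Rotations of directions and adjacency of cells

r1 r2 r3 r4 r5 : Fin 6 → Fin 6
r1 d0 = d1
r1 d1 = d2
r1 d2 = d3
r1 d3 = d4
r1 d4 = d5
r1 d5 = d0
r2 i = r1 (r1 i)
r3 i = r1 (r2 i)
r4 i = r1 (r3 i)
r5 i = r1 (r4 i)

r6 : ∀ i → r1 (r5 i) ≡ i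
r6 = six refl refl refl refl refl refl

ℤ-cancelˡ : ∀ a {x y} → a + x ≡ a + y → x ≡ y
ℤ-cancelˡ a {x} {y} e = trans (l a x) (trans (cong (λ t → t - a) e) (sym (l a y)))
  where l : ∀ a x → x ≡ a + x - a
        l = solve-∀

⊕-assoc : ∀ c x y → (c ⊕C x) ⊕C y ≡ c ⊕C (x ⊕C y)
⊕-assoc (a , b) (x , x') (y , y') = cong₂ _,_ (ℤP.+-assoc a x y) (ℤP.+-assoc b x' y')

infixl 21 _▸_
_▸_ : Cell → Fin 6 → Cell
c ▸ i = c ⊕C vec i

▸-opposite : ∀ c i → c ▸ i ▸ r3 i ≡ c
▸-opposite c@(a , b) i = trans (⊕-assoc c (vec i) (vec (r3 i))) (trans (cong (c ⊕C_) (lem i)) (cong₂ _,_ (ℤP.+-identityʳ a) (ℤP.+-identityʳ b)))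
  where
  lem : ∀ i → vec i ⊕C vec (r3 i) ≡ (0ℤ , 0ℤ)
  lem = six refl refl refl refl refl refl

▸-next : ∀ c i → c ▸ i ▸ r2 i ≡ c ▸ r1 i
▸-next c i = trans (⊕-assoc c (vec i) (vec (r2 i))) (cong (c ⊕C_) (lem i))
  where
  lem : ∀ i → vec i ⊕C vec (r2 i) ≡ vec (r1 i)
  lem = six refl refl refl refl refl refl

▸-prev : ∀ c i → c ▸ i ▸ r4 i ≡ c ▸ r5 i
▸-prev c i = trans (⊕-assoc c (vec i) (vec (r4 i))) (cong (c ⊕C_) (lem i))
  where
  lem : ∀ i → vec i ⊕C vec (r4 i) ≡ vec (r5 i)
  lem = six refl refl refl refl refl refl

edge-flip : ∀ c i → edge (c ▸ i) (r3 i) ≡ edge c i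
edge-flip c d0 = cong (_, d0) (▸-opposite c d0)
edge-flip c d1 = cong (_, d1) (▸-opposite c d1)
edge-flip c d2 = cong (_, d2) (▸-opposite c d2)
edge-flip c d3 = refl
edge-flip c d4 = refl
edge-flip c d5 = refl

-- Planarity

-- A divergence-free flow on the triangular lattice of cells is supported in a bounded region χ whose
-- complementary cells all escape to infinity.  Its winding number U around a cell outside χ is constant
-- along walks that avoid χ, hence zero; and the winding numbers at the two cells flanking an adjacency
-- of χ differ by the flow through it.
module Planarity
  (χ : Cell → Bool) (B : ℤ) (bounded : ∀ c → B ≤ proj₁ c → χ c ≡ false)
  (F : Cell → Fin 6 → ℤ)
  (supported : ∀ c i → χ c ≡ false → F c i ≡ 0ℤ)
  (antisym : ∀ c i → F (c ▸ i) (r3 i) ≡ - F c i)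
  (divFree : ∀ c → F c d0 + (F c d1 + (F c d2 + (F c d3 + (F c d4 + F c d5)))) ≡ 0ℤ)
  where

  target0 : ∀ c i → χ (c ▸ i) ≡ false → F c i ≡ 0ℤ
  target0 c i e = ℤP.neg-injective (trans (sym (antisym c i)) (supported _ _ e))

  clip : ℤ → ℕ
  clip (+ n) = n
  clip -[1+ n ] = 0

  up : ℤ → ℤ → ℤ
  up a b = F (a , b) d1 + F (a , b) d2

  u : ℕ → ℤ → ℤ
  u zero b = 0ℤ
  u (suc n) b = u n b + up (B - + n) b

  -- The net flow from row `b` to row `b + 1` out of the cells strictly to the right of `a`, that
  -- is, across a horizontal ray from `(a , b)` to infinity. `clip` makes the sum finite: from
  -- column `B` on there is no flow.
  U : ℤ → ℤ → ℤ
  U a b = u (clip (B - a)) b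

  up0 : ∀ a b → χ (a , b) ≡ false → up a b ≡ 0ℤ
  up0 a b e = cong₂ _+_ (supported (a , b) d1 e) (supported (a , b) d2 e)

  U-step : ∀ a b → U a b ≡ U (a + + 1) b + up (a + + 1) b
  U-step a b with B - a in eq | B - (a + + 1) in eq'
  ... | D | D' = go D D' eq pr
    where
    pr : D' ≡ D + -1ℤ
    pr = trans (sym eq') (trans (lem B a) (cong (λ t → t + -1ℤ) eq))
      where lem : ∀ B a → B - (a + + 1) ≡ B - a + -1ℤ
            lem = solve-∀
    out : ∀ k → B - a ≡ k → B ≤ a + + 1 → 0ℤ ≡ 0ℤ + up (a + + 1) b
    out k _ h = sym (trans (ℤP.+-identityˡ _) (up0 (a + + 1) b (bounded (a + + 1 , b) h)))
    go : ∀ D D' → B - a ≡ D → D' ≡ D + -1ℤ → u (clip D) b ≡ u (clip D') b + up (a + + 1) b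
    go (+ zero) _ e refl = out _ e (ℤP.≤-trans (ℤP.≤-reflexive (ℤP.i-j≡0⇒i≡j B a e)) (ℤP.i≤i+j a (+ 1)))
    go (+ suc n) _ e refl = cong (λ y → u n b + up y b) q
      where
      lem : ∀ B a x → B - a ≡ + 1 + x → B - x ≡ a + + 1
      lem B a x e = trans (l1 B a x) (trans (cong (λ t → t - x + a) e) (l2 a x))
        where l1 : ∀ B a x → B - x ≡ B - a - x + a
              l1 = solve-∀
              l2 : ∀ a x → + 1 + x - x + a ≡ a + + 1
              l2 = solve-∀
      q : B - + n ≡ a + + 1
      q = lem B a (+ n) e
    go -[1+ n ] _ e refl = out _ e (ℤP.≤-trans h (ℤP.i≤i+j a (+ 1)))
      where
      h : B ≤ a
      h = ℤP.i-j≤0⇒i≤j (ℤP.≤-trans (ℤP.≤-reflexive e) ℤ.-≤+)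

  vanish : (f : ℤ → ℤ) (B' : ℤ) → (∀ a → B' ≤ a → f a ≡ 0ℤ) → ∀ n a → (∀ a' → a ≤ a' → f a' ≡ f (a' + + 1)) → B' ≤ a + + n → f a ≡ 0ℤ
  vanish f B' z zero a s h = z a (subst (B' ≤_) (ℤP.+-identityʳ a) h)
  vanish f B' z (suc n) a s h = trans (s a ℤP.≤-refl) (vanish f B' z n (a + + 1) (λ a' l → s a' (ℤP.≤-trans (ℤP.i≤i+j a (+ 1)) l)) (subst (B' ≤_) (sym (ℤP.+-assoc a (+ 1) (+ n))) h))

  reach : ∀ B a → B ≤ a + + ∣ B - a ∣
  reach B a = ℤP.≤-trans (ℤP.≤-reflexive (lem B a)) (ℤP.+-monoʳ-≤ a (i≤∣i∣ (B - a)))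
    where
    lem : ∀ B a → B ≡ a + (B - a)
    lem = solve-∀
    i≤∣i∣ : ∀ i → i ≤ + ∣ i ∣
    i≤∣i∣ (+ n) = ℤP.≤-refl
    i≤∣i∣ -[1+ n ] = ℤ.-≤+

  U-out : ∀ a b → B ≤ a → U a b ≡ 0ℤ
  U-out a b h = go (B - a) (ℤP.i≤j⇒i-j≤0 h)
    where
    go : ∀ D → D ≤ 0ℤ → u (clip D) b ≡ 0ℤ
    go (+ zero) _ = refl
    go (+ suc n) (ℤ.+≤+ ())
    go -[1+ n ] _ = refl

  -- Conservation at `(a + 1 , b + 1)`, with the darts `d3`, `d4`, `d5` turned round by `antisym`:
  -- what leaves to the right or upwards has entered from the left or from below.
  div' : ∀ a b → F (a + + 1 , b + + 1) d0 + up (a + + 1) (b + + 1)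
               ≡ F (a , b + + 1) d0 + F (a + + 1 , b) d1 + F (a + + 1 + + 1 , b) d2
  div' a b = lem (F p d0) (F p d1) (F p d2) (F p d3) (F p d4) (F p d5) _ _ _ e3 e4 e5 (divFree p)
    where
    p : Cell
    p = (a + + 1 , b + + 1)
    eqc : ∀ (c c' : Cell) i → c' ▸ i ≡ c → F c (r3 i) ≡ - F c' i
    eqc c c' i refl = antisym c' i
    e3 = eqc (a + + 1 , b + + 1) (a , b + + 1) d0 (cong₂ _,_ refl (ℤP.+-identityʳ _))
    e4 = eqc (a + + 1 , b + + 1) (a + + 1 , b) d1 (cong₂ _,_ (ℤP.+-identityʳ _) refl)
    e5 = eqc (a + + 1 , b + + 1) (a + + 1 + + 1 , b) d2 (cong₂ _,_ (trans (ℤP.+-assoc (a + + 1) (+ 1) -1ℤ) (ℤP.+-identityʳ _)) refl)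
    lem : ∀ x0 x1 x2 x3 x4 x5 y0 y1 y2 → x3 ≡ - y0 → x4 ≡ - y1 → x5 ≡ - y2 →
      x0 + (x1 + (x2 + (x3 + (x4 + x5)))) ≡ 0ℤ → x0 + (x1 + x2) ≡ y0 + y1 + y2
    lem x0 x1 x2 _ _ _ y0 y1 y2 refl refl refl e = ℤP.i-j≡0⇒i≡j _ _ (trans (l x0 x1 x2 y0 y1 y2) e)
      where l : ∀ x0 x1 x2 y0 y1 y2 → x0 + (x1 + x2) - (y0 + y1 + y2) ≡ x0 + (x1 + (x2 + (- y0 + (- y1 + - y2))))
            l = solve-∀

  -- Moving the ray up by one row changes the flow across it only near its starting point. The
  -- difference of the two sides is zero far to the right, and by `div'` it is the same in
  -- neighbouring columns, so it is zero everywhere.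
  U-row : ∀ a b → U a (b + + 1) ≡ U (a + + 1) b + F (a + + 1 , b) d1 + F (a , b + + 1) d0
  U-row a b = ℤP.i-j≡0⇒i≡j _ _ (vanish D B far ∣ B - a ∣ a (λ a' _ → stp a') (reach B a))
    where
    D : ℤ → ℤ
    D a = U a (b + + 1) - (U (a + + 1) b + F (a + + 1 , b) d1 + F (a , b + + 1) d0)
    far : ∀ a → B ≤ a → D a ≡ 0ℤ
    far a h = cong₂ _-_ (U-out a _ h) (cong₂ _+_ (cong₂ _+_ (U-out (a + + 1) b h') (supported (a + + 1 , b) d1 (bounded (a + + 1 , b) h'))) (supported (a , b + + 1) d0 (bounded (a , b + + 1) h)))
      where h' = ℤP.≤-trans h (ℤP.i≤i+j a (+ 1))
    stp : ∀ a → D a ≡ D (a + + 1)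
    stp a = lem _ (U (a + + 1) (b + + 1)) _ (U (a + + 1 + + 1) b) (up (a + + 1) (b + + 1)) (F (a , b + + 1) d0) (F (a + + 1 , b) d1) (F (a + + 1 + + 1 , b) d1) (F (a + + 1 + + 1 , b) d2) (F (a + + 1 , b + + 1) d0)
        (U-step a (b + + 1)) (U-step (a + + 1) b) (div' a b)
      where
      lem : ∀ u0 u1 v1 v2 p h g1 g1' g2' h' →
        u0 ≡ u1 + p → v1 ≡ v2 + (g1' + g2') → h' + p ≡ h + g1 + g2' →
        u0 - (v1 + g1 + h) ≡ u1 - (v2 + g1' + h')
      lem u0 u1 v1 v2 p h g1 g1' g2' h' refl refl e = ℤP.i-j≡0⇒i≡j _ _ (trans (l u1 v2 p h g1 g1' g2' h') (ℤP.i≡j⇒i-j≡0 e))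
        where l : ∀ u1 v2 p h g1 g1' g2' h' → u1 + p - (v2 + (g1' + g2') + g1 + h) - (u1 - (v2 + g1' + h')) ≡ h' + p - (h + g1 + g2')
              l = solve-∀

  W : Cell → ℤ
  W (a , b) = U a b

  private
    Out : Cell → Set
    Out c = χ c ≡ false

    cell≡ : ∀ {a b a' b' : ℤ} → a ≡ a' → b ≡ b' → (a , b) ≡ (a' , b')
    cell≡ = cong₂ _,_

    down-up : ∀ b → b + -1ℤ + + 1 ≡ b
    down-up b = trans (ℤP.+-assoc b -1ℤ (+ 1)) (ℤP.+-identityʳ b)
    up-down : ∀ b → b + + 1 + -1ℤ ≡ b
    up-down b = trans (ℤP.+-assoc b (+ 1) -1ℤ) (ℤP.+-identityʳ b)

    F-to : ∀ c c' i → c ▸ i ≡ c' → Out c' → F c i ≡ 0ℤ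
    F-to c c' i refl o = target0 c i o

    +00 : ∀ {x y z} → x ≡ y + z → z ≡ 0ℤ → x ≡ y
    +00 {y = y} refl refl = ℤP.+-identityʳ y

  W-move0 : ∀ a b → Out (a , b) → Out (a + + 1 , b) → U a b ≡ U (a + + 1) b
  W-move0 a b _ o = +00 (U-step a b) (up0 (a + + 1) b o)

  W-move1 : ∀ a b → Out (a , b) → Out (a , b + + 1) → U a b ≡ U a (b + + 1)
  W-move1 a b _ o = trans (trans (U-step a b) (trans (cong (ℤ._+_ (U (a + + 1) b)) (+00 {z = F (a + + 1 , b) d2} refl (F-to (a + + 1 , b) (a , b + + 1) d2 (cell≡ (up-down a) refl) o))) refl))
    (sym (+00 (U-row a b) (supported (a , b + + 1) d0 o)))

  W-move2 : ∀ a b → Out (a + + 1 , b) → Out (a , b + + 1) → U (a + + 1) b ≡ U a (b + + 1)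
  W-move2 a b o o' = sym (+00 (+00 (U-row a b) (supported (a , b + + 1) d0 o')  ) (supported (a + + 1 , b) d1 o))

  W-move : ∀ c i → Out c → Out (c ▸ i) → W c ≡ W (c ▸ i)
  W-move (a , b) d0 o o' = trans (W-move0 a b o (subst Out (cell≡ refl (ℤP.+-identityʳ b)) o')) (cong (U (a + + 1)) (sym (ℤP.+-identityʳ b)))
  W-move (a , b) d1 o o' = trans (W-move1 a b o (subst Out (cell≡ (ℤP.+-identityʳ a) refl) o')) (cong (λ x → U x (b + + 1)) (sym (ℤP.+-identityʳ a)))
  W-move (a , b) d2 o o' = trans (cong (λ x → U x b) (sym (down-up a))) (W-move2 (a + -1ℤ) b (subst Out (cell≡ (sym (down-up a)) refl) o) o')
  W-move c d3 o o' = sym (trans (W-move (c ▸ d3) d0 o' (subst Out (sym (▸-opposite c d3)) o)) (cong W (▸-opposite c d3)))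
  W-move c d4 o o' = sym (trans (W-move (c ▸ d4) d1 o' (subst Out (sym (▸-opposite c d4)) o)) (cong W (▸-opposite c d4)))
  W-move c d5 o o' = sym (trans (W-move (c ▸ d5) d2 o' (subst Out (sym (▸-opposite c d5)) o)) (cong W (▸-opposite c d5)))

  W-walk : ∀ {c d} → Walk Out c d → W c ≡ W d
  W-walk (here _) = refl
  W-walk (step i o w) = trans (W-move _ i o (first w)) (W-walk w)
    where first : ∀ {c d} → Walk Out c d → Out c
          first (here o) = o
          first (step _ o _) = o

  -- From column `a` on nothing of the region is left, so the winding number keeps the value zero
  -- that it has past `B`. Escape walks end at such cells.
  W-far : ∀ a b → (∀ a' b' → a ≤ a' → Out (a' , b')) → U a b ≡ 0ℤ
  W-far a b far = vanish (λ a → U a b) B (λ a' → U-out a' b) ∣ B - a ∣ a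
    (λ a' l → +00 (U-step a' b) (up0 (a' + + 1) b (far _ _ (ℤP.≤-trans l (ℤP.i≤i+j a' (+ 1)))))) (reach B a)

  private
    cancel : ∀ {x y z} → x ≡ y + z → x ≡ 0ℤ → y ≡ 0ℤ → z ≡ 0ℤ
    cancel {z = z} refl e refl = trans (sym (ℤP.+-identityˡ z)) e

    jump0 : ∀ a b → Out (a , b + + 1) → Out (a + + 1 , b - + 1) → U a (b + + 1) ≡ 0ℤ → U (a + + 1) (b - + 1) ≡ 0ℤ →
      F (a , b) d0 ≡ 0ℤ
    jump0 a b o o' w w' = cancel row wab (cong₂ _+_ w' (supported (a + + 1 , b - + 1) d1 o'))
      where
      row : U a b ≡ U (a + + 1) (b - + 1) + F (a + + 1 , b - + 1) d1 + F (a , b) d0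
      row = subst (λ x → U a x ≡ U (a + + 1) (b - + 1) + F (a + + 1 , b - + 1) d1 + F (a , x) d0) (down-up b) (U-row a (b - + 1))
      wab : U a b ≡ 0ℤ
      wab = trans (trans (U-step a b) (cong (ℤ._+_ (U (a + + 1) b)) (+00 refl (F-to (a + + 1 , b) (a , b + + 1) d2 (cell≡ (up-down a) refl) o))))
              (trans (sym (+00 (U-row a b) (supported (a , b + + 1) d0 o))) w)

    jump1 : ∀ a b → Out (a + + 1 , b) → Out (a - + 1 , b + + 1) → U (a + + 1) b ≡ 0ℤ → U (a - + 1) (b + + 1) ≡ 0ℤ →
      F (a , b) d1 ≡ 0ℤ
    jump1 a b o o' w w' = cancel row w' wab
      where
      row : U (a - + 1) (b + + 1) ≡ U a b + F (a , b) d1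
      row = +00 (subst (λ x → U (a - + 1) (b + + 1) ≡ U x b + F (x , b) d1 + F (a - + 1 , b + + 1) d0) (down-up a) (U-row (a - + 1) b))
              (supported _ d0 o')
      wab : U a b ≡ 0ℤ
      wab = trans (+00 (U-step a b) (up0 (a + + 1) b o)) w

    jump2 : ∀ a b → Out (a , b + + 1) → Out (a - + 1 , b) → U a (b + + 1) ≡ 0ℤ → U (a - + 1) b ≡ 0ℤ →
      F (a , b) d2 ≡ 0ℤ
    jump2 a b o o' w w' = cancel row w' (cong₂ _+_ wab (F-to (a , b) (a , b + + 1) d1 (cell≡ (ℤP.+-identityʳ a) refl) o))
      where
      row : U (a - + 1) b ≡ U a b + F (a , b) d1 + F (a , b) d2
      row = trans (subst (λ x → U (a - + 1) b ≡ U x b + up x b) (down-up a) (U-step (a - + 1) b)) (sym (ℤP.+-assoc (U a b) _ _))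
      wab : U a b ≡ 0ℤ
      wab = trans (trans (U-step a b) (cong (ℤ._+_ (U (a + + 1) b)) (+00 refl (F-to (a + + 1 , b) (a , b + + 1) d2 (cell≡ (up-down a) refl) o))))
              (trans (sym (+00 (U-row a b) (supported (a , b + + 1) d0 o))) w)

  private
    back : ∀ c i → F (c ▸ i) (r3 i) ≡ 0ℤ → F c i ≡ 0ℤ
    back c i e = ℤP.neg-injective (trans (sym (antisym c i)) e)

  -- The cells `c ▸ r1 i` and `c ▸ r5 i` flank the step from `c` to `c ▸ i`; with winding number
  -- zero at both, nothing flows between them. The directions `d3` to `d5` are the reversed ones.
  flow≡0 : (∀ z → Out z → W z ≡ 0ℤ) →
    ∀ c i → Out (c ▸ r1 i) → Out (c ▸ r5 i) → F c i ≡ 0ℤ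
  flow≡0 w (a , b) d0 o o' = jump0 a b p o' (w _ p) (w _ o')
    where p = subst Out (cell≡ (ℤP.+-identityʳ a) refl) o
  flow≡0 w (a , b) d1 o o' = jump1 a b p o (w _ p) (w _ o)
    where p = subst Out (cell≡ refl (ℤP.+-identityʳ b)) o'
  flow≡0 w (a , b) d2 o o' = jump2 a b p q (w _ p) (w _ q)
    where p = subst Out (cell≡ (ℤP.+-identityʳ a) refl) o'
          q = subst Out (cell≡ refl (ℤP.+-identityʳ b)) o
  flow≡0 w c d3 o o' = back c d3 (flow≡0 w (c ▸ d3) d0 (subst Out (sym (▸-prev c d3)) o') (subst Out (sym (▸-next c d3)) o))
  flow≡0 w c d4 o o' = back c d4 (flow≡0 w (c ▸ d4) d1 (subst Out (sym (▸-prev c d4)) o') (subst Out (sym (▸-next c d4)) o))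
  flow≡0 w c d5 o o' = back c d5 (flow≡0 w (c ▸ d5) d2 (subst Out (sym (▸-prev c d5)) o') (subst Out (sym (▸-next c d5)) o))

-- the edge not on c at the vertex of c between its sides i and r1 i
third : ∀ c i → edge (c ▸ r1 i) (r5 i) ≡ edge (c ▸ i) (r2 i)
third c i = trans (cong (λ x → edge x (r5 i)) (sym (▸-next c i))) (edge-flip (c ▸ i) (r2 i))

CellSet : Set
CellSet = Cell → Bool

EdgeSet : Set
EdgeSet = Edge → Bool

one : Bool → Bool → Bool → Bool
one true false false = true
one false true false = true
one false false true = true
one _ _ _ = false

one-rot : ∀ a b c → one a b c ≡ one b c a
one-rot true true true = refl
one-rot true true false = refl
one-rot true false true = refl
one-rot true false false = refl
one-rot false true true = refl
one-rot false true false = refl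
one-rot false false true = refl
one-rot false false false = refl

one-swap : ∀ a b c → one a b c ≡ one b a c
one-swap true true true = refl
one-swap true true false = refl
one-swap true false true = refl
one-swap true false false = refl
one-swap false true true = refl
one-swap false true false = refl
one-swap false false true = refl
one-swap false false false = refl

infix 4 _∋_ _∌_
_∋_ _∌_ : {A : Set} → (A → Bool) → A → Set
X ∋ x = X x ≡ true
X ∌ x = X x ≡ false

-- Perfect matchings and the flux through shared edges

-- The vertices of the honeycomb are the triangles of mutually adjacent cells; a perfect matching
-- of the graph of X selects exactly one side of every triangle that meets X.
record PM (X : CellSet) (m : EdgeSet) : Set where
  field
    off : ∀ c i → X ∌ c → X ∌ c ▸ i → m (edge c i) ≡ false
    cover : ∀ c i → X ∋ c → one (m (edge c i)) (m (edge c (r1 i))) (m (edge (c ▸ i) (r2 i))) ≡ true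

  coverL : ∀ c i → X ∋ c → one (m (edge c i)) (m (edge c (r5 i))) (m (edge (c ▸ i) (r4 i))) ≡ true
  coverL c i x = trans (trans (one-swap (m (edge c i)) _ _)
    (cong₂ (λ p q → one (m (edge c (r5 i))) (m (edge c p)) (m q)) (sym (r6 i)) lem)) (cover c (r5 i) x)
    where
    lem : edge (c ▸ i) (r4 i) ≡ edge (c ▸ r5 i) (r2 (r5 i))
    lem = trans (cong₂ (λ p q → edge (c ▸ p) q) (sym (r6 i)) (sym (r6 (r4 i)))) (third c (r5 i))
open PM public

-- What the ambient system contributes. `cata` passes to subsets by `⊆-out`; `bounded` and `escape`
-- are used for the ambient set alone, which suffices since the flow of a subset is supported in it.
record Good (H : CellSet) : Set where
  field
    bound : ℤ
    bounded : ∀ c → bound ≤ proj₁ c → H ∌ c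
    escape : ∀ c → H ∌ c → ∃[ d ] (Walk (λ x → H ∌ x) c d × (∀ a b → proj₁ d ≤ a → H ∌ (a , b)))
    cata : ∀ c i → H ∋ c → H ∋ c ▸ i → H ∌ c ▸ r1 i

  cataL : ∀ c i → H ∋ c → H ∋ c ▸ i → H ∌ c ▸ r5 i
  cataL c i x y with H (c ▸ r5 i) in eq
  ... | false = refl
  ... | true = trans (sym y) (trans (cong (λ j → H (c ▸ j)) (sym (r6 i))) (cata c (r5 i) x eq))
open Good public

_⊆_ : CellSet → CellSet → Set
X ⊆ H = ∀ c → X ∋ c → H ∋ c

⊆-out : ∀ {X H} → X ⊆ H → ∀ {c} → H ∌ c → X ∌ c
⊆-out {X} s {c} h with X c in eq
... | false = refl
... | true = trans (sym (s c eq)) h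

⟦_⟧ : Bool → ℤ
⟦ true ⟧ = + 1
⟦ false ⟧ = 0ℤ

sgn : Fin 6 → ℤ
sgn d0 = + 1
sgn d1 = -1ℤ
sgn d2 = + 1
sgn d3 = -1ℤ
sgn d4 = + 1
sgn d5 = -1ℤ

module Flux {H : CellSet} (good : Good H) {X : CellSet} (X⊆H : X ⊆ H) {m : EdgeSet} (pm : PM X m) where

  at : Cell → Fin 6 → Bool
  at c i = m (edge c i)

  -- For two hexagons of `X` this is nonzero exactly when the two ends of their common edge are
  -- matched into different hexagons. Both hexagons see the same difference; the alternating sign,
  -- which reflects the bipartition of the vertices, makes the flow antisymmetric.
  flow : Cell → Fin 6 → ℤ
  flow c i = ⟦ X c ∧ X (c ▸ i) ⟧ * (sgn i * (⟦ at c (r5 i) ⟧ - ⟦ at c (r1 i) ⟧))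

  private
    supported : ∀ c i → H ∌ c → flow c i ≡ 0ℤ
    supported c i h rewrite ⊆-out {X} {H} X⊆H {c} h = ℤP.*-zeroˡ (sgn i * (⟦ at c (r5 i) ⟧ - ⟦ at c (r1 i) ⟧))

    one-diff : ∀ a b c b' c' → one a b c ≡ true → one a b' c' ≡ true → ⟦ c ⟧ - ⟦ c' ⟧ ≡ ⟦ b' ⟧ - ⟦ b ⟧
    one-diff true false false false false _ _ = refl
    one-diff false true false true false _ _ = refl
    one-diff false true false false true _ _ = refl
    one-diff false false true true false _ _ = refl
    one-diff false false true false true _ _ = refl
    one-diff true true _ _ _ () _
    one-diff true false true _ _ () _
    one-diff true false false true _ _ ()
    one-diff true false false false true _ ()
    one-diff false true true _ _ () _
    one-diff false true false true true _ ()
    one-diff false true false false false _ ()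
    one-diff false false true true true _ ()
    one-diff false false true false false _ ()
    one-diff false false false _ _ () _

    r53 : ∀ i → r5 (r3 i) ≡ r2 i
    r53 i = cong r2 (r6 i)

    sgn3 : ∀ i → sgn (r3 i) ≡ - sgn i
    sgn3 = six refl refl refl refl refl refl

    antisym : ∀ c i → flow (c ▸ i) (r3 i) ≡ - flow c i
    antisym c i = trans (cong₂ (λ x y → ⟦ X (c ▸ i) ∧ X x ⟧ * (y * (⟦ at (c ▸ i) (r5 (r3 i)) ⟧ - ⟦ at (c ▸ i) (r4 i) ⟧))) (▸-opposite c i) (sgn3 i))
      (trans (cong (λ x → ⟦ X (c ▸ i) ∧ X c ⟧ * (- sgn i * (⟦ at (c ▸ i) x ⟧ - ⟦ at (c ▸ i) (r4 i) ⟧))) (r53 i))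
      (trans (cong (λ x → ⟦ x ⟧ * (- sgn i * (⟦ at (c ▸ i) (r2 i) ⟧ - ⟦ at (c ▸ i) (r4 i) ⟧))) (∧-comm (X (c ▸ i)) (X c)))
      (go (X c) refl)))
      where
      neg : ∀ a s d → a * (- s * d) ≡ - (a * (s * d))
      neg = solve-∀
      go : ∀ xc → X c ≡ xc → ⟦ xc ∧ X (c ▸ i) ⟧ * (- sgn i * (⟦ at (c ▸ i) (r2 i) ⟧ - ⟦ at (c ▸ i) (r4 i) ⟧))
         ≡ - (⟦ xc ∧ X (c ▸ i) ⟧ * (sgn i * (⟦ at c (r5 i) ⟧ - ⟦ at c (r1 i) ⟧)))
      go false _ = trans (ℤP.*-zeroˡ (- sgn i * (⟦ at (c ▸ i) (r2 i) ⟧ - ⟦ at (c ▸ i) (r4 i) ⟧))) (cong -_ (sym (ℤP.*-zeroˡ (sgn i * (⟦ at c (r5 i) ⟧ - ⟦ at c (r1 i) ⟧)))))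
      go true x = trans (neg ⟦ X (c ▸ i) ⟧ (sgn i) (⟦ at (c ▸ i) (r2 i) ⟧ - ⟦ at (c ▸ i) (r4 i) ⟧))
        (cong (λ t → - (⟦ X (c ▸ i) ⟧ * (sgn i * t)))
          (one-diff _ _ _ _ _ (cover pm c i x) (coverL pm c i x)))

    divFree : ∀ c → flow c d0 + (flow c d1 + (flow c d2 + (flow c d3 + (flow c d4 + flow c d5)))) ≡ 0ℤ
    divFree c = go (X c) refl
      where
      b x : Fin 6 → ℤ
      b i = ⟦ at c i ⟧
      x i = ⟦ X (c ▸ i) ⟧
      term : Bool → Fin 6 → ℤ
      term xc i = ⟦ xc ∧ X (c ▸ i) ⟧ * (sgn i * (⟦ at c (r5 i) ⟧ - ⟦ at c (r1 i) ⟧))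
      z : ∀ i → term false i ≡ 0ℤ
      z i = ℤP.*-zeroˡ (sgn i * (⟦ at c (r5 i) ⟧ - ⟦ at c (r1 i) ⟧))
      -- The flow out of `c`, regrouped by the six vertices of `c`. The first factor at a vertex
      -- tells whether its matching edge leaves `c`, the second is the number of other cells of `X`
      -- there minus one. In each product one factor vanishes.
      identity : ∀ b0 b1 b2 b3 b4 b5 x0 x1 x2 x3 x4 x5 →
        x0 * (+ 1 * (b5 - b1)) + (x1 * (-1ℤ * (b0 - b2)) + (x2 * (+ 1 * (b1 - b3)) + (x3 * (-1ℤ * (b2 - b4)) + (x4 * (+ 1 * (b3 - b5)) + x5 * (-1ℤ * (b4 - b0))))))
        ≡ (+ 1 - b0 - b1) * (x0 + x1 - + 1) - (+ 1 - b1 - b2) * (x1 + x2 - + 1) + (+ 1 - b2 - b3) * (x2 + x3 - + 1)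
        - (+ 1 - b3 - b4) * (x3 + x4 - + 1) + (+ 1 - b4 - b5) * (x4 + x5 - + 1) - (+ 1 - b5 - b0) * (x5 + x0 - + 1)
      identity = solve-∀
      fin : ∀ {p q r s t u} → p ≡ 0ℤ → q ≡ 0ℤ → r ≡ 0ℤ → s ≡ 0ℤ → t ≡ 0ℤ → u ≡ 0ℤ → p - q + r - s + t - u ≡ 0ℤ
      fin refl refl refl refl refl refl = refl
      -- the edge leaving c at a vertex lies in exactly one of the two other cells there
      leave : X ∋ c → ∀ i → (+ 1 - b i - b (r1 i)) * (x i + x (r1 i) - + 1) ≡ 0ℤ
      leave xc i = lem (at c i) (at c (r1 i)) _ (X (c ▸ i)) (X (c ▸ r1 i)) (cover pm c i xc)
        (λ e e' → off pm (c ▸ i) (r2 i) e (trans (cong X (▸-next c i)) e'))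
        (λ e → ⊆-out {X} {H} X⊆H (cata good c i (X⊆H c xc) (X⊆H _ e)))
        where
        lem : ∀ p q r s t → one p q r ≡ true → (s ≡ false → t ≡ false → r ≡ false) → (s ≡ true → t ≡ false) →
          (+ 1 - ⟦ p ⟧ - ⟦ q ⟧) * (⟦ s ⟧ + ⟦ t ⟧ - + 1) ≡ 0ℤ
        lem true true _ s t () _ _
        lem true false r s t _ _ _ = refl
        lem false true r s t _ _ _ = refl
        lem false false r false true _ _ _ = refl
        lem false false r true false _ _ _ = refl
        lem false false r true true _ _ k with k refl
        ... | ()
        lem false false r false false o k _ rewrite k refl refl with o
        ... | ()
      go : ∀ xc → X c ≡ xc → term xc d0 + (term xc d1 + (term xc d2 + (term xc d3 + (term xc d4 + term xc d5)))) ≡ 0ℤ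
      go false _ rewrite z d0 | z d1 | z d2 | z d3 | z d4 | z d5 = refl
      go true e = trans (identity (b d0) (b d1) (b d2) (b d3) (b d4) (b d5) (x d0) (x d1) (x d2) (x d3) (x d4) (x d5))
        (fin (leave e d0) (leave e d1) (leave e d2) (leave e d3) (leave e d4) (leave e d5))

    open Planarity H (bound good) (bounded good) flow supported antisym divFree

    W0 : ∀ z → H ∌ z → W z ≡ 0ℤ
    W0 z o with escape good z o
    ... | (a , b) , w , far = trans (W-walk w) (W-far a b far)

    read : ∀ i p q → sgn i * (⟦ p ⟧ - ⟦ q ⟧) ≡ 0ℤ → p ≡ q
    read i true true _ = refl
    read i false false _ = refl
    read d0 true false ()
    read d1 true false ()
    read d2 true false ()
    read d3 true false ()
    read d4 true false ()
    read d5 true false ()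
    read d0 false true ()
    read d1 false true ()
    read d2 false true ()
    read d3 false true ()
    read d4 false true ()
    read d5 false true ()

  -- By `cata` the two cells flanking the common edge of `c` and `c ▸ i` lie outside `H`, so
  -- `flow≡0` applies. The ends of the common edge are thus matched into the same hexagon, or to
  -- each other.
  flux : ∀ c i → X ∋ c → X ∋ c ▸ i → m (edge c (r5 i)) ≡ m (edge c (r1 i))
  flux c i x y = read i _ _ (trans (sym (ℤP.*-identityˡ (sgn i * (⟦ at c (r5 i) ⟧ - ⟦ at c (r1 i) ⟧)))) lem)
    where
    lem : + 1 * (sgn i * (⟦ at c (r5 i) ⟧ - ⟦ at c (r1 i) ⟧)) ≡ 0ℤ
    lem = trans (cong (λ t → ⟦ t ⟧ * (sgn i * (⟦ at c (r5 i) ⟧ - ⟦ at c (r1 i) ⟧))) (sym (trans (cong₂ _∧_ x y) refl)))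
      (flow≡0 W0 c i (cata good c i (X⊆H c x) (X⊆H _ y)) (cataL good c i (X⊆H c x) (X⊆H _ y)))

  one-match : ∀ {a b c b' c'} → one a b c ≡ true → one a b' c' ≡ true → c ≡ c' → b ≡ b'
  one-match {false} {true} {false} {true} _ _ refl = refl
  one-match {false} {false} {true} {false} _ _ refl = refl
  one-match {true} {false} {false} {false} _ _ refl = refl

  -- If `c ▸ j` is in `X`, this is `flux`. If not, both ends of side `j` have only edges of `c`, and
  -- each of the two neighbouring sides is used exactly when `j` is not.
  flux′ : ∀ c j → X ∋ c → X ∌ c ▸ r1 j → X ∌ c ▸ r5 j → m (edge c (r1 j)) ≡ m (edge c (r5 j))
  flux′ c j x e e' with X (c ▸ j) in y
  ... | true = sym (flux c j x y)
  ... | false = one-match (cover pm c j x) (coverL pm c j x)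
    (trans (off pm (c ▸ j) (r2 j) y (trans (cong X (▸-next c j)) e)) (sym (off pm (c ▸ j) (r4 j) y (trans (cong X (▸-prev c j)) e'))))

-- Relative directions, changes of viewpoint at a vertex, toggling

data Dir (d : Fin 6) : Fin 6 → Set where
  is0 : Dir d d
  is1 : Dir d (r1 d)
  is2 : Dir d (r2 d)
  is3 : Dir d (r3 d)
  is4 : Dir d (r4 d)
  is5 : Dir d (r5 d)

-- Splitting on the position of `i` relative to a variable `d` keeps all goals rotation invariant:
-- six cases instead of thirty-six.
dirs : ∀ d i → Dir d i
dirs d0 = six is0 is1 is2 is3 is4 is5
dirs d1 = six is5 is0 is1 is2 is3 is4
dirs d2 = six is4 is5 is0 is1 is2 is3
dirs d3 = six is3 is4 is5 is0 is1 is2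
dirs d4 = six is2 is3 is4 is5 is0 is1
dirs d5 = six is1 is2 is3 is4 is5 is0

clash : ∀ {A : Set} {b} → b ≡ true → b ≡ false → A
clash refl ()

Agree : CellSet → EdgeSet → EdgeSet → Set
Agree X m m' = ∀ c i → X ∋ c → m' (edge c i) ≡ m (edge c i)

tri : EdgeSet → Cell → Fin 6 → Bool
tri m c i = one (m (edge c i)) (m (edge c (r1 i))) (m (edge (c ▸ i) (r2 i)))

-- A vertex lies on three hexagons, and turning by two directions passes to its description from the
-- next one. A vertex can thus be examined from whichever hexagon is convenient.
tri-rot : ∀ m c i → tri m (c ▸ i) (r2 i) ≡ tri m c i
tri-rot m c i = trans (cong₂ (λ x y → one (m (edge (c ▸ i) (r2 i))) (m x) (m y)) (edge-flip c i) lem)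
  (one-rot (m (edge (c ▸ i) (r2 i))) (m (edge c i)) (m (edge c (r1 i))))
  where
  lem : edge ((c ▸ i) ▸ r2 i) (r4 i) ≡ edge c (r1 i)
  lem = trans (cong (λ x → edge x (r4 i)) (▸-next c i)) (edge-flip c (r1 i))

tri-rot′ : ∀ m c i → tri m (c ▸ r1 i) (r4 i) ≡ tri m c i
tri-rot′ m c i = trans (cong (λ x → tri m x (r4 i)) (sym (▸-next c i))) (trans (tri-rot m (c ▸ i) (r2 i)) (tri-rot m c i))

tri-cong : ∀ {m m'} c i → m' (edge c i) ≡ m (edge c i) → m' (edge c (r1 i)) ≡ m (edge c (r1 i)) →
  m' (edge (c ▸ i) (r2 i)) ≡ m (edge (c ▸ i) (r2 i)) → tri m' c i ≡ tri m c i
tri-cong c i p q r rewrite p | q | r = refl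

▸-≢ : ∀ c i → c ▸ i ≢ c
▸-≢ (a , b) i e = lem i (cancel a (cong proj₁ e)) (cancel b (cong proj₂ e))
  where
  cancel : ∀ a {x} → a + x ≡ a → x ≡ 0ℤ
  cancel a e = ℤ-cancelˡ a (trans e (sym (ℤP.+-identityʳ a)))
  lem : ∀ i → proj₁ (vec i) ≡ 0ℤ → proj₂ (vec i) ≡ 0ℤ → ⊥
  lem d0 () _
  lem d1 _ ()
  lem d2 () _
  lem d3 () _
  lem d4 _ ()
  lem d5 () _

_is_ : Cell → Cell → Bool
p is c = does (p ≟C c)

is-refl : ∀ c → c is c ≡ true
is-refl c with c ≟C c
... | yes _ = refl
... | no n = ⊥-elim (n refl)

is-≢ : ∀ {p c} → p ≢ c → p is c ≡ false
is-≢ {p} {c} n with p ≟C c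
... | yes e = ⊥-elim (n e)
... | no _ = refl

is-true : ∀ {p c} → p is c ≡ true → p ≡ c
is-true {p} {c} e with p ≟C c
... | yes q = q
is-true () | no _

emb : Fin 3 → Fin 6
emb zero = d0
emb (suc zero) = d1
emb (suc (suc zero)) = d2

-- A condition on pairs (hexagon, side) becomes one on edges by allowing either hexagon of the edge;
-- `darts-edge` then hides which of the two is the canonical one.
darts : (Cell → Fin 6 → Bool) → EdgeSet
darts D (a , j) = D a (emb j) ∨ D (a ▸ (emb j)) (r3 (emb j))

darts-edge : ∀ D c i → darts D (edge c i) ≡ D c i ∨ D (c ▸ i) (r3 i)
darts-edge D c d0 = refl
darts-edge D c d1 = refl
darts-edge D c d2 = refl
darts-edge D c d3 = trans (∨-comm _ (D ((c ▸ d3) ▸ d0) d3)) (cong (λ x → D x d3 ∨ D (c ▸ d3) d0) (▸-opposite c d3))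
darts-edge D c d4 = trans (∨-comm _ (D ((c ▸ d4) ▸ d1) d4)) (cong (λ x → D x d4 ∨ D (c ▸ d4) d1) (▸-opposite c d4))
darts-edge D c d5 = trans (∨-comm _ (D ((c ▸ d5) ▸ d2) d5)) (cong (λ x → D x d5 ∨ D (c ▸ d5) d2) (▸-opposite c d5))

PM-cong : ∀ {X X' m} → (∀ c → X c ≡ X' c) → PM X m → PM X' m
PM-cong e pm = record
  { off = λ c i p q → off pm c i (trans (e _) p) (trans (e _) q)
  ; cover = λ c i p → cover pm c i (trans (e _) p) }

toggle : Cell → EdgeSet → EdgeSet
toggle c m e = if darts (λ p _ → p is c) e then not (m e) else m e

toggle-on : ∀ c m i → toggle c m (edge c i) ≡ not (m (edge c i))
toggle-on c m i rewrite darts-edge (λ p _ → p is c) c i | is-refl c = refl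

toggle-off : ∀ c m p i → p ≢ c → p ▸ i ≢ c → toggle c m (edge p i) ≡ m (edge p i)
toggle-off c m p i n n' rewrite darts-edge (λ p _ → p is c) p i | is-≢ n | is-≢ n' = refl

-- At a vertex of `c` two of the three edges are flipped, and by alternation exactly one of these
-- was used. A vertex given from another hexagon is rotated until it is seen from `c`.
toggle-PM : ∀ {X m} c → PM X m → X ∋ c → (∀ i → m (edge c (r1 i)) ≡ not (m (edge c i))) → PM X (toggle c m)
toggle-PM {X} {m} c pm x alt = record { off = off' ; cover = cover' }
  where
  off' : ∀ p i → X ∌ p → X ∌ p ▸ i → toggle c m (edge p i) ≡ false
  off' p i e e' = trans (toggle-off c m p i (λ { refl → clash x e }) (λ { refl → clash x e' })) (off pm p i e e')
  here' : ∀ i → tri (toggle c m) c i ≡ true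
  here' i rewrite toggle-on c m i | toggle-on c m (r1 i) | toggle-off c m (c ▸ i) (r2 i) (▸-≢ c i) (λ e → ▸-≢ c (r1 i) (trans (sym (▸-next c i)) e)) | alt i
    = lem (m (edge c i)) _ (trans (cong (λ t → one (m (edge c i)) t (m (edge (c ▸ i) (r2 i)))) (sym (alt i))) (cover pm c i x))
    where lem : ∀ a b → one a (not a) b ≡ true → one (not a) (not (not a)) b ≡ true
          lem true false _ = refl
          lem false false _ = refl
          lem true true ()
          lem false true ()
  cover' : ∀ p i → X ∋ p → tri (toggle c m) p i ≡ true
  cover' p i xp with p ≟C c
  ... | yes refl = here' i
  ... | no n with (p ▸ i) ≟C c
  ... | yes refl = trans (sym (tri-rot (toggle c m) p i)) (here' (r2 i))
  ... | no n' with (p ▸ r1 i) ≟C c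
  ... | yes refl = trans (sym (tri-rot′ (toggle c m) p i)) (here' (r4 i))
  ... | no n'' = trans (tri-cong {m} {toggle c m} p i (toggle-off c m p i n n') (toggle-off c m p (r1 i) n n'')
        (toggle-off c m (p ▸ i) (r2 i) n' (λ e → n'' (trans (sym (▸-next p i)) e)))) (cover pm p i xp)

par : Fin 6 → Bool
par d0 = true
par d1 = false
par d2 = true
par d3 = false
par d4 = true
par d5 = false

par-r1 : ∀ i → par (r1 i) ≡ not (par i)
par-r1 = six refl refl refl refl refl refl

_≡b_ : Bool → Bool → Bool
true ≡b b = b
false ≡b b = not b

-- Adding a hexagon

-- the alternating triple of directions i, r2 i, r4 i
inA : Fin 6 → Fin 6 → Bool
inA i k = par i ≡b par k

inA-r1 : ∀ i k → inA i (r1 k) ≡ not (inA i k)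
inA-r1 i k rewrite par-r1 k with par i
... | true = refl
... | false = refl

inA0 : ∀ i → inA i i ≡ true
inA0 i with par i
... | true = refl
... | false = refl

inA1 : ∀ i → inA i (r1 i) ≡ false
inA1 i rewrite inA-r1 i i | inA0 i = refl

inA2 : ∀ i → inA i (r2 i) ≡ true
inA2 i rewrite inA-r1 i (r1 i) | inA1 i = refl

inA3 : ∀ i → inA i (r3 i) ≡ false
inA3 i rewrite inA-r1 i (r2 i) | inA2 i = refl

inA4 : ∀ i → inA i (r4 i) ≡ true
inA4 i rewrite inA-r1 i (r3 i) | inA3 i = refl

record Hexagon (m : EdgeSet) (c : Cell) (d : Fin 6) (b : Bool) : Set where
  constructor hexagon
  field
    a0 : m (edge c d) ≡ b
    a1 : m (edge c (r1 d)) ≡ not b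
    a2 : m (edge c (r2 d)) ≡ b
    a3 : m (edge c (r3 d)) ≡ not b
    a4 : m (edge c (r4 d)) ≡ b
    a5 : m (edge c (r5 d)) ≡ not b
open Hexagon public

hexagon-alternates : ∀ {m c d b} → Hexagon m c d b → ∀ i → m (edge c (r1 i)) ≡ not (m (edge c i))
hexagon-alternates {m} {c} {d} {b} A i = turn (dirs d i)
  where
  flip : ∀ {i b} → m (edge c (r1 i)) ≡ not b → m (edge c i) ≡ b → m (edge c (r1 i)) ≡ not (m (edge c i))
  flip p q = trans p (cong not (sym q))
  nn = sym (not-involutive b)
  turn : ∀ {i} → Dir d i → m (edge c (r1 i)) ≡ not (m (edge c i))
  turn is0 = flip (a1 A) (a0 A)
  turn is1 = flip (trans (a2 A) nn) (a1 A)
  turn is2 = flip (a3 A) (a2 A)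
  turn is3 = flip (trans (a4 A) nn) (a3 A)
  turn is4 = flip (a5 A) (a4 A)
  turn is5 = flip (trans (cong (λ j → m (edge c j)) (r6 d)) (trans (a0 A) nn)) (a5 A)

hexagon-same : ∀ {m m' c d b} → Hexagon m c d b → Hexagon m' c d b → ∀ i → m (edge c i) ≡ m' (edge c i)
hexagon-same {m} {m'} {c} {d} A A' i = turn (dirs d i)
  where
  turn : ∀ {i} → Dir d i → m (edge c i) ≡ m' (edge c i)
  turn is0 = trans (a0 A) (sym (a0 A'))
  turn is1 = trans (a1 A) (sym (a1 A'))
  turn is2 = trans (a2 A) (sym (a2 A'))
  turn is3 = trans (a3 A) (sym (a3 A'))
  turn is4 = trans (a4 A) (sym (a4 A'))
  turn is5 = trans (a5 A) (sym (a5 A'))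

add : Cell → CellSet → CellSet
add c Z x = (x is c) ∨ Z x

∨-false : ∀ {a b} → a ∨ b ≡ false → a ≡ false × b ≡ false
∨-false {false} e = refl , e

∨-true : ∀ {a b} → a ∨ b ≡ true → a ≡ true ⊎ b ≡ true
∨-true {true} _ = inj₁ refl
∨-true {false} e = inj₂ e

∨-right : ∀ {a b} → b ≡ true → a ∨ b ≡ true
∨-right {true} _ = refl
∨-right {false} e = e

add-self : ∀ c Z → add c Z ∋ c
add-self c Z rewrite is-refl c = refl

add-⊇ : ∀ c Z {x} → Z ∋ x → add c Z ∋ x
add-⊇ c Z {x} e = ∨-right {x is c} e

-- Adding a hexagon c all of whose neighbours in Z lie in the directions i, r2 i, r4 i.
module Extend (Z : CellSet) (n : EdgeSet) (pm : PM Z n) (c : Cell) (i : Fin 6) (zc : Z ∌ c)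
  (free : ∀ k → inA i k ≡ false → Z ∌ c ▸ k) where

  -- Three alternate sides cover each vertex of `c` once. A side shared with `Z` is left to `n`,
  -- which already covers its ends.
  D : Cell → Fin 6 → Bool
  D p k = (p is c) ∧ (inA i k ∧ not (Z (p ▸ k)))

  extend : EdgeSet
  extend e = n e ∨ darts D e

  extend-edge : ∀ p k → extend (edge p k) ≡ n (edge p k) ∨ (D p k ∨ D (p ▸ k) (r3 k))
  extend-edge p k = cong (n (edge p k) ∨_) (darts-edge D p k)

  D-≢ : ∀ p k → p ≢ c → D p k ≡ false
  D-≢ p k n rewrite is-≢ n = refl

  extend-off : ∀ p k → p ≢ c → p ▸ k ≢ c → extend (edge p k) ≡ n (edge p k)
  extend-off p k a b rewrite extend-edge p k | D-≢ p k a | D-≢ (p ▸ k) (r3 k) b with n (edge p k)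
  ... | true = refl
  ... | false = refl

  extend-on : ∀ k → extend (edge c k) ≡ n (edge c k) ∨ (inA i k ∧ not (Z (c ▸ k)))
  extend-on k rewrite extend-edge c k | D-≢ (c ▸ k) (r3 k) (▸-≢ c k) | is-refl c with n (edge c k) | inA i k ∧ not (Z (c ▸ k))
  ... | true | _ = refl
  ... | false | true = refl
  ... | false | false = refl

  extend-new : ∀ k → inA i k ≡ true → Z ∌ c ▸ k → extend (edge c k) ≡ true
  extend-new k a z rewrite extend-on k | a | z = ∨-right {n (edge c k)} refl

  extend-agrees : Agree Z n extend
  extend-agrees p k zp rewrite extend-edge p k | D-≢ p k (λ { refl → clash zp zc }) with (p ▸ k) ≟C c
  ... | no _ = ∨-comm (n (edge p k)) false
  ... | yes _ rewrite ▸-opposite p k | zp with inA i (r3 k)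
  ... | true = ∨-comm (n (edge p k)) false
  ... | false = ∨-comm (n (edge p k)) false

  private
    off-c : ∀ k → Z ∌ c ▸ k → n (edge c k) ≡ false
    off-c k = off pm c k zc

    kept : ∀ k → extend (edge (c ▸ k) (r2 k)) ≡ n (edge (c ▸ k) (r2 k))
    kept k = extend-off (c ▸ k) (r2 k) (▸-≢ c k) (λ e → ▸-≢ c (r1 k) (trans (sym (▸-next c k)) e))

    third-off : ∀ k → Z ∌ c ▸ k → Z ∌ c ▸ r1 k → n (edge (c ▸ k) (r2 k)) ≡ false
    third-off k a b = off pm (c ▸ k) (r2 k) a (trans (cong Z (▸-next c k)) b)

    not-in : ∀ k → Z ∋ c ▸ k → inA i k ≡ true
    not-in k z with inA i k in eq
    ... | true = refl
    ... | false = clash z (free k eq)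

    here' : ∀ k → tri extend c k ≡ true
    here' k with Z (c ▸ k) in z | Z (c ▸ r1 k) in z'
    ... | true | true = clash (trans (sym (inA-r1 i k)) (not-in (r1 k) z')) (cong not (not-in k z))
    ... | true | false = trans (tri-cong {n} {extend} c k e1 e2 (kept k)) (trans (sym (tri-rot n c k)) (cover pm (c ▸ k) (r2 k) z))
      where
      e1 : extend (edge c k) ≡ n (edge c k)
      e1 rewrite extend-on k | z | not-in k z = ∨-comm (n (edge c k)) false
      e2 : extend (edge c (r1 k)) ≡ n (edge c (r1 k))
      e2 rewrite extend-on (r1 k) | inA-r1 i k | not-in k z = ∨-comm (n (edge c (r1 k))) false
    ... | false | true = trans (tri-cong {n} {extend} c k e1 e2 (kept k)) (trans (sym (tri-rot′ n c k)) (cover pm (c ▸ r1 k) (r4 k) z'))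
      where
      e2 : extend (edge c (r1 k)) ≡ n (edge c (r1 k))
      e2 rewrite extend-on (r1 k) | z' | not-in (r1 k) z' = ∨-comm (n (edge c (r1 k))) false
      e1 : extend (edge c k) ≡ n (edge c k)
      e1 rewrite extend-on k | trans (sym (not-involutive (inA i k))) (cong not (trans (sym (inA-r1 i k)) (not-in (r1 k) z'))) = ∨-comm (n (edge c k)) false
    ... | false | false rewrite extend-on k | extend-on (r1 k) | kept k | z | z' | inA-r1 i k | off-c k z | off-c (r1 k) z' | third-off k z z' with inA i k
    ... | true = refl
    ... | false = refl

  extend-PM : PM (add c Z) extend
  extend-PM = record { off = off' ; cover = cover' }
    where
    off' : ∀ p k → add c Z ∌ p → add c Z ∌ p ▸ k → extend (edge p k) ≡ false
    off' p k a b = trans (extend-off p k (λ { refl → clash (add-self c Z) a }) (λ { refl → clash (add-self c Z) b }))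
      (off pm p k (proj₂ (∨-false {p is c} a)) (proj₂ (∨-false {(p ▸ k) is c} b)))
    cover' : ∀ p k → add c Z ∋ p → tri extend p k ≡ true
    cover' p k z with p ≟C c
    ... | yes refl = here' k
    ... | no ne with (p ▸ k) ≟C c
    ... | yes refl = trans (sym (tri-rot extend p k)) (here' (r2 k))
    ... | no ne' with (p ▸ r1 k) ≟C c
    ... | yes refl = trans (sym (tri-rot′ extend p k)) (here' (r4 k))
    ... | no ne'' = trans (tri-cong {n} {extend} p k (extend-off p k ne ne') (extend-off p (r1 k) ne ne'')
          (extend-off (p ▸ k) (r2 k) ne' (λ e → ne'' (trans (sym (▸-next p k)) e)))) (cover pm p k z)

-- Anti-forcing sets and reductions

∈-filterB⁻ : ∀ {A : Set} (p : A → Bool) xs {x} → x ∈ filterB p xs → x ∈ xs × p x ≡ true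
∈-filterB⁻ p (y ∷ xs) i with p y in eq
∈-filterB⁻ p (y ∷ xs) (here refl) | true = here refl , eq
∈-filterB⁻ p (y ∷ xs) (there i) | true = there (proj₁ (∈-filterB⁻ p xs i)) , proj₂ (∈-filterB⁻ p xs i)
... | false = there (proj₁ (∈-filterB⁻ p xs i)) , proj₂ (∈-filterB⁻ p xs i)

∈-filterB⁺ : ∀ {A : Set} (p : A → Bool) xs {x} → x ∈ xs → p x ≡ true → x ∈ filterB p xs
∈-filterB⁺ p (y ∷ xs) (here refl) e rewrite e = here refl
∈-filterB⁺ p (y ∷ xs) (there i) e with p y
... | true = there (∈-filterB⁺ p xs i e)
... | false = ∈-filterB⁺ p xs i e

length-filterB : ∀ {A : Set} (p : A → Bool) xs → length (filterB p xs) ℕ.≤ length xs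
length-filterB p [] = z≤n
length-filterB p (x ∷ xs) with p x
... | true = s≤s (length-filterB p xs)
... | false = ℕP.m≤n⇒m≤1+n (length-filterB p xs)

length-filterB-< : ∀ {A : Set} (p : A → Bool) xs {x} → x ∈ xs → p x ≡ false → suc (length (filterB p xs)) ℕ.≤ length xs
length-filterB-< p (y ∷ xs) (here refl) e rewrite e = s≤s (length-filterB p xs)
length-filterB-< p (y ∷ xs) (there i) e with p y
... | true = s≤s (length-filterB-< p xs i e)
... | false = ℕP.m≤n⇒m≤1+n (length-filterB-< p xs i e)

length-filterB-<<  : ∀ {A : Set} (p : A → Bool) xs {x y} → x ∈ xs → y ∈ xs → x ≢ y → p x ≡ false → p y ≡ false →
  suc (suc (length (filterB p xs))) ℕ.≤ length xs
length-filterB-<< p (z ∷ xs) (here refl) (here refl) ne _ _ = ⊥-elim (ne refl)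
length-filterB-<< p (z ∷ xs) (here refl) (there j) ne e e' rewrite e = s≤s (length-filterB-< p xs j e')
length-filterB-<< p (z ∷ xs) (there i) (here refl) ne e e' rewrite e' = s≤s (length-filterB-< p xs i e)
length-filterB-<< p (z ∷ xs) (there i) (there j) ne e e' with p z
... | true = s≤s (length-filterB-<< p xs i j ne e e')
... | false = ℕP.m≤n⇒m≤1+n (length-filterB-<< p xs i j ne e e')

Avoids : EdgeSet → List Edge → Set
Avoids m S = ∀ e → e ∈ S → m e ≡ false

meets? : ∀ m S → (∃[ e ] (e ∈ S × m e ≡ true)) ⊎ Avoids m S
meets? m [] = inj₂ (λ _ ())
meets? m (x ∷ S) with m x in eq | meets? m S
... | true | _ = inj₁ (x , here refl , eq)
... | false | inj₁ (e , i , t) = inj₁ (e , there i , t)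
... | false | inj₂ a = inj₂ (λ { e (here refl) → eq ; e (there i) → a e i })

AF : CellSet → EdgeSet → List Edge → Set
AF X m S = Avoids m S × (∀ n → PM X n → Avoids n S → ∀ e → n e ≡ m e)

inE : CellSet → EdgeSet
inE Y = darts (λ p _ → Y p)

inE-edge : ∀ Y c i → inE Y (edge c i) ≡ Y c ∨ Y (c ▸ i)
inE-edge Y c i = darts-edge (λ p _ → Y p) c i

inE-cell : ∀ Y c i → Y ∋ c → inE Y ∋ (edge c i)
inE-cell Y c i y rewrite inE-edge Y c i | y = refl

inE-out : ∀ Y c i → Y ∌ c → Y ∌ c ▸ i → inE Y ∌ (edge c i)
inE-out Y c i y y' rewrite inE-edge Y c i | y | y' = refl

dart : ∀ e → e ≡ edge (proj₁ e) (emb (proj₂ e))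
dart (c , zero) = refl
dart (c , suc zero) = refl
dart (c , suc (suc zero)) = refl

edge-ind : (R : Edge → Set) → (∀ c i → R (edge c i)) → ∀ e → R e
edge-ind R f e = subst R (sym (dart e)) (f _ _)

Agree-in : ∀ {Y k m} → Agree Y k m → ∀ e → inE Y ∋ e → m e ≡ k e
Agree-in {Y} {k} {m} ag = edge-ind (λ e → inE Y ∋ e → m e ≡ k e) lem
  where
  lem : ∀ c i → inE Y ∋ (edge c i) → m (edge c i) ≡ k (edge c i)
  lem c i y with ∨-true {Y c} (trans (sym (inE-edge Y c i)) y)
  ... | inj₁ a = ag c i a
  ... | inj₂ b = trans (cong m (sym (edge-flip c i))) (trans (ag (c ▸ i) (r3 i) b) (cong k (edge-flip c i)))

PM-support : ∀ {X m} → PM X m → ∀ e → inE X ∌ e → m e ≡ false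
PM-support {X} {m} pm = edge-ind (λ e → inE X ∌ e → m e ≡ false)
  (λ c i o → let (a , b) = ∨-false {X c} (trans (sym (inE-edge X c i)) o) in off pm c i a b)

PM-resp : ∀ {X m m'} → (∀ e → m e ≡ m' e) → PM X m → PM X m'
PM-resp {X} {m} {m'} eq pm = record
  { off = λ c i a b → trans (sym (eq _)) (off pm c i a b)
  ; cover = λ c i x → trans (tri-cong {m} {m'} c i (sym (eq _)) (sym (eq _)) (sym (eq _))) (cover pm c i x) }

-- A bijection between the perfect matchings of X satisfying P and those of Y satisfying Q,
-- given by agreement on E, which lowers anti-forcing numbers by exactly one.
record Reduction (X Y : CellSet) (P Q : EdgeSet → Bool) : Set where
  field
    -- For a cut along chains these are all edges of `Y`; at a branched hexagon one edge has to be
    -- left out.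
    E : EdgeSet

  Rel : EdgeSet → EdgeSet → Set
  Rel m n = (PM X m × P m ≡ true) × (PM Y n × Q n ≡ true) × (∀ e → E e ≡ true → m e ≡ n e)

  field
    forth : ∀ m → PM X m → P m ≡ true → ∃[ n ] Rel m n
    back  : ∀ n → PM Y n → Q n ≡ true → ∃[ m ] Rel m n
    injˡ  : ∀ {m n m'} → Rel m n → Rel m' n → ∀ e → m e ≡ m' e
    injʳ  : ∀ {m n n'} → Rel m n → Rel m n' → ∀ e → n e ≡ n' e
    lower : ∀ {m n} → Rel m n → ∀ S → AF X m S → ∃[ S' ] (AF Y n S' × suc (length S') ℕ.≤ length S)
    upper : ∀ {m n} → Rel m n → ∀ S' → AF Y n S' → ∃[ S ] (AF X m S × length S ℕ.≤ suc (length S'))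

restrict : CellSet → EdgeSet → EdgeSet
restrict Y m e = m e ∧ inE Y e

restrict-in : ∀ Y m e → inE Y ∋ e → restrict Y m e ≡ m e
restrict-in Y m e i rewrite i with m e
... | true = refl
... | false = refl

restrict-out : ∀ Y m e → inE Y ∌ e → restrict Y m e ≡ false
restrict-out Y m e i rewrite i with m e
... | true = refl
... | false = refl

-- No edge of m outside Y ends at a vertex of Y.
Splits : CellSet → CellSet → EdgeSet → Set
Splits X Y m = ∀ c i → X ∋ c → Y ∌ c → Y ∋ c ▸ i → m (edge c (r1 i)) ≡ false × m (edge c (r5 i)) ≡ false

r53 : ∀ i → r5 (r3 i) ≡ r2 i
r53 i = cong r2 (r6 i)

-- This edge ends at a vertex of `Y` although both its hexagons lie outside `Y`. If one of them is
-- in `X`, it is a hexagon touching `Y` and `Splits` applies to it; otherwise the edge is not in the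
-- graph of `X`.
third-split : ∀ {X Y m} → PM X m → Splits X Y m → ∀ c i → Y ∋ c → Y ∌ c ▸ i → Y ∌ c ▸ r1 i →
  m (edge (c ▸ i) (r2 i)) ≡ false
third-split {X} {Y} {m} pm sp c i y a b with X (c ▸ i) in x | X (c ▸ r1 i) in x'
... | true | _ = trans (cong (λ j → m (edge (c ▸ i) j)) (sym (r53 i))) (proj₂ (sp (c ▸ i) (r3 i) x a (trans (cong Y (▸-opposite c i)) y)))
... | false | true = trans (cong m (sym (third c i))) (proj₁ (sp (c ▸ r1 i) (r4 i) x' b (trans (cong Y (▸-opposite c (r1 i))) y)))
... | false | false = off pm (c ▸ i) (r2 i) x (trans (cong X (▸-next c i)) x')

restrict-PM : ∀ {X Y m} → Y ⊆ X → PM X m → Splits X Y m → PM Y (restrict Y m)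
restrict-PM {X} {Y} {m} sub pm sp = record { off = λ c i a b → restrict-out Y m (edge c i) (inE-out Y c i a b) ; cover = cov }
  where
  cov : ∀ c i → Y ∋ c → tri (restrict Y m) c i ≡ true
  cov c i y = trans (tri-cong {m} {restrict Y m} c i (restrict-in Y m (edge c i) (inE-cell Y c i y)) (restrict-in Y m (edge c (r1 i)) (inE-cell Y c (r1 i) y)) t) (cover pm c i (sub c y))
    where
    t : restrict Y m (edge (c ▸ i) (r2 i)) ≡ m (edge (c ▸ i) (r2 i))
    t with Y (c ▸ i) in a | Y (c ▸ r1 i) in b
    ... | true | _ = restrict-in Y m (edge (c ▸ i) (r2 i)) (inE-cell Y (c ▸ i) (r2 i) a)
    ... | false | true = restrict-in Y m (edge (c ▸ i) (r2 i)) (trans (cong (inE Y) (sym (third c i))) (inE-cell Y (c ▸ r1 i) (r5 i) b))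
    ... | false | false = trans (restrict-out Y m (edge (c ▸ i) (r2 i)) (inE-out Y (c ▸ i) (r2 i) a (trans (cong Y (▸-next c i)) b)))
                          (sym (third-split {X} {Y} {m} pm sp c i y a b))

-- Cutting off the cells K = X ∖ Y, whose part of a matching is determined by the presence of e₀.
-- Lower bound: the hexagon hex ⊆ K alternates and must be hit outside of Y.  Upper bound: deleting e⋆
-- alone forces the part on K once the part on Y is forced.
record Peeling (X Y : CellSet) (e₀ : Edge) (Q : EdgeSet → Bool) : Set₁ where
  field
    sub      : Y ⊆ X
    Q-resp   : ∀ {m n} → (∀ e → m e ≡ n e) → Q m ≡ Q n
    splits   : ∀ {m} → PM X m → m e₀ ≡ true → Splits X Y m
    -- The condition under which the part outside `Y` is the fixed one. It may be weaker than
    -- `m e₀`: in the lower bound uniqueness is tested against all matchings of `Y`, also those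
    -- violating `Q`, and these too must extend with that fixed part.
    Standard : EdgeSet → Set
    standard : ∀ {m} → PM X m → m e₀ ≡ true → Standard m
    fixed    : ∀ {m m'} → PM X m → Standard m → PM X m' → Standard m' →
               ∀ c i → X ∋ c → Y ∌ c → Y ∌ c ▸ i → m (edge c i) ≡ m' (edge c i)
    build    : ∀ n → PM Y n → ∃[ m ] (PM X m × Standard m × Agree Y n m × (Q n ≡ true → m e₀ ≡ true))
    inQ      : ∀ {m} → PM X m → m e₀ ≡ true → Q (restrict Y m) ≡ true
    hex      : Cell
    hex∈X    : X ∋ hex
    hex∉Y    : Y ∌ hex
    alternates : ∀ {m} → PM X m → m e₀ ≡ true → ∀ i → m (edge hex (r1 i)) ≡ not (m (edge hex i))
    hex-free : ∀ {m} → PM X m → m e₀ ≡ true → ∀ i → m (edge hex i) ≡ false → Y ∌ hex ▸ i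
    e⋆       : Edge
    e⋆-out   : ∀ {m} → PM X m → m e₀ ≡ true → m e⋆ ≡ false
    e⋆-splits : ∀ {m} → PM X m → m e⋆ ≡ false → Splits X Y m
    e⋆-forces : ∀ {m} → PM X m → m e⋆ ≡ false → Q (restrict Y m) ≡ true → m e₀ ≡ true

module _ {X Y e₀ Q} (p : Peeling X Y e₀ Q) where
  open Peeling p

  private
    all-fixed : ∀ {m m'} → PM X m → Standard m → PM X m' → Standard m' → ∀ e → inE Y ∌ e → m e ≡ m' e
    all-fixed {m} {m'} pm t pm' t' = edge-ind (λ e → inE Y ∌ e → m e ≡ m' e) lem
      where
      lem : ∀ c i → inE Y ∌ (edge c i) → m (edge c i) ≡ m' (edge c i)
      lem c i o with ∨-false {Y c} (trans (sym (inE-edge Y c i)) o)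
      ... | y , y' with X c in x | X (c ▸ i) in x'
      ... | true | _ = fixed pm t pm' t' c i x y y'
      ... | false | true = trans (cong m (sym (edge-flip c i))) (trans (fixed pm t pm' t' (c ▸ i) (r3 i) x' y' (trans (cong Y (▸-opposite c i)) y)) (cong m' (edge-flip c i)))
      ... | false | false = trans (off pm c i x x') (sym (off pm' c i x x'))

    bool-case : ∀ b → (b ≡ true) ⊎ (b ≡ false)
    bool-case true = inj₁ refl
    bool-case false = inj₂ refl

    all-equal : ∀ {m m'} → PM X m → Standard m → PM X m' → Standard m' → (∀ e → inE Y ∋ e → m e ≡ m' e) → ∀ e → m e ≡ m' e
    all-equal pm t pm' t' ag e with bool-case (inE Y e)
    ... | inj₁ i = ag e i
    ... | inj₂ o = all-fixed pm t pm' t' e o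

    YPM-eq : ∀ {n n'} → PM Y n → PM Y n' → (∀ e → inE Y ∋ e → n e ≡ n' e) → ∀ e → n e ≡ n' e
    YPM-eq pn pn' h e with bool-case (inE Y e)
    ... | inj₁ i = h e i
    ... | inj₂ o = trans (PM-support pn e o) (sym (PM-support pn' e o))

    not≢ : ∀ b → not b ≡ b → ⊥
    not≢ true ()
    not≢ false ()

  reduction : Reduction X Y (λ m → m e₀) Q
  reduction = record
    { E = inE Y
    ; forth = λ m pm t → restrict Y m , (pm , t) , (restrict-PM sub pm (splits pm t) , inQ pm t) , λ e i → sym (restrict-in Y m e i)
    ; back = λ n pn q → let (m , pm , _ , ag , f) = build n pn in m , (pm , f q) , (pn , q) , Agree-in {Y} {n} {m} ag
    ; injˡ = λ { ((pm , t) , _ , ag) ((pm' , t') , _ , ag') → all-equal pm (standard pm t) pm' (standard pm' t') (λ e i → trans (ag e i) (sym (ag' e i))) }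
    ; injʳ = λ { (_ , (pn , _) , ag) (_ , (pn' , _) , ag') → YPM-eq pn pn' (λ e i → trans (sym (ag e i)) (ag' e i)) }
    ; lower = low
    ; upper = upp }
    where
    low : ∀ {m n} → (PM X m × m e₀ ≡ true) × (PM Y n × Q n ≡ true) × (∀ e → inE Y ∋ e → m e ≡ n e) →
      ∀ S → AF X m S → ∃[ S' ] (AF Y n S' × suc (length S') ℕ.≤ length S)
    low {m} {n} ((pm , t) , (pn , q) , ag) S (av , un) = filterB (inE Y) S , (av' , un') , shorter
      where
      m' : EdgeSet
      m' = toggle hex m
      shorter : suc (length (filterB (inE Y) S)) ℕ.≤ length S
      shorter with meets? m' S
      ... | inj₂ a = ⊥-elim (not≢ (m (edge hex d0)) (trans (sym (toggle-on hex m d0)) (un m' (toggle-PM hex pm hex∈X (alternates pm t)) a (edge hex d0))))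
      ... | inj₁ (e , i , te) = length-filterB-< (inE Y) S i (new e te (av e i))
        where
        new : ∀ e → m' e ≡ true → m e ≡ false → inE Y ∌ e
        new = edge-ind (λ e → m' e ≡ true → m e ≡ false → inE Y ∌ e) lem
          where
          lem : ∀ c i → m' (edge c i) ≡ true → m (edge c i) ≡ false → inE Y ∌ (edge c i)
          lem c i a b with c ≟C hex
          ... | yes refl = inE-out Y c i hex∉Y (hex-free pm t i b)
          ... | no ne with (c ▸ i) ≟C hex
          ... | yes refl = trans (cong (inE Y) (sym (edge-flip c i))) (inE-out Y (c ▸ i) (r3 i) hex∉Y (hex-free pm t (r3 i) (trans (cong m (edge-flip c i)) b)))
          ... | no ne' = clash a (trans (toggle-off hex m c i ne ne') b)
      av' : Avoids n (filterB (inE Y) S)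
      av' e i = let (j , y) = ∈-filterB⁻ (inE Y) S i in trans (sym (ag e y)) (av e j)
      un' : ∀ n' → PM Y n' → Avoids n' (filterB (inE Y) S) → ∀ e → n' e ≡ n e
      -- The competitor `n'` is extended by the standard part. Outside `Y` the extension equals `m`,
      -- so it avoids `S` there as well, and `S` forces it to be `m`.
      un' n' pn' a with build n' pn'
      ... | k , pk , st , ag' , _ = YPM-eq pn' pn (λ e y → trans (sym (Agree-in {Y} {n'} {k} ag' e y)) (trans (un k pk avk e) (ag e y)))
        where
        avk : Avoids k S
        avk e i with bool-case (inE Y e)
        ... | inj₁ y = trans (Agree-in {Y} {n'} {k} ag' e y) (a e (∈-filterB⁺ (inE Y) S i y))
        ... | inj₂ o = trans (all-fixed pk st pm (standard pm t) e o) (av e i)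
    upp : ∀ {m n} → (PM X m × m e₀ ≡ true) × (PM Y n × Q n ≡ true) × (∀ e → inE Y ∋ e → m e ≡ n e) →
      ∀ S' → AF Y n S' → ∃[ S ] (AF X m S × length S ℕ.≤ suc (length S'))
    upp {m} {n} ((pm , t) , (pn , q) , ag) S' (av , un) = e⋆ ∷ filterB (inE Y) S' , (av' , un') , s≤s (length-filterB (inE Y) S')
      where
      av' : Avoids m (e⋆ ∷ filterB (inE Y) S')
      av' e (here refl) = e⋆-out pm t
      av' e (there i) = let (j , y) = ∈-filterB⁻ (inE Y) S' i in trans (ag e y) (av e j)
      un' : ∀ m' → PM X m' → Avoids m' (e⋆ ∷ filterB (inE Y) S') → ∀ e → m' e ≡ m e
      un' m' pm' a = all-equal pm' (standard pm' t') pm (standard pm t) (λ e i → trans (sym (restrict-in Y m' e i)) (trans (same e) (sym (ag e i))))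
        where
        st : m' e⋆ ≡ false
        st = a e⋆ (here refl)
        pn' : PM Y (restrict Y m')
        pn' = restrict-PM sub pm' (e⋆-splits pm' st)
        same : ∀ e → restrict Y m' e ≡ n e
        same = un (restrict Y m') pn' av''
          where
          av'' : Avoids (restrict Y m') S'
          av'' e i with bool-case (inE Y e)
          ... | inj₁ y = trans (restrict-in Y m' e y) (a e (there (∈-filterB⁺ (inE Y) S' i y)))
          ... | inj₂ o = restrict-out Y m' e o
        -- The restriction of `m'` is already known to be `n`, hence satisfies `Q`; only with this
        -- can the deletion of `e⋆` force `e₀`.
        t' : m' e₀ ≡ true
        t' = e⋆-forces pm' st (trans (Q-resp same) q)

-- Straight chains

along : Cell → Fin 6 → ℕ → Cell
along c d zero = c
along c d (suc k) = along (c ▸ d) d k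

along-suc : ∀ c d k → along c d (suc k) ≡ along c d k ▸ d
along-suc c d zero = refl
along-suc c d (suc k) = along-suc (c ▸ d) d k

-- the linear functional with value 0 on vec m and 1 on vec (r1 m)
φ : Fin 6 → Cell → ℤ
φ d0 (x , y) = y
φ d1 (x , y) = - x
φ d2 (x , y) = - (x + y)
φ d3 (x , y) = - y
φ d4 (x , y) = x
φ d5 (x , y) = x + y

φ-add : ∀ m c v → φ m (c ⊕C v) ≡ φ m c + φ m v
φ-add d0 c v = refl
φ-add d1 (x , y) (x' , y') = lem x x'
  where lem : ∀ x x' → - (x + x') ≡ - x + - x'
        lem = solve-∀
φ-add d2 (x , y) (x' , y') = lem x x' y y'
  where lem : ∀ x x' y y' → - (x + x' + (y + y')) ≡ - (x + y) + - (x' + y')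
        lem = solve-∀
φ-add d3 (x , y) (x' , y') = lem y y'
  where lem : ∀ x x' → - (x + x') ≡ - x + - x'
        lem = solve-∀
φ-add d4 c v = refl
φ-add d5 (x , y) (x' , y') = lem x x' y y'
  where lem : ∀ x x' y y' → x + x' + (y + y') ≡ x + y + (x' + y')
        lem = solve-∀

φ-along⁺ : ∀ t d → φ t (vec d) ≡ + 1 → ∀ k c → φ t (along c d k) ≡ φ t c + + k
φ-along⁺ t d e zero c = sym (ℤP.+-identityʳ (φ t c))
φ-along⁺ t d e (suc k) c = trans (φ-along⁺ t d e k (c ▸ d))
  (trans (cong (λ z → z + + k) (trans (φ-add t c (vec d)) (cong (ℤ._+_ (φ t c)) e))) (ℤP.+-assoc (φ t c) (+ 1) (+ k)))

φ-along⁻ : ∀ t d → φ t (vec d) ≡ -1ℤ → ∀ k c → φ t (along c d k) ≡ φ t c - + k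
φ-along⁻ t d e zero c = sym (ℤP.+-identityʳ (φ t c))
φ-along⁻ t d e (suc k) c = trans (φ-along⁻ t d e k (c ▸ d))
  (trans (cong (λ z → z - + k) (trans (φ-add t c (vec d)) (cong (ℤ._+_ (φ t c)) e))) (trans (lem (φ t c) (+ k)) refl))
  where lem : ∀ x k → x + -1ℤ - k ≡ x - (+ 1 + k)
        lem = solve-∀

φ-r5 : ∀ d → φ (r5 d) (vec d) ≡ + 1
φ-r5 = six refl refl refl refl refl refl

along-inj : ∀ c d {j k} → along c d j ≡ along c d k → j ≡ k
along-inj c d {j} {k} e = ℤP.+-injective (ℤ-cancelˡ (φ t c) (trans (sym (φ-along⁺ t d (φ-r5 d) j c)) (trans (cong (φ t) e) (φ-along⁺ t d (φ-r5 d) k c))))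
  where t = r5 d

OnRay : Cell → Fin 6 → ℕ → Cell → Set
OnRay c d n x = ∃[ k ] (k ℕ.≤ n × x ≡ along c d k)

-- the maximal ray of X from c in direction d has n further cells
data Ray (X : CellSet) (d : Fin 6) : Cell → ℕ → Set where
  stop : ∀ {c} → X ∌ c ▸ d → Ray X d c zero
  more : ∀ {c n} → X ∋ c ▸ d → Ray X d (c ▸ d) n → Ray X d c (suc n)

ray-in : ∀ {X d c n} → Ray X d c n → ∀ k → k ℕ.< n → X ∋ (along c d (suc k))
ray-in (more x r) zero _ = x
ray-in (more x r) (suc k) (s≤s l) = ray-in r k l

ray-end : ∀ {X d c n} → Ray X d c n → X ∌ (along c d (suc n))
ray-end (stop x) = x
ray-end (more _ r) = ray-end r

ray-in′ : ∀ {X d c n} → X ∋ c → Ray X d c n → ∀ k → k ℕ.≤ n → X ∋ (along c d k)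
ray-in′ x r zero _ = x
ray-in′ x r (suc k) l = ray-in r k l

addRay : CellSet → Cell → Fin 6 → ℕ → CellSet
addRay Z c d zero = Z
addRay Z c d (suc n) = addRay (add (c ▸ d) Z) (c ▸ d) d n

addRay-⊇ : ∀ n {Z c d x} → Z ∋ x → addRay Z c d n x ≡ true
addRay-⊇ zero z = z
addRay-⊇ (suc n) {Z} {c} {d} z = addRay-⊇ n (add-⊇ (c ▸ d) Z z)

addRay-on : ∀ n {Z c d} k → k ℕ.< n → addRay Z c d n (along c d (suc k)) ≡ true
addRay-on (suc n) {Z} {c} {d} zero l = addRay-⊇ n (add-self (c ▸ d) Z)
addRay-on (suc n) (suc k) (s≤s l) = addRay-on n k l

addRay-inv : ∀ n {Z c d x} → addRay Z c d n x ≡ true → Z ∋ x ⊎ ∃[ k ] (k ℕ.< n × x ≡ along c d (suc k))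
addRay-inv zero z = inj₁ z
addRay-inv (suc n) {Z} {c} {d} {x} z with addRay-inv n z
... | inj₂ (k , l , e) = inj₂ (suc k , s≤s l , e)
... | inj₁ z' with ∨-true {x is (c ▸ d)} z'
... | inj₁ e = inj₂ (zero , s≤s z≤n , is-true e)
... | inj₂ z'' = inj₁ z''

add-false : ∀ {c Z x} → x ≢ c → Z ∌ x → add c Z ∌ x
add-false {c} {Z} {x} n z rewrite is-≢ n = z

r55 : ∀ i → r5 (r5 i) ≡ r4 i
r55 i = cong r4 (r6 i)

not-true : ∀ {b} → (b ≡ true → ⊥) → b ≡ false
not-true {true} f = ⊥-elim (f refl)
not-true {false} f = refl

not-false : ∀ {b} → (b ≡ false → ⊥) → b ≡ true
not-false {false} f = ⊥-elim (f refl)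
not-false {true} f = refl

bool-ext : ∀ {a b} → (a ≡ true → b ≡ true) → (b ≡ true → a ≡ true) → a ≡ b
bool-ext {true} {b} f g = sym (f refl)
bool-ext {false} {true} f g = g refl
bool-ext {false} {false} f g = refl

Agree-trans : ∀ {Y Z n m k} → Y ⊆ Z → Agree Y n m → Agree Z m k → Agree Y n k
Agree-trans s a b c i y = trans (b c i (s c y)) (a c i y)

one-first : ∀ {a b c} → one a b c ≡ true → a ≡ true → b ≡ false × c ≡ false
one-first {true} {false} {false} _ _ = refl , refl

one-second : ∀ {a b c} → one a b c ≡ true → b ≡ true → a ≡ false × c ≡ false
one-second {false} {true} {false} _ _ = refl , refl

one-rest₁ : ∀ {a b c} → one a b c ≡ true → b ≡ false → c ≡ false → a ≡ true
one-rest₁ {true} {false} {false} _ _ _ = refl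

one-rest₂ : ∀ {a b c} → one a b c ≡ true → a ≡ false → c ≡ false → b ≡ true
one-rest₂ {false} {true} {false} _ _ _ = refl

module _ {H : CellSet} (good : Good H) {X : CellSet} (X⊆H : X ⊆ H) where

  X-cata : ∀ c i → X ∋ c → X ∋ c ▸ i → X ∌ c ▸ r1 i
  X-cata c i x y = ⊆-out {X} {H} X⊆H (cata good c i (X⊆H c x) (X⊆H _ y))

  X-cataL : ∀ c i → X ∋ c → X ∋ c ▸ i → X ∌ c ▸ r5 i
  X-cataL c i x y = ⊆-out {X} {H} X⊆H (cataL good c i (X⊆H c x) (X⊆H _ y))

  behind : ∀ c d → X ∋ c → X ∋ (c ▸ d) ▸ r3 d
  behind c d x = trans (cong X (▸-opposite c d)) x

  flank₂ : ∀ c d → X ∋ c → X ∋ c ▸ d → X ∌ (c ▸ d) ▸ r2 d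
  flank₂ c d x y = trans (cong (λ j → X ((c ▸ d) ▸ j)) (sym (r53 d))) (X-cataL (c ▸ d) (r3 d) y (behind c d x))

  flank₄ : ∀ c d → X ∋ c → X ∋ c ▸ d → X ∌ (c ▸ d) ▸ r4 d
  flank₄ c d x y = X-cata (c ▸ d) (r3 d) y (behind c d x)

  -- A new ray cell can have neighbours in `Z` only behind it and beside it, in the directions
  -- `r3 d`, `r1 d` and `r5 d`: the flanks `r2 d` and `r4 d` are empty by `cata`, and the cell ahead
  -- is not there yet. These directions form an alternating triple, so `Extend` applies cell by
  -- cell, going outwards.
  rayExtend : ∀ d n c Z m → X ∋ c → Ray X d c n → Z ⊆ X → (∀ k → k ℕ.< n → Z ∌ (along c d (suc k))) → PM Z m →
    ∃[ m' ] (PM (addRay Z c d n) m' × Agree Z m m' × addRay Z c d n ⊆ X)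
  rayExtend d zero c Z m xc r sub fresh pm = m , pm , (λ _ _ _ → refl) , sub
  rayExtend d (suc n) c Z m xc (more x r) sub fresh pm =
    let (m' , pm' , ag , sub') = rayExtend d n c' (add c' Z) E.extend x r sub'' fresh' E.extend-PM
    in m' , pm' , Agree-trans {Z} {add c' Z} {m} {E.extend} {m'} (λ y z → add-⊇ c' Z z) E.extend-agrees ag , sub'
    where
    c' = c ▸ d
    free : ∀ k → inA (r1 d) k ≡ false → Z ∌ c' ▸ k
    free k a with dirs d k
    ... | is0 = next n r fresh
      where
      next : ∀ n → Ray X d c' n → (∀ k → k ℕ.< suc n → Z ∌ (along c d (suc k))) → Z ∌ c' ▸ d
      next zero (stop e) _ = ⊆-out {Z} {X} sub e
      next (suc n) _ f = f 1 (s≤s (s≤s z≤n))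
    ... | is1 = clash (inA0 (r1 d)) a
    ... | is2 = ⊆-out {Z} {X} sub (flank₂ c d xc x)
    ... | is3 = clash (inA2 (r1 d)) a
    ... | is4 = ⊆-out {Z} {X} sub (flank₄ c d xc x)
    ... | is5 = clash (inA4 (r1 d)) a
    module E = Extend Z m pm c' (r1 d) (fresh zero (s≤s z≤n)) free
    sub'' : add c' Z ⊆ X
    sub'' y z with ∨-true {y is c'} z
    ... | inj₁ e = trans (cong X (is-true e)) x
    ... | inj₂ e = sub y e
    fresh' : ∀ k → k ℕ.< n → add c' Z ∌ (along c' d (suc k))
    fresh' k l = add-false {c'} {Z} (λ e → ℕP.1+n≢0 (along-inj c' d {suc k} {zero} e)) (fresh (suc k) (s≤s l))

  growRays : ∀ {Y L} i d d' n n' → Y ⊆ X → X ∋ L → Y ∌ L → (∀ k → inA i k ≡ false → Y ∌ L ▸ k) →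
    Ray X d L n → Ray X d' L n' → (∀ k → k ℕ.≤ n → Y ∌ (along L d k)) → (∀ k → k ℕ.≤ n' → Y ∌ (along L d' k)) →
    (∀ j k → along L d (suc j) ≢ along L d' k) → (∀ x → X ∋ x → Y ∌ x → OnRay L d n x ⊎ OnRay L d' n' x) →
    ∀ k → PM Y k → ∃[ m ] (PM X m × Agree Y k m × (∀ j → inA i j ≡ true → Y ∌ L ▸ j → m (edge L j) ≡ true))
  growRays {Y} {L} i d d' n n' Y⊆X L∈X L∉Y free ray ray' cut cut' apart rest k pk = mB , PM-cong Z≗X (proj₁ (proj₂ B))
      , Agree-trans {Y} {Z₁} {k} {E.extend} {mB} (λ y z → add-⊇ L Y z) E.extend-agrees
        (Agree-trans {Z₁} {Z₂} {E.extend} {mA} {mB} (λ y z → addRay-⊇ n {Z₁} {L} {d} z) agA agB)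
      , λ j a o → trans (agB L j (addRay-⊇ n {Z₁} {L} {d} (add-self L Y))) (trans (agA L j (add-self L Y)) (E.extend-new j a o))
    where
    module E = Extend Y k pk L i L∉Y free
    Z₁ = add L Y
    sub₁ : Z₁ ⊆ X
    sub₁ y z with ∨-true {y is L} z
    ... | inj₁ e = trans (cong X (is-true e)) L∈X
    ... | inj₂ e = Y⊆X y e
    new : ∀ e j → Y ∌ (along L e (suc j)) → Z₁ ∌ (along L e (suc j))
    new e j o = add-false {L} {Y} (λ q → ℕP.1+n≢0 (along-inj L e {suc j} {0} q)) o
    A = rayExtend d n L Z₁ E.extend L∈X ray sub₁ (λ j l → new d j (cut (suc j) l)) E.extend-PM
    mA = proj₁ A
    agA = proj₁ (proj₂ (proj₂ A))
    Z₂ = addRay Z₁ L d n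
    fresh₂ : ∀ j → j ℕ.< n' → Z₂ ∌ (along L d' (suc j))
    fresh₂ j l = not-true λ z → bad (addRay-inv n {Z₁} {L} {d} z)
      where
      bad : Z₁ ∋ (along L d' (suc j)) ⊎ ∃[ i ] (i ℕ.< n × along L d' (suc j) ≡ along L d (suc i)) → ⊥
      bad (inj₁ z) = clash z (new d' j (cut' (suc j) l))
      bad (inj₂ (i , _ , e)) = apart i (suc j) (sym e)
    B = rayExtend d' n' L Z₂ mA L∈X ray' (proj₂ (proj₂ (proj₂ A))) fresh₂ (proj₁ (proj₂ A))
    mB = proj₁ B
    agB = proj₁ (proj₂ (proj₂ B))
    Z≗X : ∀ c → addRay Z₂ L d' n' c ≡ X c
    Z≗X c = bool-ext (proj₂ (proj₂ (proj₂ B)) c) all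
      where
      inZ₁ : Z₁ ∋ c → addRay Z₂ L d' n' c ≡ true
      inZ₁ z = addRay-⊇ n' {Z₂} {L} {d'} (addRay-⊇ n {Z₁} {L} {d} z)
      inL : c ≡ L → addRay Z₂ L d' n' c ≡ true
      inL refl = inZ₁ (add-self L Y)
      all : X ∋ c → addRay Z₂ L d' n' c ≡ true
      all x with Y c in y
      ... | true = inZ₁ (add-⊇ L Y y)
      ... | false with rest c x y
      ... | inj₁ (zero , _ , e) = inL e
      ... | inj₂ (zero , _ , e) = inL e
      ... | inj₁ (suc i , l , e) = addRay-⊇ n' {Z₂} {L} {d'} (trans (cong Z₂ e) (addRay-on n {Z₁} {L} {d} i l))
      ... | inj₂ (suc i , l , e) = trans (cong (addRay Z₂ L d' n') e) (addRay-on n' {Z₂} {L} {d'} i l)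

  -- The pattern on a chain away from its vertical edge: the slanted sides pointing forward are used
  -- and the vertical ones are not. `f1` and `f5` are conditional since a branch attached at a
  -- slanted side may match the ends of that side itself.
  record Forced (m : EdgeSet) (d : Fin 6) (c : Cell) : Set where
    field
      f0 : m (edge c d) ≡ false
      f1 : X ∌ c ▸ r1 d → m (edge c (r1 d)) ≡ true
      f2 : m (edge c (r2 d)) ≡ false
      f3 : m (edge c (r3 d)) ≡ false
      f4 : m (edge c (r4 d)) ≡ false
      f5 : X ∌ c ▸ r5 d → m (edge c (r5 d)) ≡ true
  open Forced public

  module Rays {m : EdgeSet} (pm : PM X m) where
    open Flux good X⊆H pm using (flux; flux′) public

    -- a ray cell whose entrance vertices are matched elsewhere
    module Entered (c : Cell) (d : Fin 6) (x : X ∋ c) (xb : X ∋ c ▸ r3 d)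
      (e2 : m (edge c (r2 d)) ≡ false) (e4 : m (edge c (r4 d)) ≡ false) where

      side₁ : X ∌ c ▸ r1 d → m (edge c (r1 d)) ≡ true
      side₁ o = one-rest₁ (cover pm c (r1 d) x) e2 (off pm (c ▸ r1 d) (r3 d) o
        (trans (cong X (▸-next c (r1 d))) (trans (cong (λ j → X (c ▸ j)) (sym (r53 d))) (X-cataL c (r3 d) x xb))))

      side₅ : X ∌ c ▸ r5 d → m (edge c (r5 d)) ≡ true
      side₅ o = one-rest₂ (cover pm c (r4 d) x) e4 (off pm (c ▸ r4 d) (r2 (r4 d)) (X-cata c (r3 d) x xb)
        (trans (cong X (▸-next c (r4 d))) o))

      front : m (edge c d) ≡ false
      front with X (c ▸ r1 d) in y
      ... | false = proj₁ (one-second (cover pm c d x) (side₁ y))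
      ... | true = trans (trans (cong (λ j → m (edge c j)) (sym (r6 d))) (flux c (r1 d) x y)) e2

    enter : ∀ c d → X ∋ c → m (edge c (r1 d)) ≡ true → m (edge c (r5 d)) ≡ true →
      m (edge c d) ≡ false × m (edge (c ▸ d) (r2 d)) ≡ false × m (edge (c ▸ d) (r4 d)) ≡ false
    enter c d x a b = proj₁ p , proj₂ p , proj₂ (one-second (coverL pm c d x) b)
      where p = one-second (cover pm c d x) a

    forcedRay : ∀ d {n c} → X ∋ c → m (edge c (r1 d)) ≡ true → m (edge c (r5 d)) ≡ true → Ray X d c n →
      ∀ k → k ℕ.< n → Forced m d (along c d (suc k))
    forcedRay d {suc n} {c} x a b (more y r) k l = res k l
      where
      c' = c ▸ d
      en = enter c d x a b
      open Entered c' d y (behind c d x) (proj₁ (proj₂ en)) (proj₂ (proj₂ en))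
      first : Forced m d c'
      first = record { f0 = front ; f1 = side₁ ; f2 = proj₁ (proj₂ en) ; f3 = trans (cong m (edge-flip c d)) (proj₁ en)
                     ; f4 = proj₂ (proj₂ en) ; f5 = side₅ }
      res : ∀ k → k ℕ.< suc n → Forced m d (along c' d k)
      res zero _ = first
      res (suc k) (s≤s l) = rec r l
        where
        rec : ∀ {n} → Ray X d c' n → k ℕ.< n → Forced m d (along c' d (suc k))
        rec (more y' r') l = forcedRay d y (side₁ (X-cata c' d y y')) (side₅ (X-cataL c' d y y')) (more y' r') k l

φ-0 : ∀ d → φ d (vec d) ≡ 0ℤ
φ-0 = six refl refl refl refl refl refl

φ-r1 : ∀ d → φ d (vec (r1 d)) ≡ + 1
φ-r1 = six refl refl refl refl refl refl

φ-r2 : ∀ d → φ d (vec (r2 d)) ≡ + 1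
φ-r2 = six refl refl refl refl refl refl

φ-neg : ∀ d i → φ (r3 d) (vec i) ≡ - φ d (vec i)
φ-neg d0 i = refl
φ-neg d1 i = sym (ℤP.neg-involutive _)
φ-neg d2 i = sym (ℤP.neg-involutive _)
φ-neg d3 i = sym (ℤP.neg-involutive _)
φ-neg d4 i = refl
φ-neg d5 i = refl

vec-r3 : ∀ m i → φ m (vec (r3 i)) ≡ - φ m (vec i)
vec-r3 m i = lem (φ m (vec i)) (φ m (vec (r3 i))) (trans (sym (φ-add m (vec i) (vec (r3 i)))) (trans (cong (φ m) (opp i)) (z m)))
  where
  lem : ∀ a b → a + b ≡ 0ℤ → b ≡ - a
  lem a b e = trans (l a b) (trans (cong (λ t → t - a) e) (ℤP.+-identityˡ (- a)))
    where l : ∀ a b → b ≡ a + b - a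
          l = solve-∀
  opp : ∀ i → vec i ▸ r3 i ≡ (0ℤ , 0ℤ)
  opp = six refl refl refl refl refl refl
  z : ∀ m → φ m (0ℤ , 0ℤ) ≡ 0ℤ
  z = six refl refl refl refl refl refl

φ-r4 : ∀ d → φ d (vec (r4 d)) ≡ -1ℤ
φ-r4 d = trans (vec-r3 d (r1 d)) (cong -_ (φ-r1 d))

φ-r5′ : ∀ d → φ d (vec (r5 d)) ≡ -1ℤ
φ-r5′ d = trans (vec-r3 d (r2 d)) (cong -_ (φ-r2 d))

φ-along⁰ : ∀ d k c → φ d (along c d k) ≡ φ d c
φ-along⁰ d zero c = refl
φ-along⁰ d (suc k) c = trans (φ-along⁰ d k (c ▸ d)) (trans (φ-add d c (vec d)) (trans (cong (ℤ._+_ (φ d c)) (φ-0 d)) (ℤP.+-identityʳ (φ d c))))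

flank-∉ : ∀ c d k j x → φ d (vec x) ≢ 0ℤ → along c d k ▸ x ≢ along c d j
flank-∉ c d k j x nz e = nz (ℤ-cancelˡ (φ d c) (trans (cong (λ z → z + φ d (vec x)) (sym (φ-along⁰ d k c)))
  (trans (sym (φ-add d (along c d k) (vec x))) (trans (cong (φ d) e) (trans (φ-along⁰ d j c) (sym (ℤP.+-identityʳ (φ d c))))))))

-- a functional separating two rays from c with an angle of 120°
record Separates (t d d' : Fin 6) : Set where
  field
    on  : φ t (vec d) ≡ + 1
    on' : φ t (vec d') ≡ -1ℤ
    s₁  : ∃[ e ] (φ t (vec (r1 d)) ≡ + e)
    s₅  : ∃[ e ] (φ t (vec (r5 d)) ≡ + e)

sepˡ : ∀ m → Separates m (r1 m) (r5 m)
sepˡ m = record { on = φ-r1 m ; on' = φ-r5′ m ; s₁ = 1 , φ-r2 m ; s₅ = 0 , trans (cong (λ j → φ m (vec j)) (r6 m)) (φ-0 m) }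

sepʳ : ∀ m → Separates (r3 m) (r5 m) (r1 m)
sepʳ m = record { on = trans (φ-neg m (r5 m)) (cong -_ (φ-r5′ m)) ; on' = trans (φ-neg m (r1 m)) (cong -_ (φ-r1 m))
  ; s₁ = 0 , trans (cong (λ j → φ (r3 m) (vec j)) (r6 m)) (trans (φ-neg m m) (cong -_ (φ-0 m)))
  ; s₅ = 1 , trans (cong (λ j → φ (r3 m) (vec j)) (r55 m)) (trans (φ-neg m (r4 m)) (cong -_ (φ-r4 m))) }

pos≢neg : ∀ k j → + suc k ≢ - + j
pos≢neg k zero ()
pos≢neg k (suc j) ()

sep-∉ : ∀ {t d d'} → Separates t d d' → ∀ c k j x → (∃[ e ] (φ t (vec x) ≡ + e)) → along c d (suc k) ▸ x ≢ along c d' j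
sep-∉ {t} {d} {d'} s c k j x (e , ee) eq = pos≢neg (k ℕ.+ e) j (ℤ-cancelˡ (φ t c)
  (trans (trans (sym (ℤP.+-assoc (φ t c) (+ suc k) (+ e)))
    (trans (cong₂ _+_ (sym (φ-along⁺ t d (Separates.on s) (suc k) c)) (sym ee)) (sym (φ-add t (along c d (suc k)) (vec x)))))
   (trans (cong (φ t) eq) (φ-along⁻ t d' (Separates.on' s) j c))))

sep-≢ : ∀ {t d d'} → Separates t d d' → ∀ c k j → along c d (suc k) ≢ along c d' j
sep-≢ {t} {d} {d'} s c k j eq = pos≢neg k j (ℤ-cancelˡ (φ t c)
  (trans (sym (φ-along⁺ t d (Separates.on s) (suc k) c)) (trans (cong (φ t) eq) (φ-along⁻ t d' (Separates.on' s) j c))))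

+1≢0 : ∀ {x : ℤ} → x ≡ + 1 → x ≢ 0ℤ
+1≢0 refl ()

-1≢0 : ∀ {x : ℤ} → x ≡ -1ℤ → x ≢ 0ℤ
-1≢0 refl ()

-- Cutting off rays, stars, tails and forks

module RaySide {H : CellSet} (good : Good H) {X Y : CellSet} (X⊆H : X ⊆ H) (Y⊆X : Y ⊆ X)
  (L : Cell) (L∈X : X ∋ L) (d : Fin 6) (n : ℕ) (ray : Ray X d L n)
  (cut : ∀ k → k ℕ.≤ n → Y ∌ (along L d k)) where

  cell : ℕ → Cell
  cell k = along L d (suc k)

  cell∈X : ∀ k → k ℕ.< n → X ∋ (cell k)
  cell∈X k l = ray-in ray k l

  prev : ∀ k → cell k ▸ r3 d ≡ along L d k
  prev k = trans (cong (λ x → x ▸ r3 d) (along-suc L d k)) (▸-opposite (along L d k) d)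

  prev∈X : ∀ k → k ℕ.< n → X ∋ (along L d k)
  prev∈X k l = ray-in′ L∈X ray k (ℕP.<⇒≤ l)

  private
    step∈X : ∀ k → k ℕ.< n → X ∋ along L d k ▸ d
    step∈X k l = trans (cong X (sym (along-suc L d k))) (cell∈X k l)

  out₂ : ∀ k → k ℕ.< n → X ∌ cell k ▸ r2 d
  out₂ k l = trans (cong (λ x → X (x ▸ r2 d)) (along-suc L d k)) (flank₂ good X⊆H (along L d k) d (prev∈X k l) (step∈X k l))

  out₄ : ∀ k → k ℕ.< n → X ∌ cell k ▸ r4 d
  out₄ k l = trans (cong (λ x → X (x ▸ r4 d)) (along-suc L d k)) (flank₄ good X⊆H (along L d k) d (prev∈X k l) (step∈X k l))

  ahead : ∀ k → k ℕ.≤ n → Y ∌ along L d k ▸ d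
  ahead k l with k ℕ.≟ n
  ... | yes refl = ⊆-out {Y} {X} Y⊆X (trans (cong X (sym (along-suc L d k))) (ray-end ray))
  ... | no ne = trans (cong Y (sym (along-suc L d k))) (cut (suc k) (ℕP.≤∧≢⇒< l ne))

  module _ {m : EdgeSet} (pm : PM X m) (t1 : m (edge L (r1 d)) ≡ true) (t5 : m (edge L (r5 d)) ≡ true) where

    forced : ∀ k → k ℕ.< n → Forced good X⊆H m d (cell k)
    forced k l = Rays.forcedRay good X⊆H pm d L∈X t1 t5 ray k l

    splits-ray : ∀ k → k ℕ.< n → ∀ i → Y ∋ cell k ▸ i → m (edge (cell k) (r1 i)) ≡ false × m (edge (cell k) (r5 i)) ≡ false
    splits-ray k l i y with dirs d i
    ... | is0 = clash y (ahead (suc k) l)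
    ... | is1 = f2 (forced k l) , trans (cong (λ j → m (edge (cell k) j)) (r6 d)) (f0 (forced k l))
    ... | is2 = clash (Y⊆X _ y) (out₂ k l)
    ... | is3 = clash y (trans (cong Y (prev k)) (cut k (ℕP.<⇒≤ l)))
    ... | is4 = clash (Y⊆X _ y) (out₄ k l)
    ... | is5 = trans (cong (λ j → m (edge (cell k) j)) (r6 d)) (f0 (forced k l)) , trans (cong (λ j → m (edge (cell k) j)) (r55 d)) (f4 (forced k l))

  fixed-ray : ∀ {m m'} → PM X m → m (edge L (r1 d)) ≡ true → m (edge L (r5 d)) ≡ true →
    PM X m' → m' (edge L (r1 d)) ≡ true → m' (edge L (r5 d)) ≡ true →
    ∀ k → k ℕ.< n → (X ∋ cell k ▸ r1 d → Y ∋ cell k ▸ r1 d) →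
    (X ∋ cell k ▸ r5 d → Y ∋ cell k ▸ r5 d) →
    ∀ i → Y ∌ cell k ▸ i → m (edge (cell k) i) ≡ m' (edge (cell k) i)
  fixed-ray {m} {m'} pm a b pm' a' b' k l s1 s5 i y = go (dirs d i) y
    where
    F = forced pm a b k l
    F' = forced pm' a' b' k l
    go : ∀ {i} → Dir d i → Y ∌ cell k ▸ i → m (edge (cell k) i) ≡ m' (edge (cell k) i)
    go is0 _ = trans (f0 F) (sym (f0 F'))
    go is1 y = trans (f1 F o) (sym (f1 F' o))
      where o = not-true (λ x → clash (s1 x) y)
    go is2 _ = trans (f2 F) (sym (f2 F'))
    go is3 _ = trans (f3 F) (sym (f3 F'))
    go is4 _ = trans (f4 F) (sym (f4 F'))
    go is5 y = trans (f5 F o) (sym (f5 F' o))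
      where o = not-true (λ x → clash (s5 x) y)

-- The hexagon L has neighbours only in the directions r1 m and r5 m; an edge m of L in a matching
-- determines the matching along both rays from L.
module Star {H : CellSet} (good : Good H) {X Y : CellSet} (X⊆H : X ⊆ H) (Y⊆X : Y ⊆ X)
  (L : Cell) (L∈X : X ∋ L) (m₀ : Fin 6)
  (o0 : X ∌ L ▸ m₀) (o2 : X ∌ L ▸ r2 m₀)
  (o3 : X ∌ L ▸ r3 m₀) (o4 : X ∌ L ▸ r4 m₀)
  (n n' : ℕ) (ray : Ray X (r1 m₀) L n) (ray' : Ray X (r5 m₀) L n')
  (cut : ∀ k → k ℕ.≤ n → Y ∌ (along L (r1 m₀) k))
  (cut' : ∀ k → k ℕ.≤ n' → Y ∌ (along L (r5 m₀) k))
  (rest : ∀ x → X ∋ x → Y ∌ x → OnRay L (r1 m₀) n x ⊎ OnRay L (r5 m₀) n' x) where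

  private
    module R = RaySide good X⊆H Y⊆X L L∈X (r1 m₀) n ray cut
    module R' = RaySide good X⊆H Y⊆X L L∈X (r5 m₀) n' ray' cut'

    e₀ : Edge
    e₀ = edge L m₀

    sub-dir : ∀ (m : EdgeSet) {i j} → i ≡ j → m (edge L i) ≡ m (edge L j)
    sub-dir m e = cong (λ j → m (edge L j)) e

    X-dir : ∀ {i j b} → i ≡ j → X (L ▸ j) ≡ b → X (L ▸ i) ≡ b
    X-dir e x = trans (cong (λ j → X (L ▸ j)) e) x

    same2 : ∀ {m} → PM X m → m (edge L (r2 m₀)) ≡ m (edge L m₀)
    same2 {m} pm = trans (flux′ L (r1 m₀) L∈X o2 (X-dir (r6 m₀) o0)) (sub-dir m (r6 m₀))
      where open Rays good X⊆H pm
    same4 : ∀ {m} → PM X m → m (edge L (r4 m₀)) ≡ m (edge L m₀)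
    same4 {m} pm = trans (sym (sub-dir m (r55 m₀))) (trans (sym (flux′ L (r5 m₀) L∈X (X-dir (r6 m₀) o0) (X-dir (r55 m₀) o4))) (sub-dir m (r6 m₀)))
      where open Rays good X⊆H pm

    around : ∀ {m} → PM X m → m e₀ ≡ true → Hexagon m L m₀ true
    around {m} pm t = hexagon t (proj₁ (one-first (cover pm L m₀ L∈X) t)) (trans (same2 pm) t)
      (proj₁ (one-first (cover pm L (r2 m₀) L∈X) (trans (same2 pm) t))) (trans (same4 pm) t) (proj₁ (one-first (coverL pm L m₀ L∈X) t))

    right₁ : ∀ {m} → PM X m → m e₀ ≡ true → m (edge L (r1 (r1 m₀))) ≡ true
    right₁ pm t = a2 (around pm t)
    right₅ : ∀ {m} → PM X m → m e₀ ≡ true → m (edge L (r5 (r1 m₀))) ≡ true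
    right₅ {m} pm t = trans (sub-dir m (r6 m₀)) t
    left₁ : ∀ {m} → PM X m → m e₀ ≡ true → m (edge L (r1 (r5 m₀))) ≡ true
    left₁ {m} pm t = trans (sub-dir m (r6 m₀)) t
    left₅ : ∀ {m} → PM X m → m e₀ ≡ true → m (edge L (r5 (r5 m₀))) ≡ true
    left₅ {m} pm t = trans (sub-dir m (r55 m₀)) (a4 (around pm t))

    L∉Y : Y ∌ L
    L∉Y = cut 0 z≤n

    isolated : ∀ i → Y ∌ L ▸ i
    isolated i with dirs m₀ i
    ... | is0 = ⊆-out {Y} {X} Y⊆X o0
    ... | is1 = R.ahead 0 z≤n
    ... | is2 = ⊆-out {Y} {X} Y⊆X o2
    ... | is3 = ⊆-out {Y} {X} Y⊆X o3
    ... | is4 = ⊆-out {Y} {X} Y⊆X o4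
    ... | is5 = R'.ahead 0 z≤n

    splits : ∀ {m} → PM X m → m e₀ ≡ true → Splits X Y m
    splits {m} pm t c i x y y' with rest c x y
    ... | inj₁ (zero , l , refl) = clash y' (isolated i)
    ... | inj₂ (zero , l , refl) = clash y' (isolated i)
    ... | inj₁ (suc k , l , refl) = R.splits-ray pm (right₁ pm t) (right₅ pm t) k l i y'
    ... | inj₂ (suc k , l , refl) = R'.splits-ray pm (left₁ pm t) (left₅ pm t) k l i y'

    side : ∀ k x → φ (r1 m₀) (vec x) ≢ 0ℤ → (∃[ e ] (φ m₀ (vec x) ≡ + e)) → X ∋ R.cell k ▸ x → Y ∋ R.cell k ▸ x
    side k x nz s xx = not-false λ y → bad (rest _ xx y)
      where
      bad : OnRay L (r1 m₀) n (R.cell k ▸ x) ⊎ OnRay L (r5 m₀) n' (R.cell k ▸ x) → ⊥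
      bad (inj₁ (j , _ , e)) = flank-∉ L (r1 m₀) (suc k) j x nz e
      bad (inj₂ (j , _ , e)) = sep-∉ (sepˡ m₀) L k j x s e

    side' : ∀ k x → φ (r5 m₀) (vec x) ≢ 0ℤ → (∃[ e ] (φ (r3 m₀) (vec x) ≡ + e)) → X ∋ R'.cell k ▸ x → Y ∋ R'.cell k ▸ x
    side' k x nz s xx = not-false λ y → bad (rest _ xx y)
      where
      bad : OnRay L (r1 m₀) n (R'.cell k ▸ x) ⊎ OnRay L (r5 m₀) n' (R'.cell k ▸ x) → ⊥
      bad (inj₁ (j , _ , e)) = sep-∉ (sepʳ m₀) L k j x s e
      bad (inj₂ (j , _ , e)) = flank-∉ L (r5 m₀) (suc k) j x nz e

    fixed : ∀ {m m'} → PM X m → m e₀ ≡ true → PM X m' → m' e₀ ≡ true →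
      ∀ c i → X ∋ c → Y ∌ c → Y ∌ c ▸ i → m (edge c i) ≡ m' (edge c i)
    fixed {m} {m'} pm t pm' t' c i x y y' with rest c x y
    ... | inj₁ (suc k , l , refl) = R.fixed-ray pm (right₁ pm t) (right₅ pm t) pm' (right₁ pm' t') (right₅ pm' t') k l
          (side k (r2 m₀) (+1≢0 (φ-r1 (r1 m₀))) (Separates.s₁ (sepˡ m₀)))
          (side k (r5 (r1 m₀)) (-1≢0 (φ-r5′ (r1 m₀))) (Separates.s₅ (sepˡ m₀))) i y'
    ... | inj₂ (suc k , l , refl) = R'.fixed-ray pm (left₁ pm t) (left₅ pm t) pm' (left₁ pm' t') (left₅ pm' t') k l
          (side' k (r1 (r5 m₀)) (+1≢0 (φ-r1 (r5 m₀))) (Separates.s₁ (sepʳ m₀)))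
          (side' k (r5 (r5 m₀)) (-1≢0 (φ-r5′ (r5 m₀))) (Separates.s₅ (sepʳ m₀))) i y'
    ... | inj₁ (zero , _ , refl) = hexagon-same (around pm t) (around pm' t') i
    ... | inj₂ (zero , _ , refl) = hexagon-same (around pm t) (around pm' t') i

    build : ∀ k → PM Y k → ∃[ m ] (PM X m × m e₀ ≡ true × Agree Y k m × (true ≡ true → m e₀ ≡ true))
    build k pk = let (m , pm , ag , new) = growRays good X⊆H m₀ (r1 m₀) (r5 m₀) n n' Y⊆X L∈X L∉Y (λ i _ → isolated i) ray ray' cut cut'
                           (λ j → sep-≢ (sepˡ m₀) L j) rest k pk
                     t = new m₀ (inA0 m₀) (isolated m₀)
                 in m , pm , t , ag , λ _ → t

    -- At the vertex between `r2 m₀` and `r3 m₀` there is no third edge in the graph, so `r2 m₀`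
    -- must be used, and flux carries this over to `m₀`. Hence `edge L (r3 m₀)` serves as `e⋆`.
    r3-forces : ∀ {m} → PM X m → m (edge L (r3 m₀)) ≡ false → m e₀ ≡ true
    r3-forces pm f = trans (sym (same2 pm)) (one-rest₁ (cover pm L (r2 m₀) L∈X) f (off pm (L ▸ r2 m₀) (r4 m₀) o2 (trans (cong X (▸-next L (r2 m₀))) o3)))

  peeling : Peeling X Y e₀ (λ _ → true)
  peeling = record
    { sub = Y⊆X ; Q-resp = λ _ → refl ; splits = splits ; Standard = λ m → m e₀ ≡ true ; standard = λ _ t → t ; fixed = fixed
    ; build = build ; inQ = λ _ _ → refl ; hex = L ; hex∈X = L∈X ; hex∉Y = L∉Y ; alternates = λ pm t → hexagon-alternates (around pm t) ; hex-free = λ _ _ i _ → isolated i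
    ; e⋆ = edge L (r3 m₀) ; e⋆-out = λ pm t → a3 (around pm t) ; e⋆-splits = λ pm f → splits pm (r3-forces pm f) ; e⋆-forces = λ pm f _ → r3-forces pm f }

-- A straight terminal tail hanging on the edge e of the hexagon h.
module Tail {H : CellSet} (good : Good H) {X : CellSet} (X⊆H : X ⊆ H)
  (h : Cell) (h∈X : X ∋ h) (e : Fin 6) (n : ℕ) (L∈X : X ∋ h ▸ e) (ray : Ray X e (h ▸ e) n)
  (bare₁ : ∀ k → k ℕ.≤ n → X ∌ along (h ▸ e) e k ▸ r1 e)
  (bare₅ : ∀ k → k ℕ.≤ n → X ∌ along (h ▸ e) e k ▸ r5 e) where

  L : Cell
  L = h ▸ e

  Entry : EdgeSet → Set
  Entry m = m (edge L (r2 e)) ≡ false × m (edge L (r4 e)) ≡ false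

  record Values (m : EdgeSet) (c : Cell) : Set where
    field
      v0 : m (edge c e) ≡ false
      v1 : m (edge c (r1 e)) ≡ true
      v2 : m (edge c (r2 e)) ≡ false
      v4 : m (edge c (r4 e)) ≡ false
      v5 : m (edge c (r5 e)) ≡ true
  open Values public

  values : ∀ {m} → PM X m → Entry m → ∀ k → k ℕ.≤ n → Values m (along L e k)
  values {m} pm (a , b) = vals
    where
    open Rays good X⊆H pm
    open Entered L e L∈X (trans (cong X (▸-opposite h e)) h∈X) a b
    vals : ∀ k → k ℕ.≤ n → Values m (along L e k)
    vals zero l = record { v0 = front ; v1 = side₁ (bare₁ 0 l) ; v2 = a ; v4 = b ; v5 = side₅ (bare₅ 0 l) }
    vals (suc k) l = record { v0 = f0 F ; v1 = f1 F (bare₁ (suc k) l) ; v2 = f2 F ; v4 = f4 F ; v5 = f5 F (bare₅ (suc k) l) }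
      where F = forcedRay e L∈X (side₁ (bare₁ 0 z≤n)) (side₅ (bare₅ 0 z≤n)) ray k l

  prev : ∀ k → along L e (suc k) ▸ r3 e ≡ along L e k
  prev k = trans (cong (λ x → x ▸ r3 e) (along-suc L e k)) (▸-opposite (along L e k) e)

  back-edge : ∀ k → edge (along L e (suc k)) (r3 e) ≡ edge (along L e k) e
  back-edge k = trans (cong (λ x → edge x (r3 e)) (along-suc L e k)) (edge-flip (along L e k) e)

  values-fixed : ∀ {m m'} → PM X m → Entry m → PM X m' → Entry m' → ∀ k → k ℕ.≤ n → ∀ i →
    edge (along L e k) i ≡ edge h e ⊎ m (edge (along L e k) i) ≡ m' (edge (along L e k) i)
  values-fixed {m} {m'} pm en pm' en' k l i = cases (dirs e i)
    where
    V = values pm en k l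
    V' = values pm' en' k l
    entrance : ∀ k → k ℕ.≤ n → edge (along L e k) (r3 e) ≡ edge h e ⊎ m (edge (along L e k) (r3 e)) ≡ m' (edge (along L e k) (r3 e))
    entrance zero _ = inj₁ (edge-flip h e)
    entrance (suc k) l = inj₂ (trans (trans (cong m (back-edge k)) (v0 (values pm en k (ℕP.<⇒≤ l))))
      (sym (trans (cong m' (back-edge k)) (v0 (values pm' en' k (ℕP.<⇒≤ l))))))
    cases : ∀ {i} → Dir e i → edge (along L e k) i ≡ edge h e ⊎ m (edge (along L e k) i) ≡ m' (edge (along L e k) i)
    cases is0 = inj₂ (trans (v0 V) (sym (v0 V')))
    cases is1 = inj₂ (trans (v1 V) (sym (v1 V')))
    cases is2 = inj₂ (trans (v2 V) (sym (v2 V')))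
    cases is3 = entrance k l
    cases is4 = inj₂ (trans (v4 V) (sym (v4 V')))
    cases is5 = inj₂ (trans (v5 V) (sym (v5 V')))

  entry : ∀ {m} → PM X m → m (edge h e) ≡ true → Entry m
  entry pm t = proj₂ (one-first (cover pm h e h∈X) t) , proj₂ (one-first (coverL pm h e h∈X) t)

  hexagon₁ : ∀ {m} → PM X m → m (edge h e) ≡ true → Hexagon m L e false
  hexagon₁ {m} pm t = hexagon (v0 V) (v1 V) (v2 V) (trans (cong m (edge-flip h e)) t) (v4 V) (v5 V)
    where V = values pm (entry pm t) 0 z≤n

-- Here `h` is kept: the edge shared with the tail survives as a side of `h` and must be used in `Y`
-- too. `Standard` is the weaker `T.Entry`, which fixes the tail whether or not that edge is used.
module Stub {H : CellSet} (good : Good H) {X Y : CellSet} (X⊆H : X ⊆ H) (Y⊆X : Y ⊆ X)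
  (h : Cell) (h∈Y : Y ∋ h) (d : Fin 6) (L∈X : X ∋ h ▸ d)
  (n : ℕ) (ray : Ray X d (h ▸ d) n)
  (cut : ∀ k → k ℕ.≤ n → Y ∌ along (h ▸ d) d k)
  (bare₁ : ∀ k → k ℕ.≤ n → X ∌ along (h ▸ d) d k ▸ r1 d)
  (bare₅ : ∀ k → k ℕ.≤ n → X ∌ along (h ▸ d) d k ▸ r5 d)
  (rest : ∀ x → X ∋ x → Y ∌ x → OnRay (h ▸ d) d n x) where

  private
    L : Cell
    L = h ▸ d
    h∈X = Y⊆X h h∈Y
    module R = RaySide good X⊆H Y⊆X L L∈X d n ray cut

    module T = Tail good X⊆H h h∈X d n L∈X ray bare₁ bare₅
    open T using (v0; v1; v2; v4; v5)

    e₀ : Edge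
    e₀ = edge h d

    elsewhere : ∀ i → Y ∋ L ▸ i → i ≡ r3 d
    elsewhere i y with dirs d i
    ... | is0 = clash y (R.ahead 0 z≤n)
    ... | is1 = clash (Y⊆X _ y) (bare₁ 0 z≤n)
    ... | is2 = clash (Y⊆X _ y) (flank₂ good X⊆H h d h∈X L∈X)
    ... | is3 = refl
    ... | is4 = clash (Y⊆X _ y) (flank₄ good X⊆H h d h∈X L∈X)
    ... | is5 = clash (Y⊆X _ y) (bare₅ 0 z≤n)

    splits : ∀ {m} → PM X m → T.Entry m → Splits X Y m
    splits {m} pm st c i x y y' with rest c x y
    ... | zero , _ , refl with elsewhere i y'
    ... | refl = proj₂ st , trans (cong (λ j → m (edge L j)) (r53 d)) (proj₁ st)
    splits {m} pm st c i x y y' | suc k , l , refl = R.splits-ray pm (v1 (T.values pm st 0 z≤n)) (v5 (T.values pm st 0 z≤n)) k l i y'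

    fixed : ∀ {m m'} → PM X m → T.Entry m → PM X m' → T.Entry m' →
      ∀ c i → X ∋ c → Y ∌ c → Y ∌ c ▸ i → m (edge c i) ≡ m' (edge c i)
    fixed {m} {m'} pm st pm' st' c i x y y' with rest c x y
    ... | k , l , refl with T.values-fixed pm st pm' st' k l i
    ... | inj₂ e = e
    ... | inj₁ e = clash (trans (cong (inE Y) e) (inE-cell Y h d h∈Y)) (inE-out Y (along L d k) i y y')

    build : ∀ k → PM Y k → ∃[ m ] (PM X m × T.Entry m × Agree Y k m × (k e₀ ≡ true → m e₀ ≡ true))
    build k pk = mA , pmA , (entry₂ , entry₄) , agA , (λ t → trans (agA h d h∈Y) t)
      where
      fresh : ∀ j → j ℕ.< suc n → Y ∌ (along h d (suc j))
      fresh j (s≤s l) = cut j l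
      A = rayExtend good X⊆H d (suc n) h Y k h∈X (more L∈X ray) Y⊆X fresh pk
      mA = proj₁ A
      agA = proj₁ (proj₂ (proj₂ A))
      all : ∀ c → X ∋ c → addRay Y h d (suc n) c ≡ true
      all c x with Y c in y
      ... | true = addRay-⊇ (suc n) {Y} {h} {d} y
      ... | false with rest c x y
      ... | j , l , e = trans (cong (addRay Y h d (suc n)) e) (addRay-on (suc n) {Y} {h} {d} j (s≤s l))
      pmA : PM X mA
      pmA = PM-cong (λ c → bool-ext (proj₂ (proj₂ (proj₂ A)) c) (all c)) (proj₁ (proj₂ A))
      Y-off : ∀ i → X ∌ h ▸ i → Y ∌ h ▸ i
      Y-off i = ⊆-out {Y} {X} Y⊆X
      match : ∀ {a b c a' b' c'} → one a b c ≡ true → one a' b' c' ≡ true → a' ≡ a → b' ≡ b → c ≡ false → c' ≡ false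
      match {true} {false} {false} {c' = false} _ _ refl refl _ = refl
      match {false} {true} {false} {c' = false} _ _ refl refl _ = refl
      match {false} {false} {true} _ _ _ _ ()
      entry₂ : mA (edge L (r2 d)) ≡ false
      entry₂ = match (cover pk h d h∈Y) (cover pmA h d h∈X) (agA h d h∈Y) (agA h (r1 d) h∈Y)
        (off pk L (r2 d) (cut 0 z≤n) (trans (cong Y (▸-next h d)) (Y-off (r1 d) (X-cata good X⊆H h d h∈X L∈X))))
      entry₄ : mA (edge L (r4 d)) ≡ false
      entry₄ = match (coverL pk h d h∈Y) (coverL pmA h d h∈X) (agA h d h∈Y) (agA h (r5 d) h∈Y)
        (off pk L (r4 d) (cut 0 z≤n) (trans (cong Y (▸-prev h d)) (Y-off (r5 d) (X-cataL good X⊆H h d h∈X L∈X))))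

    -- Flux through the shared edge makes `r2 d` and `r4 d` of `L` used together or not at all, so
    -- deleting one of them closes both entrances.
    e⋆-standard : ∀ {m} → PM X m → m (edge L (r2 d)) ≡ false → T.Entry m
    e⋆-standard {m} pm f = f , trans (sym (flux L (r3 d) L∈X (trans (cong X (▸-opposite h d)) h∈X))) (trans (cong (λ j → m (edge L j)) (r53 d)) f)
      where open Rays good X⊆H pm

    restrict-e₀ : ∀ m → restrict Y m e₀ ≡ m e₀
    restrict-e₀ m = restrict-in Y m e₀ (inE-cell Y h d h∈Y)

    free : ∀ {m} → PM X m → m e₀ ≡ true → ∀ i → m (edge L i) ≡ false → Y ∌ L ▸ i
    free {m} pm t i f = not-true λ y → clash (trans (cong (λ j → m (edge L j)) (elsewhere i y)) (trans (cong m (edge-flip h d)) t)) f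

  peeling : Peeling X Y e₀ (λ m → m e₀)
  peeling = record
    { sub = Y⊆X ; Q-resp = λ e → e e₀ ; splits = λ pm t → splits pm (T.entry pm t) ; Standard = T.Entry ; standard = T.entry ; fixed = fixed
    ; build = build ; inQ = λ {m} _ t → trans (restrict-e₀ m) t ; hex = L ; hex∈X = L∈X ; hex∉Y = cut 0 z≤n ; alternates = λ pm t → hexagon-alternates (T.hexagon₁ pm t) ; hex-free = free
    ; e⋆ = edge L (r2 d) ; e⋆-out = λ pm t → proj₁ (T.entry pm t) ; e⋆-splits = λ pm f → splits pm (e⋆-standard pm f)
    ; e⋆-forces = λ {m} _ _ q → trans (sym (restrict-e₀ m)) q }

-- A branched hexagon h with two straight terminal tails, in the directions r2 d and r4 d.
module Fork {H : CellSet} (good : Good H) {X Y : CellSet} (X⊆H : X ⊆ H) (Y⊆X : Y ⊆ X)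
  (h : Cell) (h∈X : X ∋ h) (h∉Y : Y ∌ h) (d : Fin 6) (L∈Y : Y ∋ h ▸ d)
  (n n' : ℕ)
  (c∈X : X ∋ h ▸ r2 d) (ray : Ray X (r2 d) (h ▸ r2 d) n)
  (c∈X' : X ∋ h ▸ r4 d) (ray' : Ray X (r4 d) (h ▸ r4 d) n')
  (bare₁ : ∀ k → k ℕ.≤ n → X ∌ along (h ▸ r2 d) (r2 d) k ▸ r1 (r2 d))
  (bare₅ : ∀ k → k ℕ.≤ n → X ∌ along (h ▸ r2 d) (r2 d) k ▸ r5 (r2 d))
  (bare₁′ : ∀ k → k ℕ.≤ n' → X ∌ along (h ▸ r4 d) (r4 d) k ▸ r1 (r4 d))
  (bare₅′ : ∀ k → k ℕ.≤ n' → X ∌ along (h ▸ r4 d) (r4 d) k ▸ r5 (r4 d))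
  (cut : ∀ k → k ℕ.≤ suc n → Y ∌ (along h (r2 d) k))
  (cut' : ∀ k → k ℕ.≤ suc n' → Y ∌ (along h (r4 d) k))
  (rest : ∀ x → X ∋ x → Y ∌ x → OnRay h (r2 d) (suc n) x ⊎ OnRay h (r4 d) (suc n') x) where

  private
    module T = Tail good X⊆H h h∈X (r2 d) n c∈X ray bare₁ bare₅
    module T' = Tail good X⊆H h h∈X (r4 d) n' c∈X' ray' bare₁′ bare₅′
    module R = RaySide good X⊆H Y⊆X h h∈X (r2 d) (suc n) (more c∈X ray) cut
    module R' = RaySide good X⊆H Y⊆X h h∈X (r4 d) (suc n') (more c∈X' ray') cut'

    s f : Edge
    s = edge h d
    f = edge h (r1 d)

    L∈X : X ∋ h ▸ d
    L∈X = Y⊆X _ L∈Y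

    h-dir : ∀ (m : EdgeSet) {i j} → i ≡ j → m (edge h i) ≡ m (edge h j)
    h-dir m e = cong (λ j → m (edge h j)) e

    out1 : X ∌ h ▸ r1 d
    out1 = X-cata good X⊆H h d h∈X L∈X
    out3 : X ∌ h ▸ r3 d
    out3 = X-cata good X⊆H h (r2 d) h∈X c∈X
    out5 : X ∌ h ▸ r5 d
    out5 = X-cataL good X⊆H h d h∈X L∈X

    only-d : ∀ i → Y ∋ h ▸ i → i ≡ d
    only-d i y with dirs d i
    ... | is0 = refl
    ... | is1 = clash (Y⊆X _ y) out1
    ... | is2 = clash y (cut 1 (s≤s z≤n))
    ... | is3 = clash (Y⊆X _ y) out3
    ... | is4 = clash y (cut' 1 (s≤s z≤n))
    ... | is5 = clash (Y⊆X _ y) out5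

    -- With `f-three`, flux through the common edges with `h ▸ d` and `h ▸ r2 d` shows that the
    -- sides `r1 d`, `r3 d`, `r5 d` of `h` are used together or not at all, so `f` stands for the
    -- whole triple.
    f-five : ∀ {m} → PM X m → m (edge h (r5 d)) ≡ m f
    f-five pm = flux h d h∈X L∈X
      where open Rays good X⊆H pm
    f-three : ∀ {m} → PM X m → m (edge h (r3 d)) ≡ m f
    f-three {m} pm = trans (sym (flux h (r2 d) h∈X c∈X)) (h-dir m (cong r1 (r6 d)))
      where open Rays good X⊆H pm

    tail-alone : ∀ k → k ℕ.< suc n → ∀ i → Y ∌ R.cell k ▸ i
    tail-alone k l i with dirs (r2 d) i
    ... | is0 = R.ahead (suc k) l
    ... | is1 = ⊆-out {Y} {X} Y⊆X (bare₁ k (ℕP.≤-pred l))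
    ... | is2 = ⊆-out {Y} {X} Y⊆X (R.out₂ k l)
    ... | is3 = trans (cong Y (R.prev k)) (cut k (ℕP.<⇒≤ l))
    ... | is4 = ⊆-out {Y} {X} Y⊆X (R.out₄ k l)
    ... | is5 = ⊆-out {Y} {X} Y⊆X (bare₅ k (ℕP.≤-pred l))

    tail-alone′ : ∀ k → k ℕ.< suc n' → ∀ i → Y ∌ R'.cell k ▸ i
    tail-alone′ k l i with dirs (r4 d) i
    ... | is0 = R'.ahead (suc k) l
    ... | is1 = ⊆-out {Y} {X} Y⊆X (bare₁′ k (ℕP.≤-pred l))
    ... | is2 = ⊆-out {Y} {X} Y⊆X (R'.out₂ k l)
    ... | is3 = trans (cong Y (R'.prev k)) (cut' k (ℕP.<⇒≤ l))
    ... | is4 = ⊆-out {Y} {X} Y⊆X (R'.out₄ k l)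
    ... | is5 = ⊆-out {Y} {X} Y⊆X (bare₅′ k (ℕP.≤-pred l))

    splits : ∀ {m} → PM X m → m f ≡ false → Splits X Y m
    splits {m} pm o c i x y y' with rest c x y
    ... | inj₁ (suc k , l , refl) = clash y' (tail-alone k l i)
    ... | inj₂ (suc k , l , refl) = clash y' (tail-alone′ k l i)
    ... | inj₁ (zero , _ , refl) rewrite only-d i y' = o , trans (f-five pm) o
    ... | inj₂ (zero , _ , refl) rewrite only-d i y' = o , trans (f-five pm) o

    Entries : EdgeSet → Set
    Entries m = T.Entry m × T'.Entry m

    outside : ∀ {m m'} → PM X m → Entries m → PM X m' → Entries m' → ∀ e → inE Y ∌ e →
      (∃[ i ] (e ≡ edge h i)) ⊎ m e ≡ m' e
    outside {m} {m'} pm (a , b) pm' (a' , b') = edge-ind (λ e → inE Y ∌ e → (∃[ i ] (e ≡ edge h i)) ⊎ m e ≡ m' e) lem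
      where
      wrap : ∀ {e j} → e ≡ edge h j ⊎ m e ≡ m' e → (∃[ i ] (e ≡ edge h i)) ⊎ m e ≡ m' e
      wrap (inj₁ q) = inj₁ (_ , q)
      wrap (inj₂ q) = inj₂ q
      cell : ∀ c i → X ∋ c → Y ∌ c → (∃[ j ] (edge c i ≡ edge h j)) ⊎ m (edge c i) ≡ m' (edge c i)
      cell c i x y with rest c x y
      ... | inj₁ (zero , _ , refl) = inj₁ (i , refl)
      ... | inj₂ (zero , _ , refl) = inj₁ (i , refl)
      ... | inj₁ (suc k , l , refl) = wrap (T.values-fixed pm a pm' a' k (ℕP.≤-pred l) i)
      ... | inj₂ (suc k , l , refl) = wrap (T'.values-fixed pm b pm' b' k (ℕP.≤-pred l) i)
      flip : ∀ {e e'} → e ≡ e' → (∃[ i ] (e ≡ edge h i)) ⊎ m e ≡ m' e → (∃[ i ] (e' ≡ edge h i)) ⊎ m e' ≡ m' e'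
      flip refl r = r
      lem : ∀ c i → inE Y ∌ (edge c i) → (∃[ j ] (edge c i ≡ edge h j)) ⊎ m (edge c i) ≡ m' (edge c i)
      lem c i o with ∨-false {Y c} (trans (sym (inE-edge Y c i)) o)
      ... | y , y' with X c in x | X (c ▸ i) in x'
      ... | true | _ = cell c i x y
      ... | false | true = flip (edge-flip c i) (cell (c ▸ i) (r3 i) x' y')
      ... | false | false = inj₂ (trans (off pm c i x x') (sym (off pm' c i x x')))

    around-F : ∀ {m} → PM X m → m f ≡ true → Hexagon m h d false
    around-F {m} pm t = hexagon (proj₁ (one-second (cover pm h d h∈X) t)) t (proj₁ (one-second (cover pm h (r2 d) h∈X) t3)) t3
        (proj₁ (one-first (cover pm h (r3 d) h∈X) t3)) (trans (f-five pm) t)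
      where t3 = trans (f-three pm) t

    entries-F : ∀ {m} → PM X m → m f ≡ true → Entries m
    entries-F {m} pm t = proj₂ (enter h (r2 d) h∈X (a3 A) (trans (h-dir m (cong r1 (r6 d))) (a1 A)))
                       , proj₂ (enter h (r4 d) h∈X (a5 A) (trans (h-dir m (cong r3 (r6 d))) (a3 A)))
      where
      open Rays good X⊆H pm
      A = around-F pm t

    -- The edge `s` is left out: a matching using `f` does not use it, whereas its partner on `Y`,
    -- obtained after toggling `h`, does.
    E : EdgeSet
    E e = inE Y e ∧ not (does (e ≟E s))

    s∈E : inE Y ∋ s
    s∈E = trans (cong (inE Y) (sym (edge-flip h d))) (inE-cell Y (h ▸ d) (r3 d) L∈Y)

    E-in : ∀ {e} → E e ≡ true → inE Y ∋ e × e ≢ s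
    E-in {e} t with inE Y e | e ≟E s
    ... | true | no ne = refl , ne

    data Kind (e : Edge) : Set where
      kept    : E e ≡ true → Kind e
      is-s    : e ≡ s → Kind e
      outer   : inE Y ∌ e → Kind e

    kind : ∀ e → Kind e
    kind e with inE Y e in y | e ≟E s in q
    ... | false | _ = outer y
    ... | true | yes r = is-s r
    ... | true | no ne = kept (trans (cong₂ (λ a b → a ∧ not (does b)) y q) refl)

    h-edge : ∀ i → inE Y ∋ (edge h i) → edge h i ≡ s
    h-edge i y with ∨-true {Y h} (trans (sym (inE-edge Y h i)) y)
    ... | inj₁ y' = clash y' h∉Y
    ... | inj₂ y' = cong (edge h) (only-d i y')

    toggle-E : ∀ m e → E e ≡ true → toggle h m e ≡ m e
    toggle-E m = edge-ind (λ e → E e ≡ true → toggle h m e ≡ m e) lem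
      where
      lem : ∀ c i → E (edge c i) ≡ true → toggle h m (edge c i) ≡ m (edge c i)
      lem c i t with E-in t
      ... | y , ne with c ≟C h
      ... | yes refl = ⊥-elim (ne (h-edge i y))
      ... | no nc with (c ▸ i) ≟C h
      ... | no nc' = toggle-off h m c i nc nc'
      ... | yes refl = ⊥-elim (ne (trans (sym (edge-flip c i)) (h-edge (r3 i) (trans (cong (inE Y) (edge-flip c i)) y))))

    Rel : EdgeSet → EdgeSet → Set
    Rel m k = (PM X m × m f ≡ true) × (PM Y k × k s ≡ true) × (∀ e → E e ≡ true → m e ≡ k e)

    -- While `f` is used, the restriction to `Y` would leave both ends of `s` uncovered. Toggling
    -- `h` replaces the triple by `d`, `r2 d`, `r4 d`; the ends of `s` are then matched to each
    -- other and `Y` splits off.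
    forth : ∀ m → PM X m → m f ≡ true → ∃[ k ] Rel m k
    forth m pm t = restrict Y m₁ , (pm , t) , (restrict-PM Y⊆X pm₁ (splits pm₁ f₁) , trans (restrict-in Y m₁ s s∈E) s₁)
        , λ e q → sym (trans (restrict-in Y m₁ e (proj₁ (E-in q))) (toggle-E m e q))
      where
      A = around-F pm t
      m₁ = toggle h m
      pm₁ = toggle-PM h pm h∈X (hexagon-alternates A)
      f₁ : m₁ f ≡ false
      f₁ = trans (toggle-on h m (r1 d)) (cong not (a1 A))
      s₁ : m₁ s ≡ true
      s₁ = trans (toggle-on h m d) (cong not (a0 A))

    -- Works whether or not `k` uses `s`: of the triple `d`, `r2 d`, `r4 d` at `h`, side `d` is left
    -- to `Y` and the two edges to the tails are used.
    grow : ∀ k → PM Y k → ∃[ m ] (PM X m × m (edge h (r2 d)) ≡ true × m (edge h (r4 d)) ≡ true × Agree Y k m)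
    grow k pk = finish (growRays good X⊆H d (r4 d) (r2 d) (suc n') (suc n) Y⊆X h∈X h∉Y
        (λ i a → not-true λ y → clash (trans (cong (inA d) (only-d i y)) (inA0 d)) a)
        (more c∈X' ray') (more c∈X ray) cut' cut (λ j → sep-≢ (subst (Separates (r3 d) (r4 d)) (r53 d) (sepˡ (r3 d))) h j)
        (λ x t o → swap (rest x t o)) k pk)
      where
      finish : ∃[ m ] (PM X m × Agree Y k m × (∀ j → inA d j ≡ true → Y ∌ h ▸ j → m (edge h j) ≡ true)) →
        ∃[ m ] (PM X m × m (edge h (r2 d)) ≡ true × m (edge h (r4 d)) ≡ true × Agree Y k m)
      finish (m , pm , ag , new) = m , pm , new (r2 d) (inA2 d) (cut 1 (s≤s z≤n)) , new (r4 d) (inA4 d) (cut' 1 (s≤s z≤n)) , ag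

    f-off : ∀ {m} → PM X m → m (edge h (r2 d)) ≡ true → m f ≡ false
    f-off pm t = proj₁ (one-second (cover pm h (r1 d) h∈X) t)

    around-S : ∀ {m} → PM X m → m (edge h (r2 d)) ≡ true → m (edge h (r4 d)) ≡ true → m s ≡ true → Hexagon m h d true
    around-S {m} pm t2 t4 t0 = hexagon t0 (f-off pm t2) t2 (trans (f-three pm) (f-off pm t2)) t4 (trans (f-five pm) (f-off pm t2))

    back : ∀ k → PM Y k → k s ≡ true → ∃[ m ] Rel m k
    back k pk t = finish (grow k pk)
      where
      finish : ∃[ m ] (PM X m × m (edge h (r2 d)) ≡ true × m (edge h (r4 d)) ≡ true × Agree Y k m) → ∃[ m ] Rel m k
      finish (m , pm , t2 , t4 , ag) = toggle h m , (toggle-PM h pm h∈X (hexagon-alternates A) , trans (toggle-on h m (r1 d)) (cong not (a1 A))) , (pk , t)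
          , λ e q → trans (toggle-E m e q) (Agree-in {Y} {k} {m} ag e (proj₁ (E-in q)))
        where A = around-S pm t2 t4 (trans (Agree-in {Y} {k} {m} ag s s∈E) t)

    outer-same : ∀ {m m'} → PM X m → m f ≡ true → PM X m' → m' f ≡ true → ∀ e → inE Y ∌ e → m e ≡ m' e
    outer-same pm t pm' t' e o with outside pm (entries-F pm t) pm' (entries-F pm' t') e o
    ... | inj₂ q = q
    ... | inj₁ (i , refl) = hexagon-same (around-F pm t) (around-F pm' t') i

    injˡ : ∀ {m k m'} → Rel m k → Rel m' k → ∀ e → m e ≡ m' e
    injˡ ((pm , t) , _ , ag) ((pm' , t') , _ , ag') e with kind e
    ... | kept q = trans (ag e q) (sym (ag' e q))
    ... | is-s refl = trans (a0 (around-F pm t)) (sym (a0 (around-F pm' t')))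
    ... | outer o = outer-same pm t pm' t' e o

    injʳ′ : ∀ {m m' k k'} → Rel m k → Rel m' k' → (∀ e → m e ≡ m' e) → ∀ e → k e ≡ k' e
    injʳ′ (_ , (pk , t) , ag) (_ , (pk' , t') , ag') eq e with kind e
    ... | kept q = trans (sym (ag e q)) (trans (eq e) (ag' e q))
    ... | is-s refl = trans t (sym t')
    ... | outer o = trans (PM-support pk e o) (sym (PM-support pk' e o))

    upper : ∀ {m k} → Rel m k → ∀ S' → AF Y k S' → ∃[ S ] (AF X m S × length S ℕ.≤ suc (length S'))
    upper {m} {k} R@((pm , t) , (pk , tk) , ag) S' (av , un) = s ∷ filterB E S' , (av' , un') , s≤s (length-filterB E S')
      where
      av' : Avoids m (s ∷ filterB E S')
      av' e (here refl) = a0 (around-F pm t)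
      av' e (there i) = let (j , q) = ∈-filterB⁻ E S' i in trans (ag e q) (av e j)
      un' : ∀ m' → PM X m' → Avoids m' (s ∷ filterB E S') → ∀ e → m' e ≡ m e
      un' m' pm' a = by (m' f) refl
        where
        avoid : ∀ k' → PM Y k' → (∀ e → E e ≡ true → k' e ≡ m' e) → Avoids k' S'
        avoid k' pk' agk e i = on (kind e)
          where
          on : Kind e → k' e ≡ false
          on (kept q) = trans (agk e q) (a e (there (∈-filterB⁺ E S' i q)))
          on (is-s q) = clash tk (trans (cong k (sym q)) (av e i))
          on (outer o) = PM-support pk' e o
        inF : ∃[ k' ] Rel m' k' → ∀ e → m' e ≡ m e
        inF (k' , mm , (pk' , tk') , ag') = injˡ (mm , (pk , tk) , λ e q → trans (ag' e q) (same e)) R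
          where
          same : ∀ e → k' e ≡ k e
          same = un k' pk' (avoid k' pk' (λ e q → sym (ag' e q)))
        by : ∀ b → m' f ≡ b → ∀ e → m' e ≡ m e
        by true fe = inF (forth m' pm' fe)
        by false fe = clash tk (trans (sym (same s)) (trans (restrict-in Y m' s s∈E) (a s (here refl))))
          where
          pr : PM Y (restrict Y m')
          pr = restrict-PM Y⊆X pm' (splits pm' fe)
          same : ∀ e → restrict Y m' e ≡ k e
          same = un (restrict Y m') pr (avoid (restrict Y m') pr (λ e q → restrict-in Y m' e (proj₁ (E-in q))))

    E-false : ∀ {e} → inE Y ∌ e → E e ≡ false
    E-false o rewrite o = refl

    extended-unique : ∀ {m k} → Rel m k → ∀ S → AF X m S → ∀ k' → PM Y k' → k' s ≡ true → Avoids k' (filterB E S) → ∀ e → k' e ≡ k e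
    extended-unique {m} {k} R@((pm , t) , _ , ag) S (av , un) k' pk' t' a = finish (back k' pk' t')
      where
      finish : ∃[ m' ] Rel m' k' → ∀ e → k' e ≡ k e
      finish (m' , R'@((pm' , t″) , _ , ag')) = injʳ′ R' R (un m' pm' avoid)
        where
        avoid : Avoids m' S
        avoid e i = on (kind e)
          where
          on : Kind e → m' e ≡ false
          on (kept q) = trans (ag' e q) (a e (∈-filterB⁺ E S i q))
          on (is-s q) = trans (cong m' q) (a0 (around-F pm' t″))
          on (outer o) = trans (outer-same pm' t″ pm t e o) (av e i)

    toggle-far : ∀ c → Y ∌ c → (∀ i → Y ∌ c ▸ i) → ∀ m e → inE Y ∋ e → toggle c m e ≡ m e
    toggle-far c c∉Y alone m = edge-ind (λ e → inE Y ∋ e → toggle c m e ≡ m e) lem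
      where
      lem : ∀ p i → inE Y ∋ (edge p i) → toggle c m (edge p i) ≡ m (edge p i)
      lem p i y with p ≟C c
      ... | yes refl = clash y (inE-out Y p i c∉Y (alone i))
      ... | no n₁ with (p ▸ i) ≟C c
      ... | no n₂ = toggle-off c m p i n₁ n₂
      ... | yes refl = clash (trans (cong (inE Y) (edge-flip p i)) y) (inE-out Y (p ▸ i) (r3 i) c∉Y (alone (r3 i)))

    -- If N avoids S outside of one edge e of an alternating hexagon c of a tail, its toggle yields a second edge of S.
    second : ∀ {m N} → PM X m → m f ≡ true → ∀ S → AF X m S → PM X N → N f ≡ false → N s ≡ false → (∀ e → E e ≡ true → e ∈ S → N e ≡ false) →
      ∀ c → X ∋ c → Y ∌ c → (∀ i → Y ∌ c ▸ i) → c ≢ h → (∀ i → N (edge c (r1 i)) ≡ not (N (edge c i))) →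
      ∀ j → edge c j ∈ S → N (edge c j) ≡ true → ∃[ e' ] (e' ∈ S × E e' ≡ false × e' ≢ edge c j)
    second {m} {N} pm t S (av , un) pN fN sN aN c c∈X c∉Y alone c≢h alt j j∈S tj = search (meets? N' S)
      where
      N' = toggle c N
      search : (∃[ e ] (e ∈ S × N' e ≡ true)) ⊎ Avoids N' S → ∃[ e' ] (e' ∈ S × E e' ≡ false × e' ≢ edge c j)
      search (inj₂ a) = clash (trans (un N' (toggle-PM c pN c∈X alt) a f) t)
        (trans (toggle-off c N h (r1 d) (λ e → c≢h (sym e)) (λ e → clash c∈X (trans (cong X (sym e)) out1))) fN)
      search (inj₁ (e , i , te)) = e , i , not-true outE , differs
        where
        outE : E e ≡ true → ⊥
        outE q = clash te (trans (toggle-far c c∉Y alone N e (proj₁ (E-in q))) (aN e q i))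
        differs : e ≢ edge c j
        differs q = clash (trans (cong N' (sym q)) te) (trans (toggle-on c N j) (cong not tj))

    -- The extension `N` of `k'` lacks `f`, so `S` must hit it, and outside `E`. Away from `h` it
    -- coincides there with `m`, so the edge hit joins `h` to a tail. The first hexagon of that tail
    -- alternates in `N`, and toggling it gives a matching still lacking `f`, which by `second`
    -- costs another edge of `S`.
    two : ∀ {m k} → Rel m k → ∀ S → AF X m S → ∀ k' → PM Y k' → k' s ≡ false → Avoids k' (filterB E S) → suc (suc (length (filterB E S))) ℕ.≤ length S
    two {m} {k} R@((pm , t) , _ , ag) S A@(av , un) k' pk' sk a = finish (grow k' pk')
      where
      finish : ∃[ N ] (PM X N × N (edge h (r2 d)) ≡ true × N (edge h (r4 d)) ≡ true × Agree Y k' N) → suc (suc (length (filterB E S))) ℕ.≤ length S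
      finish (N , pN , t2 , t4 , agN) = search (meets? N S)
        where
        fN = f-off pN t2
        sN = trans (Agree-in {Y} {k'} {N} agN s s∈E) sk
        aN : ∀ e → E e ≡ true → e ∈ S → N e ≡ false
        aN e q i = trans (Agree-in {Y} {k'} {N} agN e (proj₁ (E-in q))) (a e (∈-filterB⁺ E S i q))
        pair : ∀ {e} → e ∈ S → E e ≡ false → ∃[ e' ] (e' ∈ S × E e' ≡ false × e' ≢ e) → suc (suc (length (filterB E S))) ℕ.≤ length S
        pair i o (e' , i' , o' , ne) = length-filterB-<< E S i i' (λ q → ne (sym q)) o o'
        at-h : ∀ j → Dir d j → edge h j ∈ S → N (edge h j) ≡ true → inE Y ∌ (edge h j) → suc (suc (length (filterB E S))) ℕ.≤ length S
        at-h _ is0 i te _ = clash te sN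
        at-h _ is1 i te _ = clash te fN
        at-h _ is3 i te _ = clash te (trans (f-three pN) fN)
        at-h _ is5 i te _ = clash te (trans (f-five pN) fN)
        at-h _ is2 i te o = pair i (E-false o) (subst (λ x → ∃[ e' ] (e' ∈ S × E e' ≡ false × e' ≢ x)) (edge-flip h (r2 d))
          (second pm t S A pN fN sN aN T.L c∈X (cut 1 (s≤s z≤n)) (tail-alone 0 (s≤s z≤n)) (▸-≢ h (r2 d)) (hexagon-alternates (T.hexagon₁ pN t2))
            (r3 (r2 d)) (subst (_∈ S) (sym (edge-flip h (r2 d))) i) (trans (cong N (edge-flip h (r2 d))) te)))
        at-h _ is4 i te o = pair i (E-false o) (subst (λ x → ∃[ e' ] (e' ∈ S × E e' ≡ false × e' ≢ x)) (edge-flip h (r4 d))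
          (second pm t S A pN fN sN aN T'.L c∈X' (cut' 1 (s≤s z≤n)) (tail-alone′ 0 (s≤s z≤n)) (▸-≢ h (r4 d)) (hexagon-alternates (T'.hexagon₁ pN t4))
            (r3 (r4 d)) (subst (_∈ S) (sym (edge-flip h (r4 d))) i) (trans (cong N (edge-flip h (r4 d))) te)))
        search : (∃[ e ] (e ∈ S × N e ≡ true)) ⊎ Avoids N S → suc (suc (length (filterB E S))) ℕ.≤ length S
        search (inj₂ av') = clash (trans (un N pN av' f) t) fN
        search (inj₁ (e , i , te)) = by (kind e)
          where
          by : Kind e → suc (suc (length (filterB E S))) ℕ.≤ length S
          by (kept q) = clash te (aN e q i)
          by (is-s q) = clash te (trans (cong N q) sN)
          by (outer o) = out (outside pN (T.entry pN t2 , T'.entry pN t4) pm (entries-F pm t) e o)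
            where
            out : (∃[ j ] (e ≡ edge h j)) ⊎ N e ≡ m e → suc (suc (length (filterB E S))) ℕ.≤ length S
            out (inj₂ q) = clash te (trans q (av e i))
            out (inj₁ (j , q)) = at-h j (dirs d j) (subst (_∈ S) q i) (trans (cong N (sym q)) te) (trans (cong (inE Y) (sym q)) o)

    -- The part of `S` in `E` need not exclude matchings of `Y` without `s`. If `S` has at least two
    -- further edges, one of them can be traded for `w`, whose deletion forces `s` at their common
    -- vertex. Otherwise `two` shows that no competitor lacks `s`, and toggling `h` in `m` provides
    -- the one edge to be saved.
    lower : ∀ {m k} → Rel m k → ∀ S → AF X m S → ∃[ S' ] (AF Y k S' × suc (length S') ℕ.≤ length S)
    lower {m} {k} R@((pm , t) , (pk , tk) , ag) S A@(av , un) = decide (suc (suc (length (filterB E S))) ℕ.≤? length S)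
      where
      w = edge (h ▸ d) (r2 d)
      at-L : ∀ {k'} → PM Y k' → one (k' s) (k' f) (k' w) ≡ true
      at-L {k'} pk' = trans (sym (tri-rot k' h d)) (cover pk' (h ▸ d) (r2 d) L∈Y)
      avk : Avoids k (filterB E S)
      avk e i = let (j , q) = ∈-filterB⁻ E S i in trans (sym (ag e q)) (av e j)
      avw : Avoids k (w ∷ filterB E S)
      avw e (here refl) = proj₂ (one-first (at-L pk) tk)
      avw e (there i) = avk e i
      unw : ∀ k' → PM Y k' → Avoids k' (w ∷ filterB E S) → ∀ e → k' e ≡ k e
      unw k' pk' a = extended-unique R S A k' pk' (one-rest₁ (at-L pk') (off pk' h (r1 d) h∉Y (⊆-out {Y} {X} Y⊆X out1)) (a w (here refl))) (λ e i → a e (there i))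
      m₁ = toggle h m
      shorter : (∃[ e ] (e ∈ S × m₁ e ≡ true)) ⊎ Avoids m₁ S → suc (length (filterB E S)) ℕ.≤ length S
      shorter (inj₂ a) = clash t (trans (sym (un m₁ (toggle-PM h pm h∈X (hexagon-alternates (around-F pm t))) a f)) (trans (toggle-on h m (r1 d)) (cong not t)))
      shorter (inj₁ (e , i , te)) = length-filterB-< E S i (not-true λ q → clash te (trans (toggle-E m e q) (av e i)))
      decide : Dec (suc (suc (length (filterB E S))) ℕ.≤ length S) → ∃[ S' ] (AF Y k S' × suc (length S') ℕ.≤ length S)
      decide (yes long) = w ∷ filterB E S , (avw , unw) , long
      decide (no short) = filterB E S , (avk , un') , shorter (meets? m₁ S)
        where
        un' : ∀ k' → PM Y k' → Avoids k' (filterB E S) → ∀ e → k' e ≡ k e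
        un' k' pk' a = by (k' s) refl
          where
          by : ∀ b → k' s ≡ b → ∀ e → k' e ≡ k e
          by true q = extended-unique R S A k' pk' q a
          by false q = ⊥-elim (short (two R S A k' pk' q a))

  forkReduction : Reduction X Y (λ m → m (edge h (r1 d))) (λ k → k (edge h d))
  forkReduction = record
    { E = E ; forth = forth ; back = back ; injˡ = injˡ ; injʳ = λ R R' → injʳ′ R R' (λ _ → refl) ; lower = lower ; upper = upper }

-- The lists of the definition of Af

module _ {A : Set} (_≟_ : DecidableEquality A) where

  elemB⁻ : ∀ x xs → elemB _≟_ x xs ≡ true → x ∈ xs
  elemB⁻ x (y ∷ xs) e with x ≟ y
  ... | yes refl = here refl
  ... | no _ = there (elemB⁻ x xs e)

  elemB⁺ : ∀ x xs → x ∈ xs → elemB _≟_ x xs ≡ true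
  elemB⁺ x (y ∷ xs) i with x ≟ y
  ... | yes _ = refl
  elemB⁺ x (y ∷ xs) (here e) | no n = ⊥-elim (n e)
  elemB⁺ x (y ∷ xs) (there i) | no n = elemB⁺ x xs i

  ∈-dedup⁻ : ∀ xs {x} → x ∈ dedup _≟_ xs → x ∈ xs
  ∈-dedup⁻ (y ∷ xs) i with elemB _≟_ y xs
  ∈-dedup⁻ (y ∷ xs) i | true = there (∈-dedup⁻ xs i)
  ∈-dedup⁻ (y ∷ xs) (here e) | false = here e
  ∈-dedup⁻ (y ∷ xs) (there i) | false = there (∈-dedup⁻ xs i)

  ∈-dedup⁺ : ∀ xs {x} → x ∈ xs → x ∈ dedup _≟_ xs
  ∈-dedup⁺ (y ∷ xs) i with elemB _≟_ y xs in eq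
  ∈-dedup⁺ (y ∷ xs) (here refl) | true = ∈-dedup⁺ xs (elemB⁻ y xs eq)
  ∈-dedup⁺ (y ∷ xs) (there i) | true = ∈-dedup⁺ xs i
  ∈-dedup⁺ (y ∷ xs) (here e) | false = here e
  ∈-dedup⁺ (y ∷ xs) (there i) | false = there (∈-dedup⁺ xs i)

  dedup-unique : ∀ xs → Unique (dedup _≟_ xs)
  dedup-unique [] = []
  dedup-unique (y ∷ xs) with elemB _≟_ y xs in eq
  ... | true = dedup-unique xs
  ... | false = All.tabulate (λ i → λ { refl → clash (elemB⁺ y xs (∈-dedup⁻ xs i)) eq }) ∷ dedup-unique xs

filterB-unique : ∀ {A : Set} (p : A → Bool) {xs} → Unique xs → Unique (filterB p xs)
filterB-unique p [] = []
filterB-unique p {x ∷ xs} (h ∷ u) with p x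
... | true = All.tabulate (λ i → All.lookup h (proj₁ (∈-filterB⁻ p xs i))) ∷ filterB-unique p u
... | false = filterB-unique p u

filterB-cong : ∀ {A : Set} (p q : A → Bool) xs → (∀ x → x ∈ xs → p x ≡ q x) → filterB p xs ≡ filterB q xs
filterB-cong p q [] h = refl
filterB-cong p q (x ∷ xs) h rewrite h x (here refl) with q x
... | true = cong (x ∷_) (filterB-cong p q xs (λ y i → h y (there i)))
... | false = filterB-cong p q xs (λ y i → h y (there i))

-- Stated for a relation because matchings of two systems correspond by agreement on edges and not
-- by an equation of lists. The partner of the head is removed from `ys`; injectivity keeps the
-- other partners available.
length-≤ : ∀ {A B : Set} (R : A → B → Set) xs ys → Unique xs → (∀ x → x ∈ xs → ∃[ y ] (y ∈ ys × R x y)) →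
  (∀ {x x' y} → x ∈ xs → x' ∈ xs → R x y → R x' y → x ≡ x') → length xs ℕ.≤ length ys
length-≤ R [] ys _ _ _ = z≤n
length-≤ {A} {B} R (x ∷ xs) ys (h ∷ u) tot inj with tot x (here refl)
... | y , i , r with ∈-∃++ i
... | ys₁ , ys₂ , refl = subst (suc (length xs) ℕ.≤_) (sym lengths) (s≤s (length-≤ R xs (ys₁ ++ ys₂) u tot' (λ i j → inj (there i) (there j))))
  where
  lengths : length (ys₁ ++ y ∷ ys₂) ≡ suc (length (ys₁ ++ ys₂))
  lengths = trans (length-++ ys₁) (trans (ℕP.+-suc (length ys₁) (length ys₂)) (cong suc (sym (length-++ ys₁))))
  tot' : ∀ x' → x' ∈ xs → ∃[ y' ] (y' ∈ ys₁ ++ ys₂ × R x' y')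
  tot' x' i' with tot x' (there i')
  ... | y' , j , r' with ∈-++⁻ ys₁ j
  ... | inj₁ k = y' , ∈-++⁺ˡ k , r'
  ... | inj₂ (there k) = y' , ∈-++⁺ʳ ys₁ k , r'
  ... | inj₂ (here refl) = ⊥-elim (All.lookup h i' (inj (here refl) (there i') r r'))

toSet : List Edge → EdgeSet
toSet M e = elemB _≟E_ e M

∈-subsets : ∀ {A : Set} xs {M : List A} → M ∈ subsets xs → ∀ {e} → e ∈ M → e ∈ xs
∈-subsets [] (here refl) ()
∈-subsets (x ∷ xs) i j with ∈-++⁻ (map (x ∷_) (subsets xs)) i
... | inj₂ k = there (∈-subsets xs k j)
... | inj₁ k with ∈-map⁻ (x ∷_) k
∈-subsets (x ∷ xs) i (here e) | inj₁ k | M' , l , refl = here e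
∈-subsets (x ∷ xs) i (there j) | inj₁ k | M' , l , refl = there (∈-subsets xs l j)

filterB∈subsets : ∀ {A : Set} (p : A → Bool) xs → filterB p xs ∈ subsets xs
filterB∈subsets p [] = here refl
filterB∈subsets p (x ∷ xs) with p x
... | true = ∈-++⁺ˡ (∈-map⁺ (x ∷_) (filterB∈subsets p xs))
... | false = ∈-++⁺ʳ (map (x ∷_) (subsets xs)) (filterB∈subsets p xs)

subsets-unique : ∀ {A : Set} {xs : List A} → Unique xs → Unique (subsets xs)
subsets-unique [] = [] ∷ []
subsets-unique {xs = x ∷ xs} (h ∷ u) = Unique.++⁺ (Unique.map⁺ (λ { refl → refl }) (subsets-unique u)) (subsets-unique u) disjoint
  where
  disjoint : ∀ {M} → (M ∈ map (x ∷_) (subsets xs) × M ∈ subsets xs) → ⊥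
  disjoint (i , j) with ∈-map⁻ (x ∷_) i
  ... | M' , _ , refl = All.lookup h (∈-subsets xs j (here refl)) refl

-- Sublists keep the order of `xs`, so one without repetitions is recovered from its set of members.
-- Pointwise equality of matchings therefore gives equality of the listed ones.
subsets-canonical : ∀ {xs M} → Unique xs → M ∈ subsets xs → M ≡ filterB (toSet M) xs
subsets-canonical {[]} [] (here refl) = refl
subsets-canonical {x ∷ xs} {M} (h ∷ u) i with ∈-++⁻ (map (x ∷_) (subsets xs)) i
... | inj₁ k with ∈-map⁻ (x ∷_) k
... | M' , l , refl with x ≟E x
... | no n = ⊥-elim (n refl)
... | yes _ = cong (x ∷_) (trans (subsets-canonical u l) (filterB-cong (toSet M') (toSet (x ∷ M')) xs same))
  where
  same : ∀ e → e ∈ xs → toSet M' e ≡ toSet (x ∷ M') e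
  same e j with e ≟E x
  ... | yes refl = ⊥-elim (All.lookup h j refl)
  ... | no _ = refl
subsets-canonical {x ∷ xs} {M} (h ∷ u) i | inj₂ k with toSet M x in t
... | false = subsets-canonical u k
... | true = ⊥-elim (All.lookup h (∈-subsets xs k (elemB⁻ _≟E_ x M t)) refl)

toSet-filterB : ∀ f E → (∀ e → f e ≡ true → e ∈ E) → ∀ e → toSet (filterB f E) e ≡ f e
toSet-filterB f E sup e with f e in fe
... | true = elemB⁺ _≟E_ e _ (∈-filterB⁺ f E (sup e fe) fe)
... | false with toSet (filterB f E) e in t
... | false = refl
... | true = trans (sym (proj₂ (∈-filterB⁻ f E (elemB⁻ _≟E_ e _ t)))) fe

-- Vertices, their three edges, and degrees

vtx : Cell → Fin 6 → Vertex
vtx (a , b) d0 = (a , b) , true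
vtx (a , b) d1 = (a + -1ℤ , b) , false
vtx (a , b) d2 = (a + -1ℤ , b) , true
vtx (a , b) d3 = (a + -1ℤ , b + -1ℤ) , false
vtx (a , b) d4 = (a , b + -1ℤ) , true
vtx (a , b) d5 = (a , b + -1ℤ) , false

private
  +0 : ∀ a → a + 0ℤ ≡ a
  +0 = ℤP.+-identityʳ
  +1-1 : ∀ a → a + + 1 + -1ℤ ≡ a
  +1-1 a = trans (ℤP.+-assoc a (+ 1) -1ℤ) (+0 a)
  -1+1 : ∀ a → a + -1ℤ + + 1 ≡ a
  -1+1 a = trans (ℤP.+-assoc a -1ℤ (+ 1)) (+0 a)

  at≡ : ∀ {a b a' b' : ℤ} {t : Bool} → a ≡ a' → b ≡ b' → ((a , b) , t) ≡ ((a' , b') , t)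
  at≡ refl refl = refl

  ed≡ : ∀ {a b a' b' : ℤ} {t : Fin 3} → a ≡ a' → b ≡ b' → ((a , b) , t) ≡ ((a' , b') , t)
  ed≡ refl refl = refl

-- `vtx c i` is the common end of the sides `i` and `r1 i` of `c`. Which end is listed first depends
-- on the direction, hence the two alternatives.
ends-edge : ∀ c i → (proj₁ (ends (edge c i)) ≡ vtx c i × proj₂ (ends (edge c i)) ≡ vtx c (r5 i))
                  ⊎ (proj₁ (ends (edge c i)) ≡ vtx c (r5 i) × proj₂ (ends (edge c i)) ≡ vtx c i)
ends-edge (a , b) d0 = inj₁ (refl , refl)
ends-edge (a , b) d1 = inj₂ (refl , refl)
ends-edge (a , b) d2 = inj₁ (refl , refl)
ends-edge (a , b) d3 = inj₂ (at≡ refl (+0 b) , at≡ refl (cong (λ x → x + -1ℤ) (+0 b)))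
ends-edge (a , b) d4 = inj₁ (at≡ (+0 a) refl , at≡ (cong (λ x → x + -1ℤ) (+0 a)) refl)
ends-edge (a , b) d5 = inj₂ (at≡ (+1-1 a) refl , at≡ (+1-1 a) refl)

star₁ star₂ star₃ : Vertex → Edge
star₁ ((a , b) , true) = (a , b) , zero
star₁ ((a , b) , false) = (a , b + + 1) , zero
star₂ ((a , b) , true) = (a , b) , suc zero
star₂ ((a , b) , false) = (a + + 1 , b) , suc zero
star₃ ((a , b) , _) = (a + + 1 , b) , suc (suc zero)

private
  cong₃ : ∀ (m : EdgeSet) {x y z x' y' z'} → x ≡ x' → y ≡ y' → z ≡ z' → one (m x) (m y) (m z) ≡ one (m x') (m y') (m z')
  cong₃ m refl refl refl = refl

star-tri : ∀ m c i → tri m c i ≡ one (m (star₁ (vtx c i))) (m (star₂ (vtx c i))) (m (star₃ (vtx c i)))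
star-tri m (a , b) d0 = cong (λ x → one (m ((a , b) , zero)) (m ((a , b) , suc zero)) (m x)) (ed≡ refl (+0 b))
star-tri m (a , b) d1 = trans (sym (one-rot (m ((a + 0ℤ + -1ℤ , b + + 1 + 0ℤ) , zero)) (m ((a , b) , suc zero)) (m ((a , b) , suc (suc zero)))))
  (cong₃ m (ed≡ (cong (λ x → x + -1ℤ) (+0 a)) (+0 _)) (ed≡ (sym (-1+1 a)) refl) (ed≡ (sym (-1+1 a)) refl))
star-tri m (a , b) d2 = trans (one-rot (m ((a , b) , suc (suc zero))) (m ((a + -1ℤ , b + 0ℤ) , zero)) (m ((a + -1ℤ + 0ℤ , b + + 1 + -1ℤ) , suc zero)))
  (cong₃ m (ed≡ refl (+0 b)) (ed≡ (+0 _) (+1-1 b)) (ed≡ (sym (-1+1 a)) refl))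
star-tri m (a , b) d3 = cong₃ m (ed≡ refl (trans (+0 b) (sym (-1+1 b)))) (ed≡ (trans (+0 a) (sym (-1+1 a))) refl) (ed≡ refl (cong (λ x → x + -1ℤ) (+0 b)))
star-tri m (a , b) d4 = trans (sym (one-rot (m ((a + 0ℤ , b + -1ℤ) , zero)) (m ((a + 0ℤ , b + -1ℤ) , suc zero)) (m ((a + + 1 , b + -1ℤ) , suc (suc zero)))))
  (cong₃ m (ed≡ (+0 a) refl) (ed≡ (+0 a) refl) refl)
star-tri m (a , b) d5 = trans (one-rot (m ((a + + 1 , b + -1ℤ) , suc (suc zero))) (m ((a , b) , zero)) (m ((a + + 1 , b + -1ℤ) , suc zero)))
  (cong₃ m (ed≡ refl (sym (-1+1 b))) refl refl)

incident-star : ∀ v e → incidentB v e ≡ true → e ≡ star₁ v ⊎ e ≡ star₂ v ⊎ e ≡ star₃ v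
incident-star v e@((a , b) , j) t with v ≟V proj₁ (ends e) | v ≟V proj₂ (ends e)
incident-star v ((a , b) , zero) t | yes refl | _ = inj₁ refl
incident-star v ((a , b) , suc zero) t | yes refl | _ = inj₂ (inj₁ refl)
incident-star v ((a , b) , suc (suc zero)) t | yes refl | _ = inj₂ (inj₂ (ed≡ (sym (-1+1 a)) refl))
incident-star v ((a , b) , zero) t | no _ | yes refl = inj₁ (ed≡ refl (sym (-1+1 b)))
incident-star v ((a , b) , suc zero) t | no _ | yes refl = inj₂ (inj₁ (ed≡ (sym (-1+1 a)) refl))
incident-star v ((a , b) , suc (suc zero)) t | no _ | yes refl = inj₂ (inj₂ (ed≡ (sym (-1+1 a)) refl))
incident-star v e () | no _ | no _

end-incident : ∀ v e → v ≡ proj₁ (ends e) ⊎ v ≡ proj₂ (ends e) → incidentB v e ≡ true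
end-incident v e h with v ≟V proj₁ (ends e) | v ≟V proj₂ (ends e)
... | yes _ | _ = refl
... | no _ | yes _ = refl
end-incident v e (inj₁ p) | no n | no _ = ⊥-elim (n p)
end-incident v e (inj₂ p) | no _ | no n = ⊥-elim (n p)

star-incident : ∀ v e → e ≡ star₁ v ⊎ e ≡ star₂ v ⊎ e ≡ star₃ v → incidentB v e ≡ true
star-incident ((a , b) , true) e (inj₁ refl) = end-incident _ e (inj₁ refl)
star-incident ((a , b) , true) e (inj₂ (inj₁ refl)) = end-incident _ e (inj₁ refl)
star-incident ((a , b) , true) e (inj₂ (inj₂ refl)) = end-incident _ e (inj₁ (at≡ (sym (+1-1 a)) refl))
star-incident ((a , b) , false) e (inj₁ refl) = end-incident _ e (inj₂ (at≡ refl (sym (+1-1 b))))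
star-incident ((a , b) , false) e (inj₂ (inj₁ refl)) = end-incident _ e (inj₂ (at≡ (sym (+1-1 a)) refl))
star-incident ((a , b) , false) e (inj₂ (inj₂ refl)) = end-incident _ e (inj₂ (at≡ (sym (+1-1 a)) refl))

bit : Bool → ℕ
bit true = 1
bit false = 0

star-distinct : ∀ v → star₁ v ≢ star₂ v × star₁ v ≢ star₃ v × star₂ v ≢ star₃ v
star-distinct ((a , b) , true) = (λ ()) , (λ ()) , (λ ())
star-distinct ((a , b) , false) = (λ ()) , (λ ()) , (λ ())

fresh : ∀ {x} M → All (x ≢_) M → toSet M x ≡ false
fresh {x} M h with toSet M x in t
... | false = refl
... | true = ⊥-elim (All.lookup h (elemB⁻ _≟E_ x M t) refl)

degree-count : ∀ v M → Unique M → degIn M v ≡ bit (toSet M (star₁ v)) ℕ.+ (bit (toSet M (star₂ v)) ℕ.+ bit (toSet M (star₃ v)))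
degree-count v [] _ = refl
degree-count v (x ∷ M) (h ∷ u) with star₁ v ≟E x | star₂ v ≟E x | star₃ v ≟E x | star-distinct v | incidentB v x in inc
... | yes refl | yes e | _ | (d , _) | _ = ⊥-elim (d (sym e))
... | yes refl | no _ | yes e | (_ , d , _) | _ = ⊥-elim (d (sym e))
... | no _ | yes refl | yes e | (_ , _ , d) | _ = ⊥-elim (d (sym e))
... | yes refl | no _ | no _ | _ | true = cong suc (trans (degree-count v M u) (cong (λ t → bit t ℕ.+ (bit (toSet M (star₂ v)) ℕ.+ bit (toSet M (star₃ v)))) (fresh M h)))
... | no _ | yes refl | no _ | _ | true = trans (cong suc (trans (degree-count v M u) (cong (λ t → bit (toSet M (star₁ v)) ℕ.+ (bit t ℕ.+ bit (toSet M (star₃ v)))) (fresh M h))))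
    (sym (ℕP.+-suc (bit (toSet M (star₁ v))) (bit (toSet M (star₃ v)))))
... | no _ | no _ | yes refl | _ | true = trans (cong suc (trans (degree-count v M u) (cong (λ t → bit (toSet M (star₁ v)) ℕ.+ (bit (toSet M (star₂ v)) ℕ.+ bit t)) (fresh M h))))
    (sym (trans (cong (bit (toSet M (star₁ v)) ℕ.+_) (ℕP.+-suc (bit (toSet M (star₂ v))) 0)) (ℕP.+-suc (bit (toSet M (star₁ v))) (bit (toSet M (star₂ v)) ℕ.+ 0))))
... | no _ | no _ | no _ | _ | false = degree-count v M u
... | no n₁ | no n₂ | no n₃ | _ | true with incident-star v x inc
... | inj₁ e = ⊥-elim (n₁ (sym e))
... | inj₂ (inj₁ e) = ⊥-elim (n₂ (sym e))
... | inj₂ (inj₂ e) = ⊥-elim (n₃ (sym e))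
degree-count v (x ∷ M) (h ∷ u) | yes e | no _ | no _ | _ | false = clash (star-incident v x (inj₁ (sym e))) inc
degree-count v (x ∷ M) (h ∷ u) | no _ | yes e | no _ | _ | false = clash (star-incident v x (inj₂ (inj₁ (sym e)))) inc
degree-count v (x ∷ M) (h ∷ u) | no _ | no _ | yes e | _ | false = clash (star-incident v x (inj₂ (inj₂ (sym e)))) inc

bit-one : ∀ a b c → ((bit a ℕ.+ (bit b ℕ.+ bit c)) == 1) ≡ one a b c
bit-one true true true = refl
bit-one true true false = refl
bit-one true false true = refl
bit-one true false false = refl
bit-one false true true = refl
bit-one false true false = refl
bit-one false false true = refl
bit-one false false false = refl

degree-one : ∀ v M → Unique M → (degIn M v == 1) ≡ one (toSet M (star₁ v)) (toSet M (star₂ v)) (toSet M (star₃ v))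
degree-one v M u = trans (cong (_== 1) (degree-count v M u)) (bit-one _ _ _)

χ : List Cell → CellSet
χ X c = memB c X

edgesOf-unique : ∀ X → Unique (edgesOf X)
edgesOf-unique X = dedup-unique _≟E_ (concatMap (λ c → map (edge c) (allFin 6)) X)

∈-edgesOf⁺ : ∀ X c i → χ X ∋ c → edge c i ∈ edgesOf X
∈-edgesOf⁺ X c i x = ∈-dedup⁺ _≟E_ _ (∈-concatMap⁺ (λ c → map (edge c) (allFin 6)) (lift (elemB⁻ _≟C_ c X x)))
  where
  lift : ∀ {X} → c ∈ X → Any (λ p → edge c i ∈ map (edge p) (allFin 6)) X
  lift (here refl) = here (∈-map⁺ (edge c) (∈-allFin i))
  lift (there k) = there (lift k)

∈-edgesOf⁻ : ∀ X e → e ∈ edgesOf X → ∃[ c ] ∃[ i ] (χ X ∋ c × e ≡ edge c i)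
∈-edgesOf⁻ X e k = finish (drop (∈-concatMap⁻ (λ c → map (edge c) (allFin 6)) (∈-dedup⁻ _≟E_ _ k)))
  where
  finish : ∃[ c ] (c ∈ X × e ∈ map (edge c) (allFin 6)) → ∃[ c ] ∃[ i ] (χ X ∋ c × e ≡ edge c i)
  finish (c , j , l) with ∈-map⁻ (edge c) {xs = allFin 6} l
  ... | i , _ , q = c , i , elemB⁺ _≟C_ c X j , q
  drop : ∀ {X} → Any (λ p → e ∈ map (edge p) (allFin 6)) X → ∃[ c ] (c ∈ X × e ∈ map (edge c) (allFin 6))
  drop (here l) = _ , here refl , l
  drop (there a) = let (c , j , l) = drop a in c , there j , l

inE-edgesOf : ∀ X e → inE (χ X) e ≡ true → e ∈ edgesOf X
inE-edgesOf X = edge-ind (λ e → inE (χ X) e ≡ true → e ∈ edgesOf X) lem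
  where
  lem : ∀ c i → inE (χ X) (edge c i) ≡ true → edge c i ∈ edgesOf X
  lem c i t with ∨-true {χ X c} (trans (sym (inE-edge (χ X) c i)) t)
  ... | inj₁ x = ∈-edgesOf⁺ X c i x
  ... | inj₂ x = subst (_∈ edgesOf X) (edge-flip c i) (∈-edgesOf⁺ X (c ▸ i) (r3 i) x)

edgesOf-inE : ∀ X e → e ∈ edgesOf X → inE (χ X) e ≡ true
edgesOf-inE X e k with ∈-edgesOf⁻ X e k
... | c , i , x , refl = inE-cell (χ X) c i x

∈-verticesOf⁺ : ∀ X c i → χ X ∋ c → vtx c i ∈ verticesOf X
∈-verticesOf⁺ X c i x = ∈-dedup⁺ _≟V_ _ (∈-concatMap⁺ (λ e → proj₁ (ends e) ∷ proj₂ (ends e) ∷ []) (lift (∈-edgesOf⁺ X c i x)))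
  where
  is-end : vtx c i ∈ (proj₁ (ends (edge c i)) ∷ proj₂ (ends (edge c i)) ∷ [])
  is-end with ends-edge c i
  ... | inj₁ (p , _) = here (sym p)
  ... | inj₂ (_ , p) = there (here (sym p))
  lift : ∀ {E} → edge c i ∈ E → Any (λ e → vtx c i ∈ (proj₁ (ends e) ∷ proj₂ (ends e) ∷ [])) E
  lift (here q) = here (subst (λ e → vtx c i ∈ (proj₁ (ends e) ∷ proj₂ (ends e) ∷ [])) q is-end)
  lift (there k) = there (lift k)

∈-verticesOf⁻ : ∀ X v → v ∈ verticesOf X → ∃[ c ] ∃[ i ] (χ X ∋ c × v ≡ vtx c i)
∈-verticesOf⁻ X v k = go (drop (∈-concatMap⁻ (λ e → proj₁ (ends e) ∷ proj₂ (ends e) ∷ []) (∈-dedup⁻ _≟V_ _ k)))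
  where
  drop : ∀ {E} → Any (λ e → v ∈ (proj₁ (ends e) ∷ proj₂ (ends e) ∷ [])) E → ∃[ e ] (e ∈ E × v ∈ (proj₁ (ends e) ∷ proj₂ (ends e) ∷ []))
  drop (here l) = _ , here refl , l
  drop (there a) = let (e , j , l) = drop a in e , there j , l
  go : ∃[ e ] (e ∈ edgesOf X × v ∈ (proj₁ (ends e) ∷ proj₂ (ends e) ∷ [])) → ∃[ c ] ∃[ i ] (χ X ∋ c × v ≡ vtx c i)
  go (e , j , l) with ∈-edgesOf⁻ X e j
  ... | c , i , x , refl with ends-edge c i | l
  ... | inj₁ (p , q) | here r = c , i , x , trans r p
  ... | inj₁ (p , q) | there (here r) = c , r5 i , x , trans r q
  ... | inj₂ (p , q) | here r = c , r5 i , x , trans r p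
  ... | inj₂ (p , q) | there (here r) = c , i , x , trans r q

allB⁻ : ∀ {A : Set} (p : A → Bool) xs → allB p xs ≡ true → ∀ x → x ∈ xs → p x ≡ true
allB⁻ p (y ∷ xs) e x i with p y in q
allB⁻ p (y ∷ xs) e x (here refl) | true = q
allB⁻ p (y ∷ xs) e x (there i) | true = allB⁻ p xs e x i

allB⁺ : ∀ {A : Set} (p : A → Bool) xs → (∀ x → x ∈ xs → p x ≡ true) → allB p xs ≡ true
allB⁺ p [] h = refl
allB⁺ p (y ∷ xs) h rewrite h y (here refl) = allB⁺ p xs (λ x i → h x (there i))

isPM⁻ : ∀ X M → Unique M → (∀ e → e ∈ M → e ∈ edgesOf X) → isPM (verticesOf X) M ≡ true → PM (χ X) (toSet M)
isPM⁻ X M u sub t = record { off = off' ; cover = λ c i x → trans (star-tri (toSet M) c i) (trans (sym (degree-one (vtx c i) M u)) (allB⁻ _ (verticesOf X) t (vtx c i) (∈-verticesOf⁺ X c i x))) }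
  where
  off' : ∀ c i → χ X ∌ c → χ X ∌ c ▸ i → toSet M (edge c i) ≡ false
  off' c i a b with toSet M (edge c i) in q
  ... | false = refl
  ... | true = clash (edgesOf-inE X _ (sub _ (elemB⁻ _≟E_ _ M q))) (inE-out (χ X) c i a b)

isPM⁺ : ∀ X M → Unique M → PM (χ X) (toSet M) → isPM (verticesOf X) M ≡ true
isPM⁺ X M u pm = allB⁺ _ (verticesOf X) (λ v i → lem v (∈-verticesOf⁻ X v i))
  where
  lem : ∀ v → ∃[ c ] ∃[ i ] (χ X ∋ c × v ≡ vtx c i) → (degIn M v == 1) ≡ true
  lem v (c , i , x , refl) = trans (degree-one (vtx c i) M u) (trans (sym (star-tri (toSet M) c i)) (cover pm c i x))

==⁺ : ∀ {a b} → a ≡ b → (a == b) ≡ true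
==⁺ {zero} refl = refl
==⁺ {suc a} refl = ==⁺ {a} refl

==⁻ : ∀ {a b} → (a == b) ≡ true → a ≡ b
==⁻ {zero} {zero} _ = refl
==⁻ {suc a} {suc b} e = cong suc (==⁻ e)

∧-true : ∀ {a b} → a ∧ b ≡ true → a ≡ true × b ≡ true
∧-true {true} {true} _ = refl , refl

all-equal-length : ∀ {A : Set} {xs : List A} {x} → Unique xs → x ∈ xs → (∀ y → y ∈ xs → y ≡ x) → length xs ≡ 1
all-equal-length {xs = y ∷ []} _ _ _ = refl
all-equal-length {xs = y ∷ z ∷ xs} ((h ∷ _) ∷ _) _ e = ⊥-elim (h (trans (e y (here refl)) (sym (e z (there (here refl))))))

length-one : ∀ {A : Set} {xs : List A} {x y} → length xs ≡ 1 → x ∈ xs → y ∈ xs → x ≡ y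
length-one {xs = z ∷ []} _ (here refl) (here refl) = refl

minimumℕ-≤ : ∀ d xs {x} → x ∈ xs → minimumℕ d xs ℕ.≤ x
minimumℕ-≤ d (x ∷ xs) (here refl) = ℕP.m⊓n≤m x (minimumℕ d xs)
minimumℕ-≤ d (x ∷ xs) (there i) = ℕP.≤-trans (ℕP.m⊓n≤n x (minimumℕ d xs)) (minimumℕ-≤ d xs i)

minimumℕ-sel : ∀ d xs → minimumℕ d xs ≡ d ⊎ minimumℕ d xs ∈ xs
minimumℕ-sel d [] = inj₁ refl
minimumℕ-sel d (x ∷ xs) with ℕP.⊓-sel x (minimumℕ d xs) | minimumℕ-sel d xs
... | inj₁ e | _ = inj₂ (here e)
... | inj₂ e | inj₁ e' = inj₁ (trans e e')
... | inj₂ e | inj₂ i = inj₂ (there (subst (_∈ xs) (sym e) i))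

-- Listed perfect matchings and the value of `af`

module Matchings (X : List Cell) where

  V : List Vertex
  V = verticesOf X

  E : List Edge
  E = edgesOf X

  E-unique : Unique E
  E-unique = edgesOf-unique X

  matchings : List (List Edge)
  matchings = perfectMatchings V E

  matchings-unique : Unique matchings
  matchings-unique = filterB-unique (isPM V) (subsets-unique E-unique)

  canonical : ∀ {E' M} → Unique E' → M ∈ perfectMatchings V E' → M ≡ filterB (toSet M) E'
  canonical {E'} u i = subsets-canonical u (proj₁ (∈-filterB⁻ (isPM V) (subsets E') i))

  matching-PM : ∀ {E' M} → Unique E' → (∀ e → e ∈ E' → e ∈ E) → M ∈ perfectMatchings V E' → PM (χ X) (toSet M)
  matching-PM {E'} {M} u sub i = isPM⁻ X M (subst Unique (sym (canonical u i)) (filterB-unique (toSet M) u))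
    (λ e k → sub e (∈-subsets E' (proj₁ (∈-filterB⁻ (isPM V) (subsets E') i)) k)) (proj₂ (∈-filterB⁻ (isPM V) (subsets E') i))

  PM-matching : ∀ {E' f} → Unique E' → PM (χ X) f → (∀ e → f e ≡ true → e ∈ E') → filterB f E' ∈ perfectMatchings V E'
  PM-matching {E'} {f} u pm sup = ∈-filterB⁺ (isPM V) (subsets E') (filterB∈subsets f E')
    (isPM⁺ X (filterB f E') (filterB-unique f u) (PM-resp (λ e → sym (toSet-filterB f E' sup e)) pm))

  support : ∀ {f} → PM (χ X) f → ∀ e → f e ≡ true → e ∈ E
  support pm e t = inE-edgesOf X e (not-false λ o → clash t (PM-support pm e o))

  PM∈ : ∀ {f} → PM (χ X) f → filterB f E ∈ matchings
  PM∈ pm = PM-matching E-unique pm (support pm)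

  ∈PM : ∀ {M} → M ∈ matchings → PM (χ X) (toSet M)
  ∈PM = matching-PM E-unique (λ _ k → k)

  toSet-PM : ∀ {f} → PM (χ X) f → ∀ e → toSet (filterB f E) e ≡ f e
  toSet-PM {f} pm = toSet-filterB f E (support pm)

  toSet-injective : ∀ {M N} → M ∈ matchings → N ∈ matchings → (∀ e → toSet M e ≡ toSet N e) → M ≡ N
  toSet-injective {M} {N} i j e = trans (canonical E-unique i) (trans (filterB-cong (toSet M) (toSet N) E (λ x _ → e x)) (sym (canonical E-unique j)))

  module _ {M : List Edge} (M∈ : M ∈ matchings) where

    private
      del : List Edge → List Edge
      del S = minus _≟E_ E S

      del-unique : ∀ S → Unique (del S)
      del-unique S = filterB-unique (λ x → not (elemB _≟E_ x S)) E-unique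

      del⁻ : ∀ S e → e ∈ del S → e ∈ E × toSet S e ≡ false
      del⁻ S e i with ∈-filterB⁻ (λ x → not (elemB _≟E_ x S)) E i
      ... | j , t with elemB _≟E_ e S
      ... | false = j , refl

      del⁺ : ∀ S e → e ∈ E → toSet S e ≡ false → e ∈ del S
      del⁺ S e i t = ∈-filterB⁺ (λ x → not (elemB _≟E_ x S)) E i (cong not t)

      avoid-toSet : ∀ {f S} → Avoids f S → ∀ e → f e ≡ true → toSet S e ≡ false
      avoid-toSet {f} {S} av e t with toSet S e in q
      ... | false = refl
      ... | true = clash t (av e (elemB⁻ _≟E_ e S q))

      pmM : PM (χ X) (toSet M)
      pmM = ∈PM M∈

      anti⁺ : ∀ S → AF (χ X) (toSet M) S → isAntiForcing V E M S ≡ true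
      anti⁺ S (av , un) = ==⁺ (all-equal-length (filterB-unique (isPM V) (subsets-unique (del-unique S))) (PM-matching (del-unique S) pmM sup) same)
        where
        sup : ∀ e → toSet M e ≡ true → e ∈ del S
        sup e t = del⁺ S e (support pmM e t) (avoid-toSet {toSet M} av e t)
        same : ∀ N → N ∈ perfectMatchings V (del S) → N ≡ filterB (toSet M) (del S)
        same N i = trans (canonical (del-unique S) i) (filterB-cong (toSet N) (toSet M) (del S)
          (λ e _ → un (toSet N) (matching-PM (del-unique S) (λ e k → proj₁ (del⁻ S e k)) i) avN e))
          where
          avN : Avoids (toSet N) S
          avN e k with toSet N e in t
          ... | false = refl
          ... | true = clash (elemB⁺ _≟E_ e S k) (proj₂ (del⁻ S e (∈-subsets (del S) (proj₁ (∈-filterB⁻ (isPM V) (subsets (del S)) i)) (elemB⁻ _≟E_ e N t))))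

      anti⁻ : ∀ S → Avoids (toSet M) S → isAntiForcing V E M S ≡ true → AF (χ X) (toSet M) S
      anti⁻ S av t = av , un
        where
        sup : ∀ f → PM (χ X) f → Avoids f S → ∀ e → f e ≡ true → e ∈ del S
        sup f pm a e t = del⁺ S e (support pm e t) (avoid-toSet {f} a e t)
        un : ∀ n → PM (χ X) n → Avoids n S → ∀ e → n e ≡ toSet M e
        un n pn a e = trans (sym (toSet-filterB n (del S) (sup n pn a) e))
          (trans (cong (λ N → toSet N e) (length-one (==⁻ t) (PM-matching (del-unique S) pn (sup n pn a)) (PM-matching (del-unique S) pmM (sup _ pmM av))))
                 (toSet-filterB (toSet M) (del S) (sup _ pmM av) e))

      candidates : List (List Edge)
      candidates = filterB (isAntiForcing V E M) (subsets (del M))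

    af-attained : ∃[ S ] (AF (χ X) (toSet M) S × length S ℕ.≤ af V E M)
    af-attained with minimumℕ-sel (length E) (map length candidates)
    ... | inj₂ i with ∈-map⁻ length i
    ... | S , j , e = S , anti⁻ S avS (proj₂ k) , ℕP.≤-reflexive (sym e)
      where
      k = ∈-filterB⁻ (isAntiForcing V E M) (subsets (del M)) j
      avS : Avoids (toSet M) S
      avS x l = proj₂ (del⁻ M x (∈-subsets (del M) (proj₁ k) l))
    -- The minimum may be the default |E|. It is then bounded below by the size of the complement of
    -- `M`, which is itself an anti-forcing set.
    af-attained | inj₁ e = del M , (avM , unM) , ℕP.≤-trans (length-filterB (λ x → not (elemB _≟E_ x M)) E) (ℕP.≤-reflexive (sym e))
      where
      avM : Avoids (toSet M) (del M)
      avM x l = proj₂ (del⁻ M x l)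
      inside : ∀ {n} → PM (χ X) n → Avoids n (del M) → ∀ e → toSet M e ≡ false → n e ≡ false
      inside {n} pn a e o with n e in t
      ... | false = refl
      ... | true = trans (sym t) (a e (del⁺ M e (support pn e t) o))
      one-⊆ : ∀ {a b c a' b' c'} → one a b c ≡ true → one a' b' c' ≡ true → (b ≡ false → b' ≡ false) → (c ≡ false → c' ≡ false) → a ≡ true → a' ≡ true
      one-⊆ {true} {false} {false} {true} _ _ _ _ _ = refl
      one-⊆ {true} {false} {false} {false} {b'} {c'} _ t f g _ rewrite f refl | g refl with t
      ... | ()
      unM : ∀ n → PM (χ X) n → Avoids n (del M) → ∀ e → n e ≡ toSet M e
      unM n pn a e with toSet M e in t
      ... | false = inside pn a e t
      ... | true with ∈-edgesOf⁻ X e (support pmM e t)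
      ... | c , i , x , refl = one-⊆ (cover pmM c i x) (cover pn c i x) (inside pn a (edge c (r1 i))) (inside pn a (edge (c ▸ i) (r2 i))) t

    af-least : ∀ S → AF (χ X) (toSet M) S → af V E M ℕ.≤ length S
    af-least S (av , un) = ℕP.≤-trans (minimumℕ-≤ (length E) (map length candidates)
        (∈-map⁺ length (∈-filterB⁺ (isAntiForcing V E M) (subsets (del M)) (filterB∈subsets (toSet S) (del M)) (anti⁺ S' (av' , un')))))
        (length-≤ _≡_ S' S (filterB-unique (toSet S) (del-unique M)) (λ x i → x , in-S x i , refl) (λ _ _ p q → trans p (sym q)))
      where
      -- The candidates are sublists of the complement of `M`. Passing from `S` to its members there
      -- loses nothing, since an edge outside the graph is avoided by every matching, and does not
      -- increase the length.
      S' : List Edge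
      S' = filterB (toSet S) (del M)
      in-S : ∀ x → x ∈ S' → x ∈ S
      in-S x i = elemB⁻ _≟E_ x S (proj₂ (∈-filterB⁻ (toSet S) (del M) i))
      av' : Avoids (toSet M) S'
      av' x i = av x (in-S x i)
      un' : ∀ n → PM (χ X) n → Avoids n S' → ∀ e → n e ≡ toSet M e
      un' n pn a = un n pn avn
        where
        avn : Avoids n S
        avn e i with n e in t
        ... | false = refl
        ... | true = trans (sym t) (a e (∈-filterB⁺ (toSet S) (del M) (del⁺ M e (support pn e t) (av e i)) (elemB⁺ _≟E_ e S i)))

-- Polynomials of classes of matchings

A : List Cell → (EdgeSet → Bool) → Poly
A X P k = + length (filterB (λ M → (af (verticesOf X) (edgesOf X) M == k) ∧ P (toSet M)) (perfectMatchings (verticesOf X) (edgesOf X)))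

every : EdgeSet → Bool
every _ = true

Af≡A : ∀ X → Af X ≈P A X every
Af≡A X k = cong (λ xs → + length xs) (filterB-cong _ _ (perfectMatchings (verticesOf X) (edgesOf X)) (λ M _ → lem (af (verticesOf X) (edgesOf X) M == k)))
  where
  lem : ∀ b → b ≡ b ∧ true
  lem true = refl
  lem false = refl

A-cong : ∀ X {P Q} → (∀ m → PM (χ X) m → P m ≡ Q m) → A X P ≈P A X Q
A-cong X {P} {Q} h k = cong (λ xs → + length xs) (filterB-cong _ _ (perfectMatchings (verticesOf X) (edgesOf X))
  (λ M i → cong ((af (verticesOf X) (edgesOf X) M == k) ∧_) (h (toSet M) (Matchings.∈PM X i))))

A-split : ∀ X {P Q R} → (∀ m → PM (χ X) m → bit (P m) ≡ bit (Q m) ℕ.+ bit (R m)) → A X P ≈P A X Q +P A X R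
A-split X {P} {Q} {R} h k = cong +_ (count (perfectMatchings (verticesOf X) (edgesOf X)) (λ M i → h (toSet M) (Matchings.∈PM X i)))
  where
  t : List Edge → Bool
  t M = af (verticesOf X) (edgesOf X) M == k
  ind : ∀ b p q r → bit p ≡ bit q ℕ.+ bit r → bit (b ∧ p) ≡ bit (b ∧ q) ℕ.+ bit (b ∧ r)
  ind true p q r e = e
  ind false p q r e = refl
  length-∷ : ∀ (f : List Edge → Bool) M Ms → length (filterB f (M ∷ Ms)) ≡ bit (f M) ℕ.+ length (filterB f Ms)
  length-∷ f M Ms with f M
  ... | true = refl
  ... | false = refl
  interchange : ∀ a b c d → (a ℕ.+ b) ℕ.+ (c ℕ.+ d) ≡ (a ℕ.+ c) ℕ.+ (b ℕ.+ d)
  interchange a b c d = trans (ℕP.+-assoc a b (c ℕ.+ d)) (trans (cong (a ℕ.+_) (trans (sym (ℕP.+-assoc b c d)) (trans (cong (ℕ._+ d) (ℕP.+-comm b c)) (ℕP.+-assoc c b d)))) (sym (ℕP.+-assoc a c (b ℕ.+ d))))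
  count : ∀ Ms → (∀ M → M ∈ Ms → bit (P (toSet M)) ≡ bit (Q (toSet M)) ℕ.+ bit (R (toSet M))) →
    length (filterB (λ M → t M ∧ P (toSet M)) Ms) ≡ length (filterB (λ M → t M ∧ Q (toSet M)) Ms) ℕ.+ length (filterB (λ M → t M ∧ R (toSet M)) Ms)
  count [] _ = refl
  count (M ∷ Ms) g = trans (length-∷ (λ M → t M ∧ P (toSet M)) M Ms)
    (trans (cong₂ ℕ._+_ (ind (t M) _ _ _ (g M (here refl))) (count Ms (λ N i → g N (there i))))
    (trans (interchange (bit (t M ∧ Q (toSet M))) (bit (t M ∧ R (toSet M))) _ _)
      (sym (cong₂ ℕ._+_ (length-∷ (λ M → t M ∧ Q (toSet M)) M Ms) (length-∷ (λ M → t M ∧ R (toSet M)) M Ms)))))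

Respects : (EdgeSet → Bool) → Set
Respects P = ∀ {m n} → (∀ e → m e ≡ n e) → P m ≡ P n

module _ {X Y : List Cell} {P Q : EdgeSet → Bool} (P-resp : Respects P) (Q-resp : Respects Q) (r : Reduction (χ X) (χ Y) P Q) where

  private
    module MX = Matchings X
    module MY = Matchings Y
    open Reduction r

    R : List Edge → List Edge → Set
    R M N = Rel (toSet M) (toSet N)

    af-suc : ∀ {M N} → M ∈ MX.matchings → N ∈ MY.matchings → R M N → af MX.V MX.E M ≡ suc (af MY.V MY.E N)
    af-suc {M} {N} i j rel = ℕP.≤-antisym le ge
      where
      le : af MX.V MX.E M ℕ.≤ suc (af MY.V MY.E N)
      le with MY.af-attained j
      ... | S' , a' , l' with upper rel S' a'
      ... | S , a , l = ℕP.≤-trans (MX.af-least i S a) (ℕP.≤-trans l (s≤s l'))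
      ge : suc (af MY.V MY.E N) ℕ.≤ af MX.V MX.E M
      ge with MX.af-attained i
      ... | S , a , l with lower rel S a
      ... | S' , a' , l' = ℕP.≤-trans (s≤s (MY.af-least j S' a')) (ℕP.≤-trans l' l)

    listX : ℕ → List (List Edge)
    listX k = filterB (λ M → (af MX.V MX.E M == k) ∧ P (toSet M)) MX.matchings
    listY : ℕ → List (List Edge)
    listY k = filterB (λ M → (af MY.V MY.E M == k) ∧ Q (toSet M)) MY.matchings

    inX : ∀ {k M} → M ∈ listX k → M ∈ MX.matchings × af MX.V MX.E M ≡ k × P (toSet M) ≡ true
    inX i = let (j , t) = ∈-filterB⁻ _ MX.matchings i in j , ==⁻ (proj₁ (∧-true t)) , proj₂ (∧-true t)
    inY : ∀ {k M} → M ∈ listY k → M ∈ MY.matchings × af MY.V MY.E M ≡ k × Q (toSet M) ≡ true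
    inY i = let (j , t) = ∈-filterB⁻ _ MY.matchings i in j , ==⁻ (proj₁ (∧-true t)) , proj₂ (∧-true t)

    to : ∀ {M} → M ∈ MX.matchings → P (toSet M) ≡ true → ∃[ N ] (N ∈ MY.matchings × R M N)
    to {M} i p with forth (toSet M) (MX.∈PM i) p
    ... | n , mm , (pn , q) , ag = filterB n MY.E , MY.PM∈ pn , mm , (MY.∈PM (MY.PM∈ pn) , trans (Q-resp (MY.toSet-PM pn)) q)
        , λ e t → trans (ag e t) (sym (MY.toSet-PM pn e))

    from : ∀ {N} → N ∈ MY.matchings → Q (toSet N) ≡ true → ∃[ M ] (M ∈ MX.matchings × R M N)
    from {N} i q with back (toSet N) (MY.∈PM i) q
    ... | m , (pm , p) , nn , ag = filterB m MX.E , MX.PM∈ pm , (MX.∈PM (MX.PM∈ pm) , trans (P-resp (MX.toSet-PM pm)) p) , nn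
        , λ e t → trans (MX.toSet-PM pm e) (ag e t)

  A-reduce : A X P ≈P xpow 1 (A Y Q)
  -- The shifted polynomial has no constant term: by `af-suc` every matching of the class has
  -- positive anti-forcing number.
  A-reduce zero = cong +_ (none (listX 0) (λ M i → absurd i))
    where
    none : ∀ {B : Set} (xs : List B) → (∀ x → x ∈ xs → ⊥) → length xs ≡ 0
    none [] _ = refl
    none (x ∷ xs) f = ⊥-elim (f x (here refl))
    absurd : ∀ {M} → M ∈ listX 0 → ⊥
    absurd i with inX i
    ... | j , a , p with to j p
    ... | N , l , rel = ℕP.1+n≢0 (trans (sym (af-suc j l rel)) a)
  A-reduce (suc k) = cong +_ (ℕP.≤-antisym le ge)
    where
    uX : Unique (listX (suc k))
    uX = filterB-unique _ MX.matchings-unique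
    uY : Unique (listY k)
    uY = filterB-unique _ MY.matchings-unique
    le : length (listX (suc k)) ℕ.≤ length (listY k)
    le = length-≤ R (listX (suc k)) (listY k) uX total (λ i j p q → MX.toSet-injective (proj₁ (inX i)) (proj₁ (inX j)) (injˡ p q))
      where
      total : ∀ M → M ∈ listX (suc k) → ∃[ N ] (N ∈ listY k × R M N)
      total M i with inX i
      ... | j , a , p with to j p
      ... | N , l , rel = N , ∈-filterB⁺ _ MY.matchings l (cong₂ _∧_ (==⁺ (ℕP.suc-injective (trans (sym (af-suc j l rel)) a))) (proj₂ (proj₁ (proj₂ rel)))) , rel
    ge : length (listY k) ℕ.≤ length (listX (suc k))
    ge = length-≤ (λ N M → R M N) (listY k) (listX (suc k)) uY total (λ i j p q → MY.toSet-injective (proj₁ (inY i)) (proj₁ (inY j)) (injʳ p q))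
      where
      total : ∀ N → N ∈ listY k → ∃[ M ] (M ∈ listX (suc k) × R M N)
      total N i with inY i
      ... | j , a , p with from j p
      ... | M , l , rel = M , ∈-filterB⁺ _ MX.matchings l (cong₂ _∧_ (==⁺ (trans (af-suc l j rel) (cong suc a))) (proj₂ (proj₁ rel))) , rel

-- Hexagonal systems as cell sets

list-bound : ∀ (H : List Cell) → ∃[ B ] (∀ c → c ∈ H → proj₁ c < B)
list-bound [] = 0ℤ , λ _ ()
list-bound (x ∷ H) = (proj₁ x + + 1) ℤ.⊔ B , bounded′
  where
  B = proj₁ (list-bound H)
  bounded′ : ∀ c → c ∈ x ∷ H → proj₁ c < (proj₁ x + + 1) ℤ.⊔ B
  bounded′ c (here refl) = ℤP.<-≤-trans (ℤP.≤-<-trans ℤP.≤-refl (less (proj₁ x))) (ℤP.i≤i⊔j (proj₁ x + + 1) B)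
    where less : ∀ a → a < a + + 1
          less a = subst (λ t → t < a + + 1) (ℤP.+-identityʳ a) (ℤP.+-monoʳ-< a (ℤ.+<+ (s≤s z≤n)))
  bounded′ c (there i) = ℤP.<-≤-trans (proj₂ (list-bound H) c i) (ℤP.i≤j⊔i (proj₁ x + + 1) B)

χ⁺ : ∀ {H c} → c ∈ H → χ H ∋ c
χ⁺ {H} {c} = elemB⁺ _≟C_ c H

χ⁻ : ∀ {H c} → χ H ∋ c → c ∈ H
χ⁻ {H} {c} = elemB⁻ _≟C_ c H

χ-false : ∀ {H c} → ¬ (c ∈ H) → χ H ∌ c
χ-false n = not-true (λ t → n (χ⁻ t))

hex-good : ∀ H → HexSystem H → Catacondensed H → Good (χ H)
hex-good H (_ , _ , esc) cat = record
  { bound = B ; bounded = λ c l → χ-false (λ i → ℤP.<⇒≱ (proj₂ (list-bound H) c i) l) ; escape = escape′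
  ; cata = λ c i x y → χ-false (λ z → triangle c i (χ⁻ x) (χ⁻ y) z) }
  where
  B = proj₁ (list-bound H)
  walk : ∀ {c d} → Walk (λ x → ¬ (x ∈ H)) c d → Walk (λ x → χ H ∌ x) c d
  walk (here n) = here (χ-false n)
  walk (step i n w) = step i (χ-false n) (walk w)
  escape′ : ∀ c → χ H ∌ c → ∃[ d ] (Walk (λ x → χ H ∌ x) c d × (∀ a b → proj₁ d ≤ a → χ H ∌ (a , b)))
  escape′ c o with esc c (λ i → clash (χ⁺ i) o)
  ... | d , w , far = d , walk w , λ a b l → χ-false (λ i → ℤP.<⇒≱ (far (a , b) i) l)
  z : ∀ a → a + 0ℤ ≡ a
  z = ℤP.+-identityʳ
  u : ∀ a → a ≡ a + -1ℤ + + 1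
  u a = sym (trans (ℤP.+-assoc a -1ℤ (+ 1)) (z a))
  mv : ∀ {a b a' b' : ℤ} → a ≡ a' → b ≡ b' → (a , b) ∈ H → (a' , b') ∈ H
  mv refl refl i = i
  triangle : ∀ c i → c ∈ H → (c ▸ i) ∈ H → (c ▸ r1 i) ∈ H → ⊥
  triangle (a , b) d0 x y w = cat ((a , b) , true) (x , mv refl (z b) y , mv (z a) refl w)
  triangle (a , b) d1 x y w = cat ((a + -1ℤ , b) , false) (mv (u a) refl x , w , mv (trans (z a) (u a)) refl y)
  triangle (a , b) d2 x y w = cat ((a + -1ℤ , b) , true) (mv refl (z b) w , mv (u a) refl x , y)
  triangle (a , b) d3 x y w = cat ((a + -1ℤ , b + -1ℤ) , false) (mv (trans (z a) (u a)) refl w , mv refl (trans (z b) (u b)) y , mv (u a) (u b) x)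
  triangle (a , b) d4 x y w = cat ((a , b + -1ℤ) , true) (mv (z a) refl y , w , mv refl (u b) x)
  triangle (a , b) d5 x y w = cat ((a , b + -1ℤ) , false) (y , mv refl (u b) x , mv refl (trans (z b) (u b)) w)

onRay? : ∀ c d n x → Dec (OnRay c d n x)
onRay? c d zero x with x ≟C c
... | yes e = yes (0 , z≤n , e)
... | no ne = no λ { (zero , _ , e) → ne e }
onRay? c d (suc n) x with x ≟C c | onRay? (c ▸ d) d n x
... | yes e | _ = yes (0 , z≤n , e)
... | no _ | yes (k , l , e) = yes (suc k , s≤s l , e)
... | no ne | no nr = no λ { (zero , _ , e) → ne e ; (suc k , s≤s l , e) → nr (k , l , e) }

record Minus (Y X : List Cell) (K : Cell → Set) : Set where
  field
    sub  : χ Y ⊆ χ X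
    cut  : ∀ x → K x → χ Y ∌ x
    kept : ∀ x → χ X ∋ x → ¬ K x → χ Y ∋ x

  lost : (∀ x → Dec (K x)) → ∀ x → χ X ∋ x → χ Y ∌ x → K x
  lost K? x t f with K? x
  ... | yes k = k
  ... | no n = clash (kept x t n) f
open Minus public

remove : ∀ X {K : Cell → Set} → (∀ x → Dec (K x)) → ∃[ Y ] Minus Y X K
remove X {K} K? = filterB p X , record
  { sub = λ x t → χ⁺ (proj₁ (∈-filterB⁻ p X (χ⁻ t)))
  ; cut = λ x k → χ-false (λ i → clash (proj₂ (∈-filterB⁻ p X i)) (lem₁ x k))
  ; kept = λ x t n → χ⁺ (∈-filterB⁺ p X (χ⁻ t) (lem₂ x n)) }
  where
  p : Cell → Bool
  p x = not (does (K? x))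
  lem₁ : ∀ x → K x → p x ≡ false
  lem₁ x k with K? x
  ... | yes _ = refl
  ... | no n = ⊥-elim (n k)
  lem₂ : ∀ x → ¬ K x → p x ≡ true
  lem₂ x n with K? x
  ... | yes k = ⊥-elim (n k)
  ... | no _ = refl

Minus-cong : ∀ {Y X K K'} → Minus Y X K → (∀ x → K x → K' x) → (∀ x → K' x → K x) → Minus Y X K'
Minus-cong M f g = record { sub = sub M ; cut = λ x k → cut M x (g x k) ; kept = λ x t n → kept M x t (λ k → n (f x k)) }

-- A run of `n` further cells provides `n + 1` distinct members of the list `X`, so the ray ends
-- before `length X` steps.
ray-exists : ∀ X d c → χ X ∋ c → ∃[ n ] Ray (χ X) d c n
ray-exists X d c x = loop (length X) 0 (λ _ ()) ℕP.≤-refl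
  where
  Long : ℕ → Set
  Long n = ∀ k → k ℕ.< n → χ X ∋ (along c d (suc k))
  extend : ∀ n → Long n → (∃[ m ] Ray (χ X) d (along c d n) m) → ∃[ m ] Ray (χ X) d c m
  extend zero _ r = r
  extend (suc n) l (m , r) = extend n (λ k q → l k (ℕP.m<n⇒m<1+n q)) (suc m , more (trans (cong (χ X) (sym (along-suc c d n))) (l n ℕP.≤-refl)) (subst (λ p → Ray (χ X) d p m) (along-suc c d n) r))
  pigeon : ∀ n → Long n → suc n ℕ.≤ length X
  pigeon n l = subst (ℕ._≤ length X) (length-upTo (suc n)) (length-≤ (λ k p → p ≡ along c d k) (upTo (suc n)) X (Unique.upTo⁺ (suc n))
    (λ k i → along c d k , χ⁻ (inside k (∈-upTo⁻ i)) , refl) (λ _ _ p q → along-inj c d (trans (sym p) q)))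
    where
    inside : ∀ k → k ℕ.< suc n → χ X ∋ (along c d k)
    inside zero _ = x
    inside (suc k) (s≤s q) = l k q
  loop : ∀ fuel n → Long n → length X ℕ.≤ n ℕ.+ fuel → ∃[ m ] Ray (χ X) d c m
  loop zero n l f = ⊥-elim (ℕP.<-irrefl refl (ℕP.≤-trans (pigeon n l) (ℕP.≤-trans f (ℕP.≤-reflexive (ℕP.+-identityʳ n)))))
  loop (suc fuel) n l f with χ X (along c d (suc n)) in e
  ... | false = extend n l (0 , stop (trans (cong (χ X) (sym (along-suc c d n))) e))
  ... | true = loop fuel (suc n) l' (ℕP.≤-trans f (ℕP.≤-reflexive (ℕP.+-suc n fuel)))
    where
    l' : Long (suc n)
    l' k q with k ℕ.≟ n
    ... | yes refl = e
    ... | no ne = l k (ℕP.≤∧≢⇒< (ℕP.≤-pred q) ne)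

≈-trans : ∀ {p q r : Poly} → p ≈P q → q ≈P r → p ≈P r
≈-trans a b k = trans (a k) (b k)

≈-sym : ∀ {p q : Poly} → p ≈P q → q ≈P p
≈-sym a k = sym (a k)

shift-cong : ∀ {p q : Poly} → p ≈P q → shiftP p ≈P shiftP q
shift-cong a zero = refl
shift-cong a (suc k) = a k

+-cong : ∀ {p q p' q' : Poly} → p ≈P p' → q ≈P q' → p +P q ≈P p' +P q'
+-cong a b k = cong₂ _+_ (a k) (b k)

Ray-⊆ : ∀ {X Y : CellSet} {d c n} → Y ⊆ X → (∀ k → k ℕ.< n → Y ∋ (along c d (suc k))) → Ray X d c n → Ray Y d c n
Ray-⊆ {X} {Y} s f (stop o) = stop (⊆-out {Y} {X} s o)
Ray-⊆ s f (more x r) = more (f 0 (s≤s z≤n)) (Ray-⊆ s (λ k l → f (suc k) (s≤s l)) r)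

along-∉ : ∀ c d n → ¬ OnRay (c ▸ d) d n c
along-∉ c d n (k , _ , e) = ℕP.1+n≢0 (along-inj c d {suc k} {0} (sym e))

-- the two directions m ± 1 in either order
data Side (m : Fin 6) : Fin 6 → Fin 6 → Set where
  right : Side m (r5 m) (r1 m)
  left  : Side m (r1 m) (r5 m)

Bare : CellSet → Cell → Fin 6 → ℕ → Set
Bare X c d n = ∀ k → k ℕ.≤ n → X ∌ along c d k ▸ r1 d × X ∌ along c d k ▸ r5 d

at : Cell → Fin 6 → EdgeSet → Bool
at c i m = m (edge c i)

at-resp : ∀ c i → Respects (at c i)
at-resp c i e = e (edge c i)

-- Reductions as identities between polynomials

module Systems {H : List Cell} (good : Good (χ H)) where

  starA : ∀ {m d s} → Side m d s → ∀ X Y L n n' → χ X ⊆ χ H → χ X ∋ L →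
    χ X ∌ L ▸ m → χ X ∌ L ▸ r2 m → χ X ∌ L ▸ r3 m → χ X ∌ L ▸ r4 m →
    Ray (χ X) d L n → Ray (χ X) s L n' → Minus Y X (λ x → OnRay L d n x ⊎ OnRay L s n' x) →
    A X (at L m) ≈P xpow 1 (A Y every)
  starA {m} left X Y L n n' s x o0 o2 o3 o4 r r' M = A-reduce {X} {Y} (at-resp L m) (λ _ → refl) (reduction
    (Star.peeling good s (sub M) L x m o0 o2 o3 o4 n n' r r' (λ k l → cut M _ (inj₁ (k , l , refl))) (λ k l → cut M _ (inj₂ (k , l , refl)))
      (lost M (λ x → onRay? L (r1 m) n x ⊎-dec onRay? L (r5 m) n' x))))
  starA {m} right X Y L n n' s x o0 o2 o3 o4 r r' M = starA left X Y L n' n s x o0 o2 o3 o4 r' r (Minus-cong M (λ _ → swap) (λ _ → swap))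

  stubA : ∀ X Y h d n → χ X ⊆ χ H → χ X ∋ h → χ X ∋ h ▸ d → Ray (χ X) d (h ▸ d) n → Bare (χ X) (h ▸ d) d n →
    Minus Y X (OnRay (h ▸ d) d n) → A X (at h d) ≈P xpow 1 (A Y (at h d))
  stubA X Y h d n s x x' r b M = A-reduce {X} {Y} (at-resp h d) (at-resp h d) (reduction
    (Stub.peeling good s (sub M) h (kept M h x (along-∉ h d n)) d x' n r (λ k l → cut M _ (k , l , refl)) (λ k l → proj₁ (b k l)) (λ k l → proj₂ (b k l))
      (lost M (onRay? (h ▸ d) d n))))

  forkA : ∀ X Y h d n n' → χ X ⊆ χ H → χ X ∋ h → χ X ∋ h ▸ d → ¬ OnRay h (r2 d) (suc n) (h ▸ d) → ¬ OnRay h (r4 d) (suc n') (h ▸ d) →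
    χ X ∋ h ▸ r2 d → Ray (χ X) (r2 d) (h ▸ r2 d) n → Bare (χ X) (h ▸ r2 d) (r2 d) n →
    χ X ∋ h ▸ r4 d → Ray (χ X) (r4 d) (h ▸ r4 d) n' → Bare (χ X) (h ▸ r4 d) (r4 d) n' →
    Minus Y X (λ x → OnRay h (r2 d) (suc n) x ⊎ OnRay h (r4 d) (suc n') x) →
    A X (at h (r1 d)) ≈P xpow 1 (A Y (at h d))
  forkA X Y h d n n' s x xL na na' x₂ r₂ b₂ x₄ r₄ b₄ M = A-reduce {X} {Y} (at-resp h (r1 d)) (at-resp h d)
    (Fork.forkReduction good s (sub M) h x (cut M h (inj₁ (0 , z≤n , refl))) d (kept M _ xL (λ { (inj₁ q) → na q ; (inj₂ q) → na' q }))
      n n' x₂ r₂ x₄ r₄ (λ k l → proj₁ (b₂ k l)) (λ k l → proj₂ (b₂ k l)) (λ k l → proj₁ (b₄ k l)) (λ k l → proj₂ (b₄ k l))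
      (λ k l → cut M _ (inj₁ (k , l , refl))) (λ k l → cut M _ (inj₂ (k , l , refl)))
      (lost M (λ x → onRay? h (r2 d) (suc n) x ⊎-dec onRay? h (r4 d) (suc n') x)))

  opposite-∉ : ∀ c d j k → along c d (suc j) ≢ along c (r3 d) k
  opposite-∉ c d j k e = pos≢neg j k (ℤ-cancelˡ (φ (r5 d) c) (trans (sym (φ-along⁺ (r5 d) d (φ-r5 d) (suc j) c))
    (trans (cong (φ (r5 d)) e) (φ-along⁻ (r5 d) (r3 d) (trans (vec-r3 (r5 d) d) (cong -_ (φ-r5 d))) k c))))

  bits : ∀ {a b c a' c'} → one a' b c' ≡ true → c' ≡ false → one a b c ≡ true → bit a' ≡ bit a ℕ.+ bit c
  bits {true} {false} {false} {true} _ _ _ = refl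
  bits {false} {false} {true} {true} _ _ _ = refl
  bits {false} {true} {false} {false} _ _ _ = refl
  bits {true} {false} {false} {false} {true} _ () _
  bits {true} {false} {false} {false} {false} () _ _
  bits {false} {false} {true} {false} {true} _ () _
  bits {false} {false} {true} {false} {false} () _ _
  bits {false} {true} {false} {true} {true} () _ _
  bits {false} {true} {false} {true} {false} () _ _

  -- In the cut across a straight terminal tail, every vertical edge beyond the first hexagon c contributes one class.
  lineA : ∀ n X Y c d b → χ X ⊆ χ H → χ X ∋ c → χ H ∋ c ▸ r3 d → Ray (χ X) d c n → Ray (χ X) (r3 d) c b → Bare (χ X) c d n →
    Minus Y X (λ x → OnRay c d n x ⊎ OnRay c (r3 d) b x) →
    A X (at c (r2 d)) ≈P (+ n) ·P xpow 2 (A Y every) +P xpow 1 (A Y every)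
  lineA zero X Y c d b s x hb r rb bare M = ≈-trans
    (starA (left {r2 d}) X Y c b 0 s x
      o2 o4 (proj₂ (bare 0 z≤n)) o6 rb (stop (trans (cong (λ j → χ X (c ▸ j)) (r6 (r1 d))) (proj₁ (bare 0 z≤n))))
      (Minus-cong M (λ { _ (inj₁ (zero , _ , e)) → inj₂ (0 , z≤n , e) ; _ (inj₂ q) → inj₁ q }) (λ { _ (inj₁ q) → inj₂ q ; _ (inj₂ (zero , _ , e)) → inj₁ (0 , z≤n , e) })))
    (λ k → sym (trans (cong (λ t → t + xpow 1 (A Y every) k) (ℤP.*-zeroˡ (xpow 2 (A Y every) k))) (ℤP.+-identityˡ _)))
    where
    hc = s c x
    o2 : χ X ∌ c ▸ r2 d
    o2 = ⊆-out {χ X} {χ H} s (trans (cong (λ j → χ H (c ▸ j)) (sym (r53 d))) (cataL good c (r3 d) hc hb))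
    o4 : χ X ∌ c ▸ r4 d
    o4 = ⊆-out {χ X} {χ H} s (cata good c (r3 d) hc hb)
    o6 : χ X ∌ c ▸ r4 (r2 d)
    o6 = ended r
      where
      ended : Ray (χ X) d c 0 → χ X ∌ c ▸ r4 (r2 d)
      ended (stop o) = trans (cong (λ j → χ X (c ▸ j)) (r6 d)) o
  lineA (suc n) X Y c d b s x hb (more x' r) rb bare M = ≈-trans (A-split X {at c (r2 d)} {at c d} {at c' (r2 d)} split) (≈-trans (+-cong first next) sum)
    where
    c' = c ▸ d
    hc = s c x
    B = A Y every
    o1 = proj₁ (bare 0 z≤n)
    o2 : χ X ∌ c ▸ r2 d
    o2 = ⊆-out {χ X} {χ H} s (trans (cong (λ j → χ H (c ▸ j)) (sym (r53 d))) (cataL good c (r3 d) hc hb))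
    o4 : χ X ∌ c ▸ r4 d
    o4 = ⊆-out {χ X} {χ H} s (cata good c (r3 d) hc hb)
    onto : ∀ {y} → OnRay c d (suc n) y ⊎ OnRay c (r3 d) b y → OnRay c' d n y ⊎ OnRay c' (r3 d) (suc b) y
    onto (inj₁ (zero , _ , e)) = inj₂ (1 , s≤s z≤n , trans e (sym (▸-opposite c d)))
    onto (inj₁ (suc k , s≤s l , e)) = inj₁ (k , l , e)
    onto (inj₂ (k , l , e)) = inj₂ (suc k , s≤s l , trans e (cong (λ p → along p (r3 d) k) (sym (▸-opposite c d))))
    unto : ∀ {y} → OnRay c' d n y ⊎ OnRay c' (r3 d) (suc b) y → OnRay c d (suc n) y ⊎ OnRay c (r3 d) b y
    unto (inj₁ (k , l , e)) = inj₁ (suc k , s≤s l , e)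
    unto (inj₂ (zero , _ , e)) = inj₁ (1 , s≤s z≤n , e)
    unto (inj₂ (suc k , s≤s l , e)) = inj₂ (k , l , trans e (cong (λ p → along p (r3 d) k) (▸-opposite c d)))
    -- Side `r2 d` is used exactly when `r1 d` is not. The other end of side `r1 d` is then covered
    -- either by the vertical edge `edge c d` or by the slanted side of `c'`, in which case the
    -- vertical edge lies further on.
    split : ∀ m → PM (χ X) m → bit (at c (r2 d) m) ≡ bit (at c d m) ℕ.+ bit (at c' (r2 d) m)
    split m pm = bits (trans (one-swap (at c (r2 d) m) (at c (r1 d) m) _) (cover pm c (r1 d) x))
      (off pm (c ▸ r1 d) (r3 d) o1 (trans (cong (χ X) (▸-next c (r1 d))) o2)) (cover pm c d x)
    next : A X (at c' (r2 d)) ≈P (+ n) ·P xpow 2 B +P xpow 1 B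
    next = lineA n X Y c' d (suc b) s x' (trans (cong (χ H) (▸-opposite c d)) hc) r
      (more (trans (cong (χ X) (▸-opposite c d)) x) (subst (λ p → Ray (χ X) (r3 d) p b) (sym (▸-opposite c d)) rb))
      (λ k l → bare (suc k) (s≤s l)) (Minus-cong M (λ _ → onto) (λ _ → unto))
    XM = remove X (onRay? c' d n)
    X' = proj₁ XM
    M' = proj₂ XM
    s' : χ X' ⊆ χ X
    s' = sub M'
    s″ : χ X' ⊆ χ H
    s″ p t = s p (s' p t)
    x″ : χ X' ∋ c
    x″ = kept M' c x (along-∉ c d n)
    o6 : χ X' ∌ c ▸ d
    o6 = cut M' _ (0 , z≤n , refl)
    out : ∀ {p} → χ X ∌ p → χ X' ∌ p
    out = ⊆-out {χ X'} {χ X} s'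
    equiv : ∀ m → PM (χ X') m → at c d m ≡ at c (r2 d) m
    equiv m pm = same (cover pm c d x″) (cover pm c (r1 d) x″) (off pm c' (r2 d) o6 (trans (cong (χ X') (▸-next c d)) (out o1)))
      (off pm (c ▸ r1 d) (r3 d) (out o1) (trans (cong (χ X') (▸-next c (r1 d))) (out o2)))
      where
      same : ∀ {a b t a' t'} → one a b t ≡ true → one b a' t' ≡ true → t ≡ false → t' ≡ false → a ≡ a'
      same {true} {false} {false} {true} _ _ _ _ = refl
      same {false} {true} {false} {false} _ _ _ _ = refl
      same {true} {false} {false} {false} {false} _ () _ _
      same {true} {false} {false} {false} {true} _ _ _ ()
      same {false} {true} {false} {true} _ () _ _
    MY : Minus Y X' (λ y → OnRay c (r3 d) b y ⊎ OnRay c (r5 (r2 d)) 0 y)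
    MY = record
      { sub = λ p t → kept M' p (sub M p t) (λ { (k , l , e) → clash t (cut M p (inj₁ (suc k , s≤s l , e))) })
      ; cut = λ { p (inj₁ q) → cut M p (inj₂ q) ; p (inj₂ (zero , _ , e)) → cut M p (inj₁ (0 , z≤n , e)) }
      ; kept = λ p t n → kept M p (s' p t) λ { (inj₁ (zero , _ , e)) → n (inj₂ (0 , z≤n , e))
                                             ; (inj₁ (suc k , s≤s l , e)) → clash t (cut M' p (k , l , e))
                                             ; (inj₂ q) → n (inj₁ q) } }
    -- An inner vertical edge costs x twice: the tail beyond `c` is cut off, after which the edge is
    -- the last vertical edge of what remains and the rest of the chain is cut off as a star.
    first : A X (at c d) ≈P xpow 2 B
    first = ≈-trans (stubA X X' c d n s x x' r (λ k l → bare (suc k) (s≤s l)) M') (shift-cong (≈-trans (A-cong X' {at c d} {at c (r2 d)} equiv)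
      (starA (left {r2 d}) X' Y c b 0 s″ x″ (out o2) (out o4) (out (proj₂ (bare 0 z≤n))) (trans (cong (λ j → χ X' (c ▸ j)) (r6 d)) o6)
        (Ray-⊆ s' (λ k l → kept M' _ (ray-in rb k l) (λ { (j , _ , e) → opposite-∉ c d j (suc k) (sym e) })) rb)
        (stop (out (trans (cong (λ j → χ X (c ▸ j)) (r6 (r1 d))) o1))) MY)))
    sum : xpow 2 B +P ((+ n) ·P xpow 2 B +P xpow 1 B) ≈P (+ suc n) ·P xpow 2 B +P xpow 1 B
    sum k = lem (+ n) (xpow 2 B k) (xpow 1 B k)
      where lem : ∀ n p q → p + (n * p + q) ≡ (+ 1 + n) * p + q
            lem = solve-∀

shift-+ : ∀ (p q : Poly) → shiftP (p +P q) ≈P shiftP p +P shiftP q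
shift-+ p q zero = refl
shift-+ p q (suc k) = refl

shift-· : ∀ z (p : Poly) → shiftP (z ·P p) ≈P z ·P shiftP p
shift-· z p zero = sym (ℤP.*-zeroʳ z)
shift-· z p (suc k) = refl

A-split₃ : ∀ X {Q R S} → (∀ m → PM (χ X) m → one (Q m) (R m) (S m) ≡ true) → A X every ≈P A X Q +P (A X R +P A X S)
A-split₃ X {Q} {R} {S} h = ≈-trans (A-split X {every} {Q} {λ m → R m ∨ S m} (λ m pm → lem₁ (Q m) (R m) (S m) (h m pm)))
  (+-cong {A X Q} (λ _ → refl) (A-split X {λ m → R m ∨ S m} {R} {S} (λ m pm → lem₂ (Q m) (R m) (S m) (h m pm))))
  where
  lem₁ : ∀ a b c → one a b c ≡ true → 1 ≡ bit a ℕ.+ bit (b ∨ c)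
  lem₁ true false false _ = refl
  lem₁ false true false _ = refl
  lem₁ false false true _ = refl
  lem₂ : ∀ a b c → one a b c ≡ true → bit (b ∨ c) ≡ bit b ℕ.+ bit c
  lem₂ true false false _ = refl
  lem₂ false true false _ = refl
  lem₂ false false true _ = refl

A-split₂ : ∀ X {Q R} → (∀ m → PM (χ X) m → ∃[ b ] (one (Q m) (R m) b ≡ true × b ≡ false)) → A X every ≈P A X Q +P A X R
A-split₂ X {Q} {R} h = A-split X {every} {Q} {R} (λ m pm → lem (Q m) (R m) (h m pm))
  where
  lem : ∀ a b → ∃[ c ] (one a b c ≡ true × c ≡ false) → 1 ≡ bit a ℕ.+ bit b
  lem true false _ = refl
  lem false true _ = refl
  lem true true (c , () , _)
  lem false false (true , _ , ())
  lem false false (false , () , _)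

sideL : ∀ d → Side (r1 d) d (r2 d)
sideL d = subst (λ x → Side (r1 d) x (r2 d)) (r6 d) right

sideR : ∀ d → Side (r5 d) d (r4 d)
sideR d = subst₂ (Side (r5 d)) (r6 d) (r55 d) left

ne-right : ∀ c d j k → along c d (suc j) ≢ along c (r2 d) k
ne-right c d j k = sep-≢ {r3 (r1 d)} (record { on = trans (cong (λ x → φ (r3 (r1 d)) (vec x)) (sym (r6 d))) (on S) ; on' = on' S
  ; s₁ = 0 , trans (φ-neg (r1 d) (r1 d)) (cong -_ (φ-0 (r1 d))) ; s₅ = 1 , trans (cong (λ x → φ (r3 (r1 d)) (vec x)) (sym (trans (r55 (r1 d)) refl))) (proj₂-s₅) }) c j k
  where
  open Separates
  S = sepʳ (r1 d)
  proj₂-s₅ : φ (r3 (r1 d)) (vec (r5 (r5 (r1 d)))) ≡ + 1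
  proj₂-s₅ = trans (cong (λ j → φ (r3 (r1 d)) (vec j)) (r55 (r1 d))) (trans (φ-neg (r1 d) (r4 (r1 d))) (cong -_ (φ-r4 (r1 d))))

ne-left : ∀ c d j k → along c d (suc j) ≢ along c (r4 d) k
ne-left c d j k e = sep-≢ (subst₂ (Separates (r5 d)) (r6 d) (r55 d) (sepˡ (r5 d))) c j k e

line₁ : ∀ h d n x → OnRay h d (suc n) x → OnRay (h ▸ d) d n x ⊎ OnRay (h ▸ d) (r3 d) 1 x
line₁ h d n x (zero , _ , e) = inj₂ (1 , ℕP.≤-refl , trans e (sym (▸-opposite h d)))
line₁ h d n x (suc k , s≤s l , e) = inj₁ (k , l , e)

line₂ : ∀ h d n x → OnRay (h ▸ d) d n x ⊎ OnRay (h ▸ d) (r3 d) 1 x → OnRay h d (suc n) x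
line₂ h d n x (inj₁ (k , l , e)) = suc k , s≤s l , e
line₂ h d n x (inj₂ (zero , _ , e)) = 1 , s≤s z≤n , e
line₂ h d n x (inj₂ (suc zero , _ , e)) = 0 , z≤n , trans e (▸-opposite h d)
line₂ h d n x (inj₂ (suc (suc k) , s≤s () , e))

-- Kinks, branched hexagons and their tails

module Tails {H : List Cell} (good : Good (χ H)) where
  open Systems {H} good

  private
    id⊆ : ∀ {X : CellSet} → X ⊆ X
    id⊆ _ t = t

  back-ray : ∀ X h d → χ X ∋ h → χ X ∌ h ▸ r3 d → Ray (χ X) (r3 d) (h ▸ d) 1
  back-ray X h d x o = more (trans (cong (χ X) (▸-opposite h d)) x)
    (stop (trans (cong (λ p → χ X (p ▸ r3 d)) (▸-opposite h d)) o))

  -- An isolated hexagon has two perfect matchings, its alternating triples. Each contributes x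
  -- times the polynomial of the rest, which both `H₂` and `H₃` describe.
  singleA : ∀ H₂ H₃ → ∀ h → χ H ∋ h → (∀ i → χ H ∌ h ▸ i) → Minus H₂ H (λ x → x ≡ h) → Minus H₃ H (λ x → x ≡ h) →
    A H every ≈P xpow 1 (A H₂ every) +P xpow 1 (A H₃ every)
  singleA H₂ H₃ h x o M₂ M₃ = ≈-trans (A-split₂ H {at h d0} {at h d1} (λ m pm → _ , cover pm h d0 x , off pm (h ▸ d0) d2 (o d0) (trans (cong (χ H) (▸-next h d0)) (o d1))))
      (+-cong (piece H₂ M₂ d0) (piece H₃ M₃ d1))
    where
    piece : ∀ Y → Minus Y H (λ x → x ≡ h) → ∀ m → A H (at h m) ≈P xpow 1 (A Y every)
    piece Y M m = starA (left {m}) H Y h 0 0 id⊆ x (o m) (o (r2 m)) (o (r3 m)) (o (r4 m)) (stop (o (r1 m))) (stop (o (r5 m)))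
      (Minus-cong M (λ _ e → inj₁ (0 , z≤n , e)) (λ { _ (inj₁ (zero , _ , e)) → e ; _ (inj₂ (zero , _ , e)) → e }))

  -- The classes are read off at the end of `edge h d` on side `m`, between the two arms. If side
  -- `m` is used, so are `r2 m` and `r4 m`, and both chains are forced, leaving `H₃`. If the shared
  -- edge is used, cutting the tail leaves the class `G` of `H₁`. Otherwise the vertical edge lies
  -- further out in the tail and `lineA` leaves `H₂`. Finally `G` is eliminated by `classes₁`.
  kinkA : ∀ {m d s} → Side m d s → ∀ H₁ H₂ H₃ h n n₃ → χ H ∋ h → χ H ∋ h ▸ d →
    Ray (χ H) d (h ▸ d) n → Bare (χ H) (h ▸ d) d n → Ray (χ H) s h n₃ →
    χ H ∌ h ▸ m → χ H ∌ h ▸ r2 m → χ H ∌ h ▸ r3 m → χ H ∌ h ▸ r4 m →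
    Minus H₁ H (OnRay (h ▸ d) d n) → Minus H₂ H (OnRay h d (suc n)) → Minus H₃ H (λ x → OnRay h d (suc n) x ⊎ OnRay h s n₃ x) →
    A H every ≈P xpow 1 (A H₂ every) +P xpow 1 (A H₃ every)
      +P (xpow 1 (A H₁ every) +P (+ n) ·P xpow 2 (A H₂ every) -P xpow 2 (A H₃ every))
  kinkA {m} {d} {s} sd H₁ H₂ H₃ h n n₃ x xc r bare r₃ o0 o2 o3 o4 M₁ M₂ M₃ = final
    where
    c = h ▸ d
    A₁ = A H₁ every
    A₂ = A H₂ every
    A₃ = A H₃ every
    G = A H₁ (at h d)

    behind-out : ∀ {m d s} → Side m d s → χ H ∌ h ▸ r2 m → χ H ∌ h ▸ r4 m → χ H ∌ h ▸ r3 d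
    behind-out left o2 o4 = o4
    behind-out {m} right o2 o4 = trans (cong (λ j → χ H (h ▸ j)) (cong r2 (r6 m))) o2

    three : ∀ {m d s} → Side m d s → χ H ∋ h ▸ d → ∀ μ → PM (χ H) μ → one (at h d μ) (at h m μ) (at (h ▸ d) (r2 d) μ) ≡ true
    three {m} right xc μ pm = trans (cong (λ j → one (at h (r5 m) μ) (at h j μ) (at (h ▸ r5 m) (r2 (r5 m)) μ)) (sym (r6 m))) (cover pm h (r5 m) x)
    three {m} left xc μ pm = trans (cong₂ (λ j b → one (at h (r1 m) μ) (at h j μ) b) (sym (r6 m)) same) (coverL pm h (r1 m) x)
      where
      c' = h ▸ r1 m
      -- On this side the vertex belongs to side `r4` of the tail hexagon; flux through the shared
      -- edge exchanges it for `r2`, the side for which `lineA` is stated.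
      same : at c' (r2 (r1 m)) μ ≡ at c' (r4 (r1 m)) μ
      same = trans (cong (λ j → at c' j μ) (sym (r53 (r1 m)))) (Flux.flux good id⊆ pm c' (r3 (r1 m)) xc (trans (cong (χ H) (▸-opposite h (r1 m))) x))

    out₁ : ∀ {p} → χ H ∌ p → χ H₁ ∌ p
    out₁ = ⊆-out {χ H₁} {χ H} (sub M₁)
    c∉H₁ : χ H₁ ∌ c
    c∉H₁ = cut M₁ _ (0 , z≤n , refl)
    h∈H₁ : χ H₁ ∋ h
    h∈H₁ = kept M₁ h x (along-∉ h d n)

    two : ∀ {m d s} → Side m d s → χ H₁ ∌ h ▸ d → χ H₁ ∌ h ▸ m → ∀ μ → PM (χ H₁) μ → ∃[ b ] (one (at h d μ) (at h m μ) b ≡ true × b ≡ false)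
    two {m} right a b μ pm = _ , trans (cong (λ j → one (at h (r5 m) μ) (at h j μ) (at (h ▸ r5 m) (r2 (r5 m)) μ)) (sym (r6 m))) (cover pm h (r5 m) h∈H₁)
      , off pm (h ▸ r5 m) (r2 (r5 m)) a (trans (cong (χ H₁) (▸-next h (r5 m))) (trans (cong (λ j → χ H₁ (h ▸ j)) (r6 m)) b))
    two {m} left a b μ pm = _ , trans (cong (λ j → one (at h (r1 m) μ) (at h j μ) (at (h ▸ r1 m) (r4 (r1 m)) μ)) (sym (r6 m))) (coverL pm h (r1 m) h∈H₁)
      , off pm (h ▸ r1 m) (r4 (r1 m)) a (trans (cong (χ H₁) (▸-prev h (r1 m))) (trans (cong (λ j → χ H₁ (h ▸ j)) (r6 m)) b))

    apart : ∀ {m d s} → Side m d s → ∀ j k → along h s (suc j) ≢ along h d k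
    apart {m} left j k e = sep-≢ (sepʳ m) h j k e
    apart {m} right j k e = sep-≢ (sepˡ m) h j k e

    classes : A H every ≈P A H (at h d) +P (A H (at h m) +P A H (at c (r2 d)))
    classes = A-split₃ H {at h d} {at h m} {at c (r2 d)} (three sd xc)
    e-class : A H (at h d) ≈P xpow 1 G
    e-class = stubA H H₁ h d n id⊆ x xc r bare M₁
    m-class : A H (at h m) ≈P xpow 1 A₃
    m-class = starA sd H H₃ h (suc n) n₃ id⊆ x o0 o2 o3 o4 (more xc r) r₃ M₃
    y-class : A H (at c (r2 d)) ≈P (+ n) ·P xpow 2 A₂ +P xpow 1 A₂
    y-class = lineA n H H₂ c d 1 id⊆ xc (trans (cong (χ H) (▸-opposite h d)) x) r (back-ray H h d x (behind-out sd o2 o4)) bare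
      (Minus-cong M₂ (line₁ h d n) (line₂ h d n))
    m-class₁ : A H₁ (at h m) ≈P xpow 1 A₃
    m-class₁ = starA sd H₁ H₃ h 0 n₃ (sub M₁) h∈H₁ (out₁ o0) (out₁ o2) (out₁ o3) (out₁ o4) (stop c∉H₁)
      (Ray-⊆ (sub M₁) (λ k l → kept M₁ _ (ray-in r₃ k l) (λ { (j , _ , e) → apart sd k (suc j) e })) r₃)
      (record { sub = λ p t → kept M₁ p (sub M₃ p t) (λ { (k , l , e) → clash t (cut M₃ p (inj₁ (suc k , s≤s l , e))) })
              ; cut = λ { p (inj₁ (zero , _ , e)) → cut M₃ p (inj₁ (0 , z≤n , e)) ; p (inj₂ q) → cut M₃ p (inj₂ q) }
              ; kept = λ p t n → kept M₃ p (sub M₁ p t) λ { (inj₁ (zero , _ , e)) → n (inj₁ (0 , z≤n , e))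
                                                          ; (inj₁ (suc k , s≤s l , e)) → clash t (cut M₁ p (k , l , e))
                                                          ; (inj₂ q) → n (inj₂ q) } })
    classes₁ : A₁ ≈P G +P xpow 1 A₃
    classes₁ = ≈-trans (A-split₂ H₁ {at h d} {at h m} (two sd c∉H₁ (out₁ o0))) (+-cong {G} (λ _ → refl) m-class₁)

    final : A H every ≈P xpow 1 A₂ +P xpow 1 A₃ +P (xpow 1 A₁ +P (+ n) ·P xpow 2 A₂ -P xpow 2 A₃)
    final k = arith (classes k) (e-class k) (m-class k) (y-class k) (trans (shift-cong classes₁ k) (shift-+ G (xpow 1 A₃) k))
      where
      arith : ∀ {a e f y g a1 a2 a22 a3 a33 : ℤ} → a ≡ e + (f + y) → e ≡ g → f ≡ a3 → y ≡ + n * a22 + a2 → a1 ≡ g + a33 →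
        a ≡ a2 + a3 + (a1 + + n * a22 - a33)
      arith {g = g} {a2 = a2} {a22} {a3} {a33} refl refl refl refl refl = lem g a2 a22 a3 a33 (+ n)
        where lem : ∀ g a2 a22 a3 a33 n → g + (a3 + (n * a22 + a2)) ≡ a2 + a3 + (g + a33 + n * a22 - a33)
              lem = solve-∀

module Branch {H : List Cell} (good : Good (χ H)) (H₁ H₂ H₃ : List Cell) (h : Cell) (d : Fin 6) (n n' p : ℕ)
  (x : χ H ∋ h)
  (x₂ : χ H ∋ h ▸ r2 d) (ray₂ : Ray (χ H) (r2 d) (h ▸ r2 d) n) (bare₂ : Bare (χ H) (h ▸ r2 d) (r2 d) n)
  (x₄ : χ H ∋ h ▸ r4 d) (ray₄ : Ray (χ H) (r4 d) (h ▸ r4 d) n') (bare₄ : Bare (χ H) (h ▸ r4 d) (r4 d) n')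
  (x₀ : χ H ∋ h ▸ d) (ray₀ : Ray (χ H) d (h ▸ d) p)
  (M₁ : Minus H₁ H (λ y → OnRay (h ▸ r2 d) (r2 d) n y ⊎ OnRay (h ▸ r4 d) (r4 d) n' y))
  (M₂ : Minus H₂ H (λ y → OnRay h (r2 d) (suc n) y ⊎ OnRay h (r4 d) (suc n') y))
  (M₃ : Minus H₃ H (λ y → OnRay h (r2 d) (suc n) y ⊎ OnRay h (r4 d) (suc n') y ⊎ OnRay h d (suc p) y)) where

  open Systems {H} good
  open Tails {H} good

  private
    e e' : Fin 6
    e = r2 d
    e' = r4 d
    c c' L : Cell
    c = h ▸ e
    c' = h ▸ e'
    L = h ▸ d

    id⊆ : ∀ {X : CellSet} → X ⊆ X
    id⊆ _ t = t

    h-dir : ∀ X {i j b} → i ≡ j → χ X (h ▸ j) ≡ b → χ X (h ▸ i) ≡ b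
    h-dir X q t = trans (cong (λ j → χ X (h ▸ j)) q) t

    c'-dir : ∀ X {i j b} → i ≡ j → χ X (c' ▸ j) ≡ b → χ X (c' ▸ i) ≡ b
    c'-dir X q t = trans (cong (λ j → χ X (c' ▸ j)) q) t

    out1 : χ H ∌ h ▸ r1 d
    out1 = cata good h d x x₀
    out3 : χ H ∌ h ▸ r3 d
    out3 = cata good h e x x₂
    out5 : χ H ∌ h ▸ r5 d
    out5 = cata good h e' x x₄

    r3e' : r3 e' ≡ r1 d
    r3e' = cong r1 (r6 d)
    r5e' : r5 e' ≡ r3 d
    r5e' = cong r3 (r6 d)
    r5e : r5 e ≡ r1 d
    r5e = cong r1 (r6 d)

    c'-back : χ H ∋ c' ▸ r3 e'
    c'-back = trans (cong (χ H) (▸-opposite h e')) x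
    c'-out4 : χ H ∌ c' ▸ r4 e'
    c'-out4 = cata good c' (r3 e') x₄ c'-back
    c'-out2 : χ H ∌ c' ▸ r2 e'
    c'-out2 = c'-dir H (sym (r53 e')) (cataL good c' (r3 e') x₄ c'-back)

    A₁ A₂ A₃ : Poly
    A₁ = A H₁ every
    A₂ = A H₂ every
    A₃ = A H₃ every

    tail₄-∉ : ∀ k → ¬ OnRay h e (suc n) (along h e' (suc k))
    tail₄-∉ k (j , _ , q) = ne-left h e' k j (trans q (cong (λ i → along h i j) (sym (cong r2 (r6 d)))))

    arm-∉₂ : ∀ m k → ¬ OnRay h e m (along h d (suc k))
    arm-∉₂ m k (j , _ , q) = ne-right h d k j q

    arm-∉₄ : ∀ m k → ¬ OnRay h e' m (along h d (suc k))
    arm-∉₄ m k (j , _ , q) = ne-left h d k j q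

    back-zero : ∀ {X} → χ X ∌ h → Ray (χ X) (r3 e') c' 0
    back-zero {X} o = stop (trans (cong (χ X) (▸-opposite h e')) o)

    JM : ∃[ J ] Minus J H (OnRay c e n)
    JM = remove H (onRay? c e n)
    J : List Cell
    J = proj₁ JM
    MJ : Minus J H (OnRay c e n)
    MJ = proj₂ JM

    -- Without `h` the second tail becomes a separate straight chain of `n' + 1` hexagons, counted
    -- in `OnW`; in `J` it still hangs on `h`.
    WM : ∃[ W ] Minus W H (OnRay h e (suc n))
    WM = remove H (onRay? h e (suc n))
    W : List Cell
    W = proj₁ WM
    MW : Minus W H (OnRay h e (suc n))
    MW = proj₂ WM

    -- Distinguished at the vertex of `h` between the sides `e` and `r3 d`: the edge to the first
    -- tail is used, or the triple of `r3 d` with no edge to a neighbour, or the vertical edge lies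
    -- further out in the first tail.
    classes : A H every ≈P A H (at h e) +P (A H (at h (r3 d)) +P A H (at c (r2 e)))
    classes = A-split₃ H {at h e} {at h (r3 d)} {at c (r2 e)} (λ μ pm → cover pm h e x)

    f-class : A H (at h (r3 d)) ≈P xpow 1 (A H₂ (at h d))
    f-class = ≈-trans (A-cong H {at h (r3 d)} {at h (r1 d)} (λ μ pm → trans (sym (Flux.flux good id⊆ pm h e x x₂)) (cong (λ j → at h j μ) r5e)))
      (forkA H H₂ h d n n' id⊆ x x₀ (arm-∉₂ (suc n) 0) (arm-∉₄ (suc n') 0) x₂ ray₂ bare₂ x₄ ray₄ bare₄ M₂)

    y-class : A H (at c (r2 e)) ≈P (+ n) ·P xpow 2 (A W every) +P xpow 1 (A W every)
    y-class = lineA n H W c e 1 id⊆ x₂ (trans (cong (χ H) (▸-opposite h e)) x) ray₂ (back-ray H h e x out5) bare₂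
      (Minus-cong MW (line₁ h e n) (line₂ h e n))

    module OnW where
      s : χ W ⊆ χ H
      s = sub MW
      out : ∀ {q} → χ H ∌ q → χ W ∌ q
      out = ⊆-out {χ W} {χ H} s
      h∉ : χ W ∌ h
      h∉ = cut MW h (0 , z≤n , refl)
      c'∈ : χ W ∋ c'
      c'∈ = kept MW c' x₄ (tail₄-∉ 0)
      ray : Ray (χ W) e' c' n'
      ray = Ray-⊆ s (λ k l → kept MW _ (ray-in ray₄ k l) (tail₄-∉ (suc k))) ray₄
      base : ∀ K → (∀ y → K y → OnRay c' e' n' y ⊎ y ≡ c') → (∀ y → OnRay c' e' n' y → K y) → Minus H₂ W K
      base K f g = record
        { sub = λ y t → kept MW y (sub M₂ y t) (λ q → clash t (cut M₂ y (inj₁ q)))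
        ; cut = λ y q → cut M₂ y (inj₂ (tail y (f y q)))
        ; kept = λ y t nk → kept M₂ y (s y t) λ { (inj₁ q) → clash t (cut MW y q)
                                                ; (inj₂ (zero , _ , q)) → clash t (trans (cong (χ W) q) h∉)
                                                ; (inj₂ (suc k , s≤s l , q)) → nk (g y (k , l , q)) } }
        where
        tail : ∀ y → OnRay c' e' n' y ⊎ y ≡ c' → OnRay h e' (suc n') y
        tail y (inj₁ (k , l , q)) = suc k , s≤s l , q
        tail y (inj₂ q) = 1 , s≤s z≤n , q
      split : A W every ≈P A W (at c' (r4 e')) +P A W (at c' (r5 e'))
      split = A-split₂ W {at c' (r4 e')} {at c' (r5 e')} (λ μ pm → _ , cover pm c' (r4 e') c'∈
        , off pm (c' ▸ r4 e') (r2 (r4 e')) (out c'-out4) (trans (cong (χ W) (▸-next c' (r4 e'))) (out (proj₂ (bare₄ 0 z≤n)))))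
      first : A W (at c' (r5 e')) ≈P xpow 1 A₂
      first = starA (sideR e') W H₂ c' n' 0 s c'∈ (out (proj₂ (bare₄ 0 z≤n))) (c'-dir W (cong r1 (r6 e')) (out (proj₁ (bare₄ 0 z≤n))))
        (c'-dir W (cong r2 (r6 e')) (out c'-out2)) (c'-dir W (cong r3 (r6 e')) (trans (cong (χ W) (▸-opposite h e')) h∉)) ray (stop (out c'-out4))
        (base _ (λ { y (inj₁ q) → inj₁ q ; y (inj₂ (zero , _ , q)) → inj₂ q }) (λ y q → inj₁ q))
      rest : A W (at c' (r4 e')) ≈P (+ n') ·P xpow 2 A₂ +P xpow 1 A₂
      rest = ≈-trans (A-cong W {at c' (r4 e')} {at c' (r2 e')} (λ μ pm → trans (Flux.flux′ good s pm c' (r3 e') c'∈ (out c'-out4) (c'-dir W (r53 e') (out c'-out2))) (cong (λ j → at c' j μ) (r53 e'))))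
        (lineA n' W H₂ c' e' 0 s c'∈ c'-back ray (back-zero {W} h∉) (λ k l → out (proj₁ (bare₄ k l)) , out (proj₂ (bare₄ k l)))
          (base _ (λ { y (inj₁ q) → inj₁ q ; y (inj₂ (zero , _ , q)) → inj₂ q }) (λ y q → inj₁ q)))
      -- A row of `n' + 1` hexagons has `n' + 2` vertical edges: the two extreme ones give x each,
      -- the `n'` inner ones x² each.
      total : A W every ≈P (+ n') ·P xpow 2 A₂ +P xpow 1 A₂ +P xpow 1 A₂
      total = ≈-trans split (+-cong rest first)

    s-class : A H (at h e) ≈P xpow 1 (A J (at h e))
    s-class = stubA H J h e n id⊆ x x₂ ray₂ bare₂ MJ

    module OnJ where
      s : χ J ⊆ χ H
      s = sub MJ
      out : ∀ {q} → χ H ∌ q → χ J ∌ q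
      out = ⊆-out {χ J} {χ H} s
      h∈ : χ J ∋ h
      h∈ = kept MJ h x (along-∉ h e n)
      c∉ : χ J ∌ c
      c∉ = cut MJ c (0 , z≤n , refl)
      shorten : ∀ {y} → OnRay c e n y → OnRay h e (suc n) y
      shorten (k , l , q) = suc k , s≤s l , q
      c'∈ : χ J ∋ c'
      c'∈ = kept MJ c' x₄ (λ q → tail₄-∉ 0 (shorten q))
      ray : Ray (χ J) e' c' n'
      ray = Ray-⊆ s (λ k l → kept MJ _ (ray-in ray₄ k l) (λ q → tail₄-∉ (suc k) (shorten q))) ray₄
      bare : Bare (χ J) c' e' n'
      bare k l = out (proj₁ (bare₄ k l)) , out (proj₂ (bare₄ k l))
      split : A J (at h e) ≈P A J (at h e') +P A J (at c' (r4 e'))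
      split = A-split J {at h e} {at h e'} {at c' (r4 e')} (λ μ pm → bits (cover pm h e h∈)
        (off pm c (r2 e) c∉ (trans (cong (χ J) (▸-next h e)) (out out3)))
        (trans (cong (λ j → one (at h e' μ) (at h j μ) (at c' (r4 e') μ)) (sym r5e')) (coverL pm h e' h∈)))
      y-part : A J (at c' (r4 e')) ≈P (+ n') ·P xpow 2 A₂ +P xpow 1 A₂
      y-part = ≈-trans (A-cong J {at c' (r4 e')} {at c' (r2 e')} (λ μ pm → trans (sym (Flux.flux good s pm c' (r3 e') c'∈ (trans (cong (χ J) (▸-opposite h e')) h∈))) (cong (λ j → at c' j μ) (r53 e'))))
        (lineA n' J H₂ c' e' 1 s c'∈ c'-back ray (back-ray J h e' h∈ (h-dir J r3e' (out out1))) bare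
          (Minus-cong base (line₁ h e' n') (line₂ h e' n')))
        where
        base : Minus H₂ J (OnRay h e' (suc n'))
        base = record
          { sub = λ y t → kept MJ y (sub M₂ y t) (λ q → clash t (cut M₂ y (inj₁ (shorten q))))
          ; cut = λ y q → cut M₂ y (inj₂ q)
          ; kept = λ y t nk → kept M₂ y (s y t) λ { (inj₁ (zero , _ , q)) → nk (0 , z≤n , q)
                                                  ; (inj₁ (suc k , s≤s l , q)) → clash t (cut MJ y (k , l , q))
                                                  ; (inj₂ q) → nk q } }
      s-part : A J (at h e') ≈P xpow 1 (A H₁ (at h e'))
      s-part = stubA J H₁ h e' n' s h∈ c'∈ ray bare (record
          { sub = λ y t → kept MJ y (sub M₁ y t) (λ q → clash t (cut M₁ y (inj₁ q)))
          ; cut = λ y q → cut M₁ y (inj₂ q)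
          ; kept = λ y t nk → kept M₁ y (s y t) λ { (inj₁ q) → clash t (cut MJ y q) ; (inj₂ q) → nk q } })
      total : A J (at h e) ≈P xpow 1 (A H₁ (at h e')) +P ((+ n') ·P xpow 2 A₂ +P xpow 1 A₂)
      total = ≈-trans split (+-cong s-part y-part)

    module OnH₁ where
      s : χ H₁ ⊆ χ H
      s = sub M₁
      out : ∀ {q} → χ H ∌ q → χ H₁ ∌ q
      out = ⊆-out {χ H₁} {χ H} s
      h∈ : χ H₁ ∋ h
      h∈ = kept M₁ h x (λ { (inj₁ q) → along-∉ h e n q ; (inj₂ q) → along-∉ h e' n' q })
      c∉ : χ H₁ ∌ c
      c∉ = cut M₁ c (inj₁ (0 , z≤n , refl))
      c'∉ : χ H₁ ∌ c'
      c'∉ = cut M₁ c' (inj₂ (0 , z≤n , refl))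
      arm : ∀ k → k ℕ.< suc p → χ H₁ ∋ (along h d (suc k))
      arm k l = kept M₁ _ (ray-in {χ H} {d} {h} (more x₀ ray₀) k l)
        λ { (inj₁ (j , l , q)) → arm-∉₂ (suc n) k (suc j , s≤s l , q) ; (inj₂ (j , l , q)) → arm-∉₄ (suc n') k (suc j , s≤s l , q) }
      base : Minus H₃ H₁ (λ y → OnRay h d (suc p) y ⊎ OnRay h (r4 d) 0 y)
      base = record
        { sub = λ y t → kept M₁ y (sub M₃ y t) λ { (inj₁ (k , l , q)) → clash t (cut M₃ y (inj₁ (suc k , s≤s l , q)))
                                                 ; (inj₂ (k , l , q)) → clash t (cut M₃ y (inj₂ (inj₁ (suc k , s≤s l , q)))) }
        ; cut = λ { y (inj₁ q) → cut M₃ y (inj₂ (inj₂ q)) ; y (inj₂ (zero , _ , q)) → cut M₃ y (inj₁ (0 , z≤n , q)) }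
        ; kept = λ y t nk → kept M₃ y (s y t) λ { (inj₁ (zero , _ , q)) → nk (inj₂ (0 , z≤n , q))
                                                ; (inj₁ (suc k , s≤s l , q)) → clash t (cut M₁ y (inj₁ (k , l , q)))
                                                ; (inj₂ (inj₁ (zero , _ , q))) → nk (inj₂ (0 , z≤n , q))
                                                ; (inj₂ (inj₁ (suc k , s≤s l , q))) → clash t (cut M₁ y (inj₂ (k , l , q)))
                                                ; (inj₂ (inj₂ q)) → nk (inj₁ q) } }
      f-part : A H₁ (at h (r5 d)) ≈P xpow 1 A₃
      f-part = starA (sideR d) H₁ H₃ h (suc p) 0 s h∈ (out out5) (h-dir H₁ (cong r1 (r6 d)) (out out1)) (h-dir H₁ (cong r2 (r6 d)) c∉)
        (h-dir H₁ (cong r3 (r6 d)) (out out3)) (Ray-⊆ s arm (more x₀ ray₀)) (stop c'∉) base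
      total : A₁ ≈P A H₁ (at h e') +P xpow 1 A₃
      total = ≈-trans (A-split₂ H₁ {at h e'} {at h (r5 d)} (λ μ pm → _ , cover pm h e' h∈
          , off pm c' (r2 e') c'∉ (trans (cong (χ H₁) (▸-next h e')) (out out5))))
        (+-cong {A H₁ (at h e')} (λ _ → refl) f-part)

  -- The edge to the first tail contributes x²G + (x² + n'x³)A₂, and the vertical edges further out
  -- contribute (x + nx²)(2x + n'x²)A₂. This explains the coefficients 3, 2(n + n') and nn'. By
  -- `OnH₁.total`, x²G is x²A₁ - x³A₃; the fork class is the last summand.
  branchA : A H every ≈P xpow 2 A₁
    +P (+ 3 ·P xpow 2 A₂ +P (+ 2 * (+ n + + n')) ·P xpow 3 A₂ +P (+ n * + n') ·P xpow 4 A₂)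
    -P xpow 3 A₃ +P xpow 1 (A H₂ (at h d))
  branchA k = arith {g = xpow 2 G k} (classes k) (s-class k) (J-shift k) (f-class k) (y-class k) (W-shift k) (W-shift₂ k) (H₁-shift k)
    where
    G = A H₁ (at h e')
    V = A W every
    J-shift : xpow 1 (A J (at h e)) ≈P xpow 2 G +P ((+ n') ·P xpow 3 A₂ +P xpow 2 A₂)
    J-shift = ≈-trans (shift-cong OnJ.total) (≈-trans (shift-+ (xpow 1 G) _) (+-cong {xpow 2 G} (λ _ → refl)
      (≈-trans (shift-+ ((+ n') ·P xpow 2 A₂) (xpow 1 A₂)) (+-cong (shift-· (+ n') (xpow 2 A₂)) (λ _ → refl)))))
    W-shift : xpow 1 V ≈P (+ n') ·P xpow 3 A₂ +P xpow 2 A₂ +P xpow 2 A₂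
    W-shift = ≈-trans (shift-cong OnW.total) (≈-trans (shift-+ ((+ n') ·P xpow 2 A₂ +P xpow 1 A₂) (xpow 1 A₂)) (+-cong {_} {xpow 2 A₂}
      (≈-trans (shift-+ ((+ n') ·P xpow 2 A₂) (xpow 1 A₂)) (+-cong (shift-· (+ n') (xpow 2 A₂)) (λ _ → refl))) (λ _ → refl)))
    W-shift₂ : xpow 2 V ≈P (+ n') ·P xpow 4 A₂ +P xpow 3 A₂ +P xpow 3 A₂
    W-shift₂ = ≈-trans (shift-cong W-shift) (≈-trans (shift-+ ((+ n') ·P xpow 3 A₂ +P xpow 2 A₂) (xpow 2 A₂)) (+-cong {_} {xpow 3 A₂}
      (≈-trans (shift-+ ((+ n') ·P xpow 3 A₂) (xpow 2 A₂)) (+-cong (shift-· (+ n') (xpow 3 A₂)) (λ _ → refl))) (λ _ → refl)))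
    H₁-shift : xpow 2 A₁ ≈P xpow 2 G +P xpow 3 A₃
    H₁-shift = ≈-trans (shift-cong (≈-trans (shift-cong OnH₁.total) (shift-+ G (xpow 1 A₃)))) (shift-+ (xpow 1 G) (xpow 2 A₃))
    arith : ∀ {a s j f t y v v₂ a₁ g b₂ b₃ b₄ c₃ : ℤ} → a ≡ s + (f + y) → s ≡ j → j ≡ g + (+ n' * b₃ + b₂) → f ≡ t →
      y ≡ + n * v₂ + v → v ≡ + n' * b₃ + b₂ + b₂ → v₂ ≡ + n' * b₄ + b₃ + b₃ → a₁ ≡ g + c₃ →
      a ≡ a₁ + (+ 3 * b₂ + (+ 2 * (+ n + + n')) * b₃ + (+ n * + n') * b₄) - c₃ + t
    arith {t = t} {g = g} {b₂} {b₃} {b₄} {c₃} refl refl refl refl refl refl refl refl = lem g t b₂ b₃ b₄ c₃ (+ n) (+ n')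
      where lem : ∀ g t b₂ b₃ b₄ c₃ n n' → g + (n' * b₃ + b₂) + (t + (n * (n' * b₄ + b₃ + b₃) + (n' * b₃ + b₂ + b₂)))
                  ≡ g + c₃ + (+ 3 * b₂ + (+ 2 * (n + n')) * b₃ + (n * n') * b₄) - c₃ + t
            lem = solve-∀

  module OnH₂ where
    s : χ H₂ ⊆ χ H
    s = sub M₂
    out : ∀ {q} → χ H ∌ q → χ H₂ ∌ q
    out = ⊆-out {χ H₂} {χ H} s
    h∉ : χ H₂ ∌ h
    h∉ = cut M₂ h (inj₁ (0 , z≤n , refl))
    arm : ∀ k → k ℕ.< suc p → χ H₂ ∋ (along h d (suc k))
    arm k l = kept M₂ _ (ray-in {χ H} {d} {h} (more x₀ ray₀) k l) λ { (inj₁ q) → arm-∉₂ (suc n) k q ; (inj₂ q) → arm-∉₄ (suc n') k q }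
    L∈ : χ H₂ ∋ L
    L∈ = arm 0 (s≤s z≤n)
    L-back : χ H ∋ L ▸ r3 d
    L-back = trans (cong (χ H) (▸-opposite h d)) x
    o4 : χ H₂ ∌ L ▸ r4 d
    o4 = out (cata good L (r3 d) x₀ L-back)
    o2 : χ H₂ ∌ L ▸ r2 d
    o2 = out (trans (cong (λ j → χ H (L ▸ j)) (sym (r53 d))) (cataL good L (r3 d) x₀ L-back))
    o3 : χ H₂ ∌ L ▸ r3 d
    o3 = trans (cong (χ H₂) (▸-opposite h d)) h∉
    s≡r3 : ∀ μ → at h d μ ≡ at L (r3 d) μ
    s≡r3 μ = cong μ (sym (edge-flip h d))

  -- Since `h` is gone and `L` has a hexagon ahead, this is the only neighbour of `L` in `H₂`. The
  -- side facing `h` then lies in the triple through `r1 d`, and a star at `L` cuts off the rest of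
  -- the arm.
  arm-long : ∀ q → p ≡ suc q → A H₂ (at h d) ≈P xpow 1 A₃
  arm-long q refl = extend ray₀
    where
    open OnH₂
    extend : Ray (χ H) d L (suc q) → A H₂ (at h d) ≈P xpow 1 A₃
    extend (more y ry) = ≈-trans (A-cong H₂ {at h d} {at L (r1 d)} same)
      (starA (sideL d) H₂ H₃ L (suc q) 0 s L∈ o1 o3 o4 o5
        (Ray-⊆ s (λ k l → arm (suc k) (s≤s l)) ray₀) (stop o2) base)
      where
      o1 : χ H₂ ∌ L ▸ r1 d
      o1 = out (cata good L d x₀ y)
      o5 : χ H₂ ∌ L ▸ r4 (r1 d)
      o5 = out (cataL good L d x₀ y)
      same : ∀ μ → PM (χ H₂) μ → at h d μ ≡ at L (r1 d) μ
      same μ pm = trans (s≡r3 μ) (ends-equal (cover pm L (r1 d) L∈) (cover pm L (r2 d) L∈)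
        (off pm (L ▸ r1 d) (r3 d) o1 (trans (cong (χ H₂) (▸-next L (r1 d))) o2))
        (off pm (L ▸ r2 d) (r4 d) o2 (trans (cong (χ H₂) (▸-next L (r2 d))) o3)))
        where
        ends-equal : ∀ {a b c t u} → one a b t ≡ true → one b c u ≡ true → t ≡ false → u ≡ false → c ≡ a
        ends-equal {true} {false} {true} _ _ _ _ = refl
        ends-equal {false} {true} {false} _ _ _ _ = refl
        ends-equal {true} {false} {false} {_} {true} _ _ _ ()
        ends-equal {true} {false} {false} {_} {false} _ () _ _
        ends-equal {false} {true} {true} _ () _ _
        ends-equal {true} {true} () _ _ _
        ends-equal {false} {false} {_} {true} _ _ () _
        ends-equal {false} {false} {_} {false} () _ _ _
      base : Minus H₃ H₂ (λ y → OnRay L d (suc q) y ⊎ OnRay L (r2 d) 0 y)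
      base = record
        { sub = λ y t → kept M₂ y (sub M₃ y t) λ { (inj₁ w) → clash t (cut M₃ y (inj₁ w)) ; (inj₂ w) → clash t (cut M₃ y (inj₂ (inj₁ w))) }
        ; cut = λ { y (inj₁ (k , l , w)) → cut M₃ y (inj₂ (inj₂ (suc k , s≤s l , w))) ; y (inj₂ (zero , _ , w)) → cut M₃ y (inj₂ (inj₂ (1 , s≤s z≤n , w))) }
        ; kept = λ y t nk → kept M₃ y (s y t) λ { (inj₁ w) → clash t (cut M₂ y (inj₁ w)) ; (inj₂ (inj₁ w)) → clash t (cut M₂ y (inj₂ w))
                                                ; (inj₂ (inj₂ (zero , _ , w))) → clash t (cut M₂ y (inj₁ (0 , z≤n , w)))
                                                ; (inj₂ (inj₂ (suc k , s≤s l , w))) → nk (inj₁ (k , l , w)) } }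

  -- A matching of `H₂` uses either the side of `L` facing `h` or the opposite side `d`, the last
  -- vertical edge of T₃. In the latter case both chains leaving `L` sideways are forced, which
  -- leaves `H₄`.
  arm-short : p ≡ 0 → ∀ H₄ q q' → Ray (χ H₂) (r1 d) L q → Ray (χ H₂) (r5 d) L q' →
    Minus H₄ H₂ (λ y → OnRay L (r1 d) q y ⊎ OnRay L (r5 d) q' y) → A₂ ≈P A H₂ (at h d) +P xpow 1 (A H₄ every)
  arm-short refl H₄ q q' r r' M₄ = ≈-trans (A-split H₂ {every} {at h d} {at L d} split) (+-cong {A H₂ (at h d)} (λ _ → refl)
      (starA (left {d}) H₂ H₄ L q q' s L∈ o0 o2 o3 o4 r r' M₄))
    where
    open OnH₂
    o0 : χ H₂ ∌ L ▸ d
    o0 = out (ray-end ray₀)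
    split : ∀ μ → PM (χ H₂) μ → 1 ≡ bit (at h d μ) ℕ.+ bit (at L d μ)
    split μ pm = trans (complement (cover pm L (r2 d) L∈) (off pm (L ▸ r2 d) (r4 d) o2 (trans (cong (χ H₂) (▸-next L (r2 d))) o3)))
      (cong₂ (λ a b → bit a ℕ.+ bit b) (sym (s≡r3 μ)) (trans
        (Flux.flux′ good s pm L (r1 d) L∈ o2 (trans (cong (λ j → χ H₂ (L ▸ j)) (r6 d)) o0)) (cong (λ j → at L j μ) (r6 d))))
      where
      complement : ∀ {a b t} → one a b t ≡ true → t ≡ false → 1 ≡ bit b ℕ.+ bit a
      complement {true} {false} _ _ = refl
      complement {false} {true} _ _ = refl
      complement {true} {true} () _
      complement {false} {false} {true} _ ()
      complement {false} {false} {false} () _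

-- Chains and tails of the statement

along-⊛ : ∀ c d k → along c d k ≡ c ⊕C (k ⊛ vec d)
along-⊛ (a , b) d zero = sym (cong₂ _,_ (trans (cong (ℤ._+_ a) (ℤP.*-zeroˡ (proj₁ (vec d)))) (ℤP.+-identityʳ a)) (trans (cong (ℤ._+_ b) (ℤP.*-zeroˡ (proj₂ (vec d)))) (ℤP.+-identityʳ b)))
along-⊛ (a , b) d (suc k) = trans (along-⊛ ((a , b) ▸ d) d k) (cong₂ _,_ (lem a (proj₁ (vec d)) (+ k)) (lem b (proj₂ (vec d)) (+ k)))
  where lem : ∀ a v k → a + v + k * v ≡ a + (+ 1 + k) * v
        lem = solve-∀

cellAt-along : ∀ ch k → cellAt ch k ≡ along (start ch) (dir ch) k
cellAt-along ch k = sym (along-⊛ (start ch) (dir ch) k)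

Ray⁺ : ∀ {X d} n {c} → (∀ k → k ℕ.< n → X ∋ (along c d (suc k))) → X ∌ (along c d (suc n)) → Ray X d c n
Ray⁺ zero f e = stop e
Ray⁺ (suc n) f e = more (f 0 (s≤s z≤n)) (Ray⁺ n (λ k l → f (suc k) (s≤s l)) e)

along-back : ∀ c d k i → along (along c d (k ℕ.+ i)) (r3 d) i ≡ along c d k
along-back c d k zero = cong (along c d) (ℕP.+-identityʳ k)
along-back c d k (suc i) = trans (cong (λ p → along p (r3 d) i) (trans (cong (λ x → x ▸ r3 d) (trans (cong (along c d) (ℕP.+-suc k i)) (along-suc c d (k ℕ.+ i)))) (▸-opposite (along c d (k ℕ.+ i)) d))) (along-back c d k i)

filterB-one : ∀ {A : Set} (p : A → Bool) xs {i j} → length (filterB p xs) ≡ 1 → i ∈ xs → j ∈ xs → p i ≡ true → p j ≡ true → i ≡ j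
filterB-one p xs e i j pi pj = length-one e (∈-filterB⁺ p xs i pi) (∈-filterB⁺ p xs j pj)

filterB-two : ∀ {A : Set} (p : A → Bool) xs {i j k} → length (filterB p xs) ≡ 2 → i ∈ xs → j ∈ xs → k ∈ xs →
  p i ≡ true → p j ≡ true → p k ≡ true → i ≢ j → k ≢ i → k ≢ j → ⊥
filterB-two p xs {i} {j} {k} e mi mj mk pi pj pk ij ki kj = too-many (length-≤ _≡_ (k ∷ i ∷ j ∷ []) (filterB p xs) ((ki ∷ kj ∷ []) ∷ (ij ∷ []) ∷ [] ∷ []) among (λ _ _ p q → trans p (sym q)))
  where
  among : ∀ x → x ∈ k ∷ i ∷ j ∷ [] → ∃[ y ] (y ∈ filterB p xs × x ≡ y)
  among x (here refl) = x , ∈-filterB⁺ p xs mk pk , refl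
  among x (there (here refl)) = x , ∈-filterB⁺ p xs mi pi , refl
  among x (there (there (here refl))) = x , ∈-filterB⁺ p xs mj pj , refl
  too-many : 3 ℕ.≤ length (filterB p xs) → ⊥
  too-many l with subst (3 ℕ.≤_) e l
  ... | s≤s (s≤s ())

Traces : Chain → Cell → Fin 6 → ℕ → Set
Traces ch c d n = (∀ x → InChain x ch → OnRay c d n x) × (∀ x → OnRay c d n x → InChain x ch)

traces : ∀ s d n → Traces (chain s d (suc n)) s d n
traces s d n = (λ { x (k , s≤s l , e) → k , l , trans e (cellAt-along (chain s d (suc n)) k) })
             , (λ { x (k , l , e) → k , s≤s l , trans e (sym (cellAt-along (chain s d (suc n)) k)) })

traces-single : ∀ {T h} d → SingleAt T h → Traces T h d 0
traces-single {chain s δ _} d (refl , refl) = (λ { x (zero , _ , e) → 0 , z≤n , trans e (cellAt-along (chain s δ 1) 0) ; x (suc k , s≤s () , _) })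
  , (λ { x (zero , _ , e) → 0 , s≤s z≤n , trans e (sym (cellAt-along (chain s δ 1) 0)) })

module Chains {H : List Cell} (good : Good (χ H)) where

  record MaxRay (h : Cell) (d : Fin 6) (n : ℕ) : Set where
    field
      origin : χ H ∋ h
      ray    : Ray (χ H) d h n
      gap    : χ H ∌ h ▸ r3 d
  open MaxRay public

  lin-cell : ∀ {s d n} → LinChain H (chain s d n) → ∀ k → k ℕ.< n → χ H ∋ (along s d k)
  lin-cell {s} {d} {n} (_ , f) k l = trans (cong (χ H) (along-⊛ s d k)) (χ⁺ (f k l))

  lin⁺ : ∀ s d n → (∀ k → k ℕ.≤ n → χ H ∋ (along s d k)) → LinChain H (chain s d (suc n))
  lin⁺ s d n f = s≤s z≤n , λ { k (s≤s l) → χ⁻ (trans (cong (χ H) (sym (along-⊛ s d k))) (f k l)) }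

  max-ray : ∀ {s d n} → MaxChain H (chain s d (suc n)) → MaxRay s d n
  max-ray {s} {d} {n} (lin , mx) = record
    { origin = cells 0 (s≤s z≤n) ; ray = Ray⁺ n (λ k l → cells (suc k) (s≤s l)) (not-true longer) ; gap = not-true earlier }
    where
    cells = lin-cell {s} {d} lin
    longer : χ H ∋ (along s d (suc n)) → ⊥
    longer t = ℕP.1+n≰n (mx (chain s d (suc (suc n))) (lin⁺ s d (suc n) all)
      (λ x q → proj₂ (traces s d (suc n)) x (let (k , l , e) = proj₁ (traces s d n) x q in k , ℕP.m≤n⇒m≤1+n l , e)))
      where
      all : ∀ k → k ℕ.≤ suc n → χ H ∋ (along s d k)
      all k l with k ℕ.≟ suc n
      ... | yes refl = t
      ... | no ne = cells k (ℕP.≤∧≢⇒< l ne)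
    earlier : χ H ∋ s ▸ r3 d → ⊥
    earlier t = ℕP.1+n≰n (mx (chain s' d (suc (suc n))) (lin⁺ s' d (suc n) all)
      (λ x q → proj₂ (traces s' d (suc n)) x (let (k , l , e) = proj₁ (traces s d n) x q in suc k , s≤s l , trans e (cong (λ p → along p d k) (sym next)))))
      where
      s' = s ▸ r3 d
      next : s' ▸ d ≡ s
      next = trans (cong (λ j → s' ▸ j) (sym (r6 d))) (▸-opposite s (r3 d))
      all : ∀ k → k ℕ.≤ suc n → χ H ∋ (along s' d k)
      all zero _ = t
      all (suc k) (s≤s l) = trans (cong (λ p → χ H (along p d k)) next) (cells k (s≤s l))

  private
    nbr? : Cell → Fin 6 → Bool
    nbr? c i = memB (c ▸ i) H

  only-nbr : ∀ {c i} → numNbrs H c ≡ 1 → χ H ∋ c ▸ i → ∀ j → j ≢ i → χ H ∌ c ▸ j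
  only-nbr {c} {i} e t j ne = not-true λ t' → ne (filterB-one (nbr? c) (allFin 6) e (∈-allFin j) (∈-allFin i) t' t)

  two-nbrs : ∀ {c i j k} → numNbrs H c ≡ 2 → χ H ∋ c ▸ i → χ H ∋ c ▸ j → i ≢ j → k ≢ i → k ≢ j → χ H ∌ c ▸ k
  two-nbrs {c} {i} {j} {k} e ti tj ij ki kj = not-true λ tk → filterB-two (nbr? c) (allFin 6) e (∈-allFin i) (∈-allFin j) (∈-allFin k) ti tj tk ij ki kj

  r2≢ : ∀ d → r2 d ≢ d
  r2≢ = six (λ ()) (λ ()) (λ ()) (λ ()) (λ ()) (λ ())

  r3≢ : ∀ d → r3 d ≢ d
  r3≢ = six (λ ()) (λ ()) (λ ()) (λ ()) (λ ()) (λ ())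

  terminal-one : ∀ {c} h → χ H ∋ h → h ≢ c → Terminal H c → numNbrs H c ≡ 1
  terminal-one h x ne (_ , inj₁ e) = e
  terminal-one h x ne (_ , inj₂ all) = ⊥-elim (ne (all h (χ⁻ x)))

  -- An inner cell of the tail has a successor, so `cata` empties its sides; the last cell is
  -- terminal and its predecessor is its only neighbour.
  terminal-bare : ∀ {h d n} → MaxRay h d (suc n) → Terminal H (along h d (suc n)) → Bare (χ H) (h ▸ d) d n
  terminal-bare {h} {d} {n} R T k l = sides (k ℕ.≟ n)
    where
    inner : k ≢ n → χ H ∌ along (h ▸ d) d k ▸ r1 d × χ H ∌ along (h ▸ d) d k ▸ r5 d
    inner ne = cata good c d x y , cataL good c d x y
      where
      c = along (h ▸ d) d k
      l' = ℕP.≤∧≢⇒< l ne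
      x = ray-in (ray R) k (ℕP.m<n⇒m<1+n l')
      y : χ H ∋ c ▸ d
      y = trans (cong (χ H) (sym (along-suc (h ▸ d) d k))) (ray-in (ray R) (suc k) (s≤s l'))
    c : Cell
    c = along h d (suc n)
    one′ : numNbrs H c ≡ 1
    one′ = terminal-one {c} h (origin R) (λ e → ℕP.1+n≢0 (along-inj h d {suc n} {0} (sym e))) T
    prev : χ H ∋ c ▸ r3 d
    prev = trans (cong (χ H) (trans (cong (λ p → p ▸ r3 d) (along-suc h d n)) (▸-opposite (along h d n) d))) (ray-in′ (origin R) (ray R) n (ℕP.n≤1+n n))
    outer : χ H ∌ c ▸ r1 d × χ H ∌ c ▸ r5 d
    outer = only-nbr {c} {r3 d} one′ prev (r1 d) (λ e → r2≢ (r1 d) (sym e)) , only-nbr {c} {r3 d} one′ prev (r5 d) (r2≢ (r3 d))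
    sides : Dec (k ≡ n) → χ H ∌ along (h ▸ d) d k ▸ r1 d × χ H ∌ along (h ▸ d) d k ▸ r5 d
    sides (no ne) = inner ne
    sides (yes e) = subst (λ j → χ H ∌ along (h ▸ d) d j ▸ r1 d × χ H ∌ along (h ▸ d) d j ▸ r5 d) (sym e) outer

  -- Containing both `L` and `L ▸ i` puts the chain on the line of the ray, in one of the two
  -- orientations. The gap behind `L` and the end of the ray confine it.
  chain-on-ray : ∀ {L i q} → Ray (χ H) i L q → χ H ∌ L ▸ r3 i → ∀ ch → LinChain H ch → InChain L ch → InChain (L ▸ i) ch →
    (∀ x → InChain x ch → OnRay L i q x) × len ch ℕ.≤ suc q
  chain-on-ray {L} {i} {q} r gp (chain s δ n) lin (j , lj , ej) (j' , lj' , ej') = orient (dirs δ i) refl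
    where
    eL : L ≡ along s δ j
    eL = trans ej (cellAt-along (chain s δ n) j)
    eL' : L ▸ i ≡ along s δ j'
    eL' = trans ej' (cellAt-along (chain s δ n) j')
    cells = lin-cell {s} {δ} lin
    flat : φ δ (vec i) ≢ 0ℤ → ⊥
    flat nz = flank-∉ s δ j j' i nz (trans (cong (λ p → p ▸ i) (sym eL)) eL')
    bounded-by : ∀ t → (∀ k → k ℕ.≤ t → χ H ∋ (along L i k)) → t ℕ.≤ q
    bounded-by t f = ℕP.≮⇒≥ λ l → clash (f (suc q) l) (ray-end r)
    Goal : Set
    Goal = (∀ x → InChain x (chain s δ n) → OnRay L i q x) × n ℕ.≤ suc q
    last : ∀ n → (∀ t → t ℕ.< n → t ℕ.≤ q) → n ℕ.≤ suc q
    last zero f = z≤n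
    last (suc n) f = s≤s (f n ℕP.≤-refl)
    forward : δ ≡ i → Goal
    forward refl = (λ { x (t , l , e) → t , onray t l , trans e (trans (cellAt-along (chain s δ n) t) (cong (λ p → along p δ t) (sym L≡s))) }) , last n onray
      where
      begins : ∀ j → L ≡ along s δ j → j ℕ.< n → L ≡ s
      begins zero e _ = e
      begins (suc j) e l = clash (trans (cong (χ H) (trans (cong (λ p → p ▸ r3 δ) (trans e (along-suc s δ j))) (▸-opposite (along s δ j) δ))) (cells j (ℕP.<⇒≤ l))) gp
      L≡s : L ≡ s
      L≡s = begins j eL lj
      onray : ∀ t → t ℕ.< n → t ℕ.≤ q
      onray t l = bounded-by t (λ k l' → trans (cong (λ p → χ H (along p δ k)) L≡s) (cells k (ℕP.≤-<-trans l' l)))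
    backward : i ≡ r3 δ → Goal
    backward refl = (λ { x (t , l , e) → j ℕ.∸ t , onray t l , trans e (trans (cellAt-along (chain s δ n) t) (sym (at-L t (before t l)))) })
        , ℕP.≤-trans (last-j n (λ t l → before t l)) (s≤s (subst (ℕ._≤ q) refl (onray 0 (ℕP.≤-<-trans z≤n lj))))
      where
      before : ∀ t → t ℕ.< n → t ℕ.≤ j
      before t l = ℕP.≮⇒≥ λ j<t → clash (trans (cong (χ H) (trans (cong₂ (λ p a → p ▸ a) eL (r6 δ)) (sym (along-suc s δ j)))) (cells (suc j) (ℕP.≤-<-trans j<t l))) gp
      last-j : ∀ n → (∀ t → t ℕ.< n → t ℕ.≤ j) → n ℕ.≤ suc j
      last-j zero f = z≤n
      last-j (suc n) f = s≤s (f n ℕP.≤-refl)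
      at-L : ∀ t → t ℕ.≤ j → along L (r3 δ) (j ℕ.∸ t) ≡ along s δ t
      at-L t l = trans (cong (λ p → along p (r3 δ) (j ℕ.∸ t)) (trans eL (cong (along s δ) (sym (ℕP.m+[n∸m]≡n l))))) (along-back s δ t (j ℕ.∸ t))
      onray : ∀ t → t ℕ.< n → j ℕ.∸ t ℕ.≤ q
      onray t l = bounded-by (j ℕ.∸ t) inside
        where
        inside : ∀ k → k ℕ.≤ j ℕ.∸ t → χ H ∋ (along L (r3 δ) k)
        inside k l' = trans (cong (λ a → χ H (along L (r3 δ) a)) (sym (ℕP.m∸[m∸n]≡n k≤j))) (trans (cong (χ H) (at-L (j ℕ.∸ k) (ℕP.m∸n≤m j k))) (cells (j ℕ.∸ k) (ℕP.≤-<-trans (ℕP.m∸n≤m j k) lj)))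
          where k≤j = ℕP.≤-trans l' (ℕP.m∸n≤m j t)
    orient : Dir δ i → i ≡ i → Goal
    orient is0 _ = forward refl
    orient is1 _ = ⊥-elim (flat (+1≢0 (φ-r1 δ)))
    orient is2 _ = ⊥-elim (flat (+1≢0 (φ-r2 δ)))
    orient is3 _ = backward refl
    orient is4 _ = ⊥-elim (flat (-1≢0 (φ-r4 δ)))
    orient is5 _ = ⊥-elim (flat (-1≢0 (φ-r5′ δ)))

-- Adjacent sides of a hexagon and the hexagons deleted for H₄

end⁺ : ∀ c i → IsEnd (vtx c i) (edge c i) × IsEnd (vtx c (r5 i)) (edge c i)
end⁺ c i with ends-edge c i
... | inj₁ (a , b) = inj₁ (sym a) , inj₂ (sym b)
... | inj₂ (a , b) = inj₂ (sym b) , inj₁ (sym a)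

end⁻ : ∀ {w} c i → IsEnd w (edge c i) → w ≡ vtx c i ⊎ w ≡ vtx c (r5 i)
end⁻ c i h with ends-edge c i | h
... | inj₁ (a , _) | inj₁ e = inj₁ (trans e a)
... | inj₁ (_ , b) | inj₂ e = inj₂ (trans e b)
... | inj₂ (a , _) | inj₁ e = inj₂ (trans e a)
... | inj₂ (_ , b) | inj₂ e = inj₁ (trans e b)

vtx-par : ∀ c i → proj₂ (vtx c i) ≡ par i
vtx-par (a , b) d0 = refl
vtx-par (a , b) d1 = refl
vtx-par (a , b) d2 = refl
vtx-par (a , b) d3 = refl
vtx-par (a , b) d4 = refl
vtx-par (a , b) d5 = refl

vtx-r3 : ∀ c i → vtx c (r3 i) ≢ vtx c i
vtx-r3 c i e = lem i (trans (sym (vtx-par c (r3 i))) (trans (cong proj₂ e) (vtx-par c i)))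
  where
  lem : ∀ i → par (r3 i) ≢ par i
  lem = six (λ ()) (λ ()) (λ ()) (λ ()) (λ ()) (λ ())

vtx-r2 : ∀ c i → vtx c (r2 i) ≢ vtx c i
vtx-r2 (a , b) i e = lem i (cong (λ v → proj₁ (proj₁ v)) e) (cong (λ v → proj₂ (proj₁ v)) e)
  where
  shift : ∀ {x} → x + -1ℤ ≢ x
  shift {x} q = absurd (ℤ-cancelˡ x (trans q (sym (ℤP.+-identityʳ x))))
    where absurd : -1ℤ ≢ 0ℤ
          absurd ()
  lem : ∀ i → proj₁ (proj₁ (vtx (a , b) (r2 i))) ≡ proj₁ (proj₁ (vtx (a , b) i)) → proj₂ (proj₁ (vtx (a , b) (r2 i))) ≡ proj₂ (proj₁ (vtx (a , b) i)) → ⊥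
  lem d0 p _ = shift p
  lem d1 _ q = shift q
  lem d2 p _ = shift (sym p)
  lem d3 p _ = shift (sym p)
  lem d4 _ q = shift (sym q)
  lem d5 p _ = shift p

-- Excludes the preceding hexagon of T₃ from the deletion for H₄: it is in `H`, but the side of `L`
-- that it contains is opposite to v.
opposite-ends : ∀ c d w → IsEnd w (edge c (r3 d)) → IsEnd w (edge c d) → ⊥
opposite-ends c d w p q with end⁻ c (r3 d) p | end⁻ c d q
... | inj₁ e | inj₁ e' = vtx-r3 c d (trans (sym e) e')
... | inj₁ e | inj₂ e' = vtx-r2 c (r3 d) (trans (sym e') e)
... | inj₂ e | inj₁ e' = vtx-r2 c d (trans (cong (vtx c) (sym (r53 d))) (trans (sym e) e'))
... | inj₂ e | inj₂ e' = vtx-r3 c (r2 d) (trans (sym e') (trans e (cong (vtx c) (r53 d))))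

edge-r1 : ∀ c i → edge c (r1 i) ≢ edge c i
edge-r1 c d0 ()
edge-r1 c d1 ()
edge-r1 c d2 ()
edge-r1 c d3 ()
edge-r1 c d4 ()
edge-r1 c d5 ()

φ-along⁰′ : ∀ t d → φ t (vec d) ≡ 0ℤ → ∀ k c → φ t (along c d k) ≡ φ t c
φ-along⁰′ t d e zero c = refl
φ-along⁰′ t d e (suc k) c = trans (φ-along⁰′ t d e k (c ▸ d)) (trans (φ-add t c (vec d)) (trans (cong (ℤ._+_ (φ t c)) e) (ℤP.+-identityʳ (φ t c))))

-- A chain leaving `h ▸ d` stays at level 1, relative to `h`, of a linear functional that is
-- constant on the ray from `h`; in `apart⁻` it decreases along that ray.
apart⁰ : ∀ t h d i e k j → φ t (vec d) ≡ + 1 → φ t (vec i) ≡ 0ℤ → φ t (vec e) ≡ 0ℤ → along (h ▸ d) i k ≢ along h e j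
apart⁰ t h d i e k j pd pi pe q = absurd (ℤ-cancelˡ (φ t h) (trans (cong (ℤ._+_ (φ t h)) (sym pd)) (trans (sym (φ-add t h (vec d)))
    (trans (sym (φ-along⁰′ t i pi k (h ▸ d))) (trans (cong (φ t) q) (trans (φ-along⁰′ t e pe j h) (sym (ℤP.+-identityʳ (φ t h)))))))))
  where absurd : + 1 ≢ 0ℤ
        absurd ()

apart⁻ : ∀ t h d i e k j → φ t (vec d) ≡ + 1 → φ t (vec i) ≡ 0ℤ → φ t (vec e) ≡ -1ℤ → along (h ▸ d) i k ≢ along h e j
apart⁻ t h d i e k j pd pi pe q = pos≢neg 0 j (ℤ-cancelˡ (φ t h) (trans (cong (ℤ._+_ (φ t h)) (sym pd)) (trans (sym (φ-add t h (vec d)))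
    (trans (sym (φ-along⁰′ t i pi k (h ▸ d))) (trans (cong (φ t) q) (φ-along⁻ t e pe j h))))))

φ-r3 : ∀ t → φ t (vec (r3 t)) ≡ 0ℤ
φ-r3 t = trans (vec-r3 t t) (cong -_ (φ-0 t))

module Side₄ {H : List Cell} (good : Good (χ H)) where
  open Chains {H} good

  DeletedAt : Cell → Fin 6 → Cell → Set
  DeletedAt L d y = ∃[ i ] (¬ (edge L i ≡ edge L d) × (∃[ w ] (IsEnd w (edge L i) × IsEnd w (edge L d))) × (L ▸ i) ∈ H
    × ∃[ ch ] (MaxChain H ch × InChain L ch × InChain (L ▸ i) ch × InChain y ch))

  module _ {L : Cell} {d : Fin 6} (x : χ H ∋ L) (xb : χ H ∋ L ▸ r3 d) (q q' : ℕ)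
    (R : Ray (χ H) (r1 d) L q) (R' : Ray (χ H) (r5 d) L q') where

    private
      gap₁ : χ H ∌ L ▸ r3 (r1 d)
      gap₁ = cata good L (r3 d) x xb
      gap₅ : χ H ∌ L ▸ r3 (r5 d)
      gap₅ = trans (cong (λ j → χ H (L ▸ j)) (trans (cong r2 (r6 d)) (sym (r53 d)))) (cataL good L (r3 d) x xb)

    deleted-ray : ∀ y → DeletedAt L d y → OnRay L (r1 d) q y ⊎ OnRay L (r5 d) q' y
    deleted-ray y (i , ne , (w , e₁ , e₂) , m , ch , (lin , _) , iL , iL' , iy) = orient (dirs d i) ne e₁ m iL'
      where
      orient : ∀ {i} → Dir d i → ¬ (edge L i ≡ edge L d) → IsEnd w (edge L i) → (L ▸ i) ∈ H → InChain (L ▸ i) ch → OnRay L (r1 d) q y ⊎ OnRay L (r5 d) q' y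
      orient is0 ne _ _ _ = ⊥-elim (ne refl)
      orient is1 _ _ _ iL' = inj₁ (proj₁ (chain-on-ray R gap₁ ch lin iL iL') y iy)
      orient is2 _ _ m _ = clash (χ⁺ m) (trans (cong (λ j → χ H (L ▸ j)) (sym (r53 d))) (cataL good L (r3 d) x xb))
      orient is3 _ e₁ _ _ = ⊥-elim (opposite-ends L d w e₁ e₂)
      orient is4 _ _ m _ = clash (χ⁺ m) (cata good L (r3 d) x xb)
      orient is5 _ _ _ iL' = inj₂ (proj₁ (chain-on-ray R' gap₅ ch lin iL iL') y iy)

    private
      -- The chain from `L` to the end of the ray witnesses the deletion. It is maximal because any
      -- chain containing it passes through `L` and `L ▸ i` and is confined by `chain-on-ray`.
      delete : ∀ i q → Ray (χ H) i L q → χ H ∌ L ▸ r3 i → ¬ (edge L i ≡ edge L d) → (∃[ w ] (IsEnd w (edge L i) × IsEnd w (edge L d))) →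
        ∀ y k → suc k ℕ.≤ q → y ≡ along L i (suc k) → DeletedAt L d y
      delete i (suc q) r gp ne sh y k l e = i , ne , sh , χ⁻ first , ch , (lin , maximal) , iL , iL' , proj₂ (traces L i (suc q)) y (suc k , l , e)
        where
        ch = chain L i (suc (suc q))
        first : χ H ∋ L ▸ i
        first = ray-in r 0 (s≤s z≤n)
        lin : LinChain H ch
        lin = lin⁺ L i (suc q) (λ k l → ray-in′ x r k l)
        iL : InChain L ch
        iL = proj₂ (traces L i (suc q)) L (0 , z≤n , refl)
        iL' : InChain (L ▸ i) ch
        iL' = proj₂ (traces L i (suc q)) (L ▸ i) (1 , s≤s z≤n , refl)
        maximal : ∀ ch' → LinChain H ch' → Contains ch' ch → len ch' ℕ.≤ suc (suc q)
        maximal ch' lin' sub = proj₂ (chain-on-ray r gp ch' lin' (sub L iL) (sub (L ▸ i) iL'))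

    ray-deleted₁ : ∀ y k → suc k ℕ.≤ q → y ≡ along L (r1 d) (suc k) → DeletedAt L d y
    ray-deleted₁ = delete (r1 d) q R gap₁ (edge-r1 L d) (vtx L d , subst (λ v → IsEnd v (edge L (r1 d))) (cong (vtx L) (r6 d)) (proj₂ (end⁺ L (r1 d))) , proj₁ (end⁺ L d))

    ray-deleted₅ : ∀ y k → suc k ℕ.≤ q' → y ≡ along L (r5 d) (suc k) → DeletedAt L d y
    ray-deleted₅ = delete (r5 d) q' R' gap₅ (λ e → edge-r1 L (r5 d) (trans (cong (edge L) (r6 d)) (sym e)))
      (vtx L (r5 d) , proj₁ (end⁺ L (r5 d)) , proj₂ (end⁺ L d))

module _ {H : List Cell} where

  minus₁ : ∀ {h T T' H₁} (K : Cell → Set) → IsH₁ H h T T' H₁ → (∀ x → K x → (InChain x T ⊎ InChain x T') × x ≢ h) →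
    (∀ x → ¬ K x → InChain x T ⊎ InChain x T' → x ≡ h) → Minus H₁ H K
  minus₁ {h} {T} {T'} {H₁} K is f g = record
    { sub = λ x t → χ⁺ (proj₁ (proj₁ (is x) (χ⁻ t)))
    ; cut = λ x k → χ-false (λ i → proj₂ (f x k) (proj₂ (proj₁ (is x) i) (proj₁ (f x k))))
    ; kept = λ x t n → χ⁺ (proj₂ (is x) (χ⁻ t , g x n)) }

  minus₂ : ∀ {T T' H₂} (K : Cell → Set) → IsH₂ H T T' H₂ → (∀ x → K x → InChain x T ⊎ InChain x T') → (∀ x → InChain x T ⊎ InChain x T' → K x) → Minus H₂ H K
  minus₂ K is f g = record
    { sub = λ x t → χ⁺ (proj₁ (proj₁ (is x) (χ⁻ t)))
    ; cut = λ x k → χ-false (λ i → proj₂ (proj₁ (is x) i) (f x k))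
    ; kept = λ x t n → χ⁺ (proj₂ (is x) (χ⁻ t , λ q → n (g x q))) }

  minus₃ : ∀ {T T' T″ H₃} (K : Cell → Set) → IsH₃ H T T' T″ H₃ → (∀ x → K x → InChain x T ⊎ InChain x T' ⊎ InChain x T″) →
    (∀ x → InChain x T ⊎ InChain x T' ⊎ InChain x T″ → K x) → Minus H₃ H K
  minus₃ K is f g = record
    { sub = λ x t → χ⁺ (proj₁ (proj₁ (is x) (χ⁻ t)))
    ; cut = λ x k → χ-false (λ i → proj₂ (proj₁ (is x) i) (f x k))
    ; kept = λ x t n → χ⁺ (proj₂ (is x) (χ⁻ t , λ q → n (g x q))) }

-- Assembling the formulas

tail-length : ∀ ℓ t → t ≡ + ℓ - + 2 → 0ℤ ≤ t → ∃[ n ] (ℓ ≡ suc (suc n) × t ≡ + n)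
tail-length zero _ refl ()
tail-length (suc zero) _ refl ()
tail-length (suc (suc n)) _ refl _ = n , refl , refl

xpow-cong : ∀ j {p q : Poly} → p ≈P q → xpow j p ≈P xpow j q
xpow-cong zero e = e
xpow-cong (suc j) e = shift-cong (xpow-cong j e)

module Final {H : List Cell} (good : Good (χ H)) where
  open Chains {H} good
  open Tails {H} good

  kink-Af : ∀ {m d s} → Side m d s → ∀ T₁ T₂ T₃ H₁ H₂ H₃ h n n₃ → MaxRay h d (suc n) → Bare (χ H) (h ▸ d) d n → Ray (χ H) s h n₃ →
    χ H ∌ h ▸ m → χ H ∌ h ▸ r2 m → χ H ∌ h ▸ r3 m → χ H ∌ h ▸ r4 m →
    Traces T₁ h d (suc n) → Traces T₂ h d 0 → Traces T₃ h s n₃ →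
    IsH₁ H h T₁ T₂ H₁ → IsH₂ H T₁ T₂ H₂ → IsH₃ H T₁ T₂ T₃ H₃ →
    Af H ≈P xpow 1 (Af H₂) +P xpow 1 (Af H₃) +P (xpow 1 (Af H₁) +P (+ n) ·P xpow 2 (Af H₂) -P xpow 2 (Af H₃))
  kink-Af {m} {d} {s} sd T₁ T₂ T₃ H₁ H₂ H₃ h n n₃ R bare r₃ o0 o2 o3 o4 (f₁ , g₁) (f₂ , g₂) (f₃ , g₃) is₁ is₂ is₃ k =
    trans (Af≡A H k) (trans (kinkA sd H₁ H₂ H₃ h n n₃ (origin R) (ray-in (ray R) 0 (s≤s z≤n)) (tail-ray (ray R)) bare r₃ o0 o2 o3 o4 M₁ M₂ M₃ k)
      (sym (cong₂ _+_ (cong₂ _+_ (xpow-cong 1 (Af≡A H₂) k) (xpow-cong 1 (Af≡A H₃) k))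
        (cong₂ _-_ (cong₂ _+_ (xpow-cong 1 (Af≡A H₁) k) (cong (ℤ._*_ (+ n)) (xpow-cong 2 (Af≡A H₂) k))) (xpow-cong 2 (Af≡A H₃) k)))))
    where
    tail-ray : Ray (χ H) d h (suc n) → Ray (χ H) d (h ▸ d) n
    tail-ray (more _ r) = r
    at-h : ∀ {x} → OnRay h d 0 x → OnRay h d (suc n) x
    at-h (zero , _ , e) = 0 , z≤n , e
    M₁ : Minus H₁ H (OnRay (h ▸ d) d n)
    M₁ = minus₁ {H} {h} {T₁} {T₂} (OnRay (h ▸ d) d n) is₁
      (λ { x q@(j , l , e) → inj₁ (g₁ x (suc j , s≤s l , e)) , λ { refl → along-∉ h d n q } })
      (λ { x nk (inj₁ q) → aside x nk (f₁ x q) ; x nk (inj₂ q) → aside x nk (at-h (f₂ x q)) })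
      where
      aside : ∀ x → ¬ OnRay (h ▸ d) d n x → OnRay h d (suc n) x → x ≡ h
      aside x nk (zero , _ , e) = e
      aside x nk (suc j , s≤s l , e) = ⊥-elim (nk (j , l , e))
    M₂ : Minus H₂ H (OnRay h d (suc n))
    M₂ = minus₂ {H} {T₁} {T₂} (OnRay h d (suc n)) is₂ (λ x q → inj₁ (g₁ x q)) (λ { x (inj₁ q) → f₁ x q ; x (inj₂ q) → at-h (f₂ x q) })
    M₃ : Minus H₃ H (λ x → OnRay h d (suc n) x ⊎ OnRay h s n₃ x)
    M₃ = minus₃ {H} {T₁} {T₂} {T₃} (λ x → OnRay h d (suc n) x ⊎ OnRay h s n₃ x) is₃ (λ { x (inj₁ q) → inj₁ (g₁ x q) ; x (inj₂ q) → inj₂ (inj₂ (g₃ x q)) })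
      (λ { x (inj₁ q) → inj₁ (f₁ x q) ; x (inj₂ (inj₁ q)) → inj₁ (at-h (f₂ x q)) ; x (inj₂ (inj₂ q)) → inj₂ (f₃ x q) })

  -- A linear chain is treated as a kink whose second arm, in direction `r2 d`, consists of `h`
  -- alone.
  line-Af : ∀ T₁ T₂ T₃ H₁ H₂ H₃ h d n → (∀ x → χ H ∋ x → OnRay h d (suc n) x) → (∀ x → OnRay h d (suc n) x → χ H ∋ x) →
    Traces T₁ h d (suc n) → SingleAt T₂ h → SingleAt T₃ h → IsH₁ H h T₁ T₂ H₁ → IsH₂ H T₁ T₂ H₂ → IsH₃ H T₁ T₂ T₃ H₃ →
    Af H ≈P xpow 1 (Af H₂) +P xpow 1 (Af H₃) +P (xpow 1 (Af H₁) +P (+ n) ·P xpow 2 (Af H₂) -P xpow 2 (Af H₃))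
  line-Af T₁ T₂ T₃ H₁ H₂ H₃ h d n on back tr s₂ s₃ = kink-Af (sideL d) T₁ T₂ T₃ H₁ H₂ H₃ h n 0
      (record { origin = back h (0 , z≤n , refl) ; ray = Ray⁺ (suc n) (λ k l → back _ (suc k , l , refl)) (not-true beyond) ; gap = gp })
      (λ k l → flank (suc k) (r1 d) (+1≢0 (φ-r1 d)) , flank (suc k) (r5 d) (-1≢0 (φ-r5′ d)))
      (stop (flank 0 (r2 d) (+1≢0 (φ-r2 d)))) (flank 0 (r1 d) (+1≢0 (φ-r1 d))) gp (flank 0 (r4 d) (-1≢0 (φ-r4 d))) (flank 0 (r5 d) (-1≢0 (φ-r5′ d)))
      tr (traces-single {T₂} d s₂) (traces-single {T₃} (r2 d) s₃)
    where
    flank : ∀ k i → φ d (vec i) ≢ 0ℤ → χ H ∌ along h d k ▸ i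
    flank k i nz = not-true λ t → let (j , _ , e) = on _ t in flank-∉ h d k j i nz e
    beyond : χ H ∋ (along h d (suc (suc n))) → ⊥
    beyond t = let (j , l , e) = on _ t in ℕP.1+n≰n (subst (ℕ._≤ suc n) (sym (along-inj h d {suc (suc n)} {j} e)) l)
    gp : χ H ∌ h ▸ r3 d
    gp = not-true λ t → bad (on _ t)
      where
      bad : ¬ OnRay h d (suc n) (h ▸ r3 d)
      bad (zero , _ , e) = ▸-≢ h (r3 d) e
      bad (suc j , _ , e) = Systems.opposite-∉ {H} good h d j 1 (sym e)

-- the part of formula (2) common to t₃ = 0 and t₃ ≥ 1
common : Poly → Poly → Poly → ℤ → ℤ → Poly
common A₁ A₂ A₃ t₁ t₂ = xpow 2 A₁ +P (+ 3 ·P xpow 2 A₂ +P (+ 2 * (t₁ + t₂)) ·P xpow 3 A₂ +P (t₁ * t₂) ·P xpow 4 A₂) -P xpow 3 A₃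

common-cong : ∀ {A₁ A₂ A₃ B₁ B₂ B₃ t₁ t₂} → A₁ ≈P B₁ → A₂ ≈P B₂ → A₃ ≈P B₃ → common A₁ A₂ A₃ t₁ t₂ ≈P common B₁ B₂ B₃ t₁ t₂
common-cong {t₁ = t₁} {t₂} e₁ e₂ e₃ k = cong₂ _-_ (cong₂ _+_ (xpow-cong 2 e₁ k)
  (cong₂ _+_ (cong₂ _+_ (cong (ℤ._*_ (+ 3)) (xpow-cong 2 e₂ k)) (cong (ℤ._*_ (+ 2 * (t₁ + t₂))) (xpow-cong 3 e₂ k)))
    (cong (ℤ._*_ (t₁ * t₂)) (xpow-cong 4 e₂ k)))) (xpow-cong 3 e₃ k)

common-swap : ∀ {A₁ A₂ A₃} t₁ t₂ → common A₁ A₂ A₃ t₁ t₂ ≈P common A₁ A₂ A₃ t₂ t₁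
common-swap {A₁} {A₂} {A₃} t₁ t₂ k = cong₂ (λ s p → xpow 2 A₁ k + (+ 3 * xpow 2 A₂ k + (+ 2 * s) * xpow 3 A₂ k + p * xpow 4 A₂ k) - xpow 3 A₃ k) (ℤP.+-comm t₁ t₂) (ℤP.*-comm t₁ t₂)

⊎-swap₃ : ∀ {A B C : Set} → A ⊎ B ⊎ C → B ⊎ A ⊎ C
⊎-swap₃ (inj₁ a) = inj₂ (inj₁ a)
⊎-swap₃ (inj₂ (inj₁ b)) = inj₁ b
⊎-swap₃ (inj₂ (inj₂ c)) = inj₂ (inj₂ c)

module Cases {H : List Cell} (good : Good (χ H)) where
  open Chains {H} good
  open Final {H} good
  open Tails {H} good
  open Side₄ {H} good

  module BranchCase (T T' : Chain) (H₁ H₂ H₃ : List Cell) (h : Cell) (d : Fin 6) (n n' p : ℕ)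
    (R₂ : MaxRay h (r2 d) (suc n)) (end₂ : Terminal H (along h (r2 d) (suc n)))
    (R₄ : MaxRay h (r4 d) (suc n')) (end₄ : Terminal H (along h (r4 d) (suc n')))
    (R₀ : MaxRay h d (suc p)) (tr : Traces T h (r2 d) (suc n)) (tr' : Traces T' h (r4 d) (suc n'))
    (is₁ : IsH₁ H h T T' H₁) (is₂ : IsH₂ H T T' H₂) (is₃ : IsH₃ H T T' (chain h d (suc (suc p))) H₃) where

    private
      T₃ : Chain
      T₃ = chain h d (suc (suc p))
      f = proj₁ tr
      g = proj₂ tr
      f' = proj₁ tr'
      g' = proj₂ tr'
      f₃ = proj₁ (traces h d (suc p))
      g₃ = proj₂ (traces h d (suc p))

      first : ∀ {e m} → Ray (χ H) e h (suc m) → χ H ∋ h ▸ e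
      first (more t _) = t
      next : ∀ {e m} → Ray (χ H) e h (suc m) → Ray (χ H) e (h ▸ e) m
      next (more _ r) = r

      K₁ K₂ K₃ : Cell → Set
      K₁ y = OnRay (h ▸ r2 d) (r2 d) n y ⊎ OnRay (h ▸ r4 d) (r4 d) n' y
      K₂ y = OnRay h (r2 d) (suc n) y ⊎ OnRay h (r4 d) (suc n') y
      K₃ y = OnRay h (r2 d) (suc n) y ⊎ OnRay h (r4 d) (suc n') y ⊎ OnRay h d (suc p) y

      inside : ∀ {e m x} → OnRay (h ▸ e) e m x → OnRay h e (suc m) x × x ≢ h
      inside {e} {m} {x} q@(j , l , eq) = (suc j , s≤s l , eq) , λ { refl → along-∉ h e m q }

      M₁ : Minus H₁ H K₁
      M₁ = minus₁ {H} {h} {T} {T'} K₁ is₁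
        (λ { x (inj₁ q) → inj₁ (g x (proj₁ (inside q))) , proj₂ (inside q) ; x (inj₂ q) → inj₂ (g' x (proj₁ (inside q))) , proj₂ (inside q) })
        (λ { x nk (inj₁ q) → at-h (λ w → nk (inj₁ w)) (f x q) ; x nk (inj₂ q) → at-h (λ w → nk (inj₂ w)) (f' x q) })
        where
        at-h : ∀ {x e m} → ¬ OnRay (h ▸ e) e m x → OnRay h e (suc m) x → x ≡ h
        at-h nk (zero , _ , e) = e
        at-h nk (suc j , s≤s l , e) = ⊥-elim (nk (j , l , e))
      M₂ : Minus H₂ H K₂
      M₂ = minus₂ {H} {T} {T'} K₂ is₂ (λ { x (inj₁ q) → inj₁ (g x q) ; x (inj₂ q) → inj₂ (g' x q) }) (λ { x (inj₁ q) → inj₁ (f x q) ; x (inj₂ q) → inj₂ (f' x q) })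
      M₃ : Minus H₃ H K₃
      M₃ = minus₃ {H} {T} {T'} {T₃} K₃ is₃
        (λ { x (inj₁ q) → inj₁ (g x q) ; x (inj₂ (inj₁ q)) → inj₂ (inj₁ (g' x q)) ; x (inj₂ (inj₂ q)) → inj₂ (inj₂ (g₃ x q)) })
        (λ { x (inj₁ q) → inj₁ (f x q) ; x (inj₂ (inj₁ q)) → inj₂ (inj₁ (f' x q)) ; x (inj₂ (inj₂ q)) → inj₂ (inj₂ (f₃ x q)) })

      open Branch {H} good H₁ H₂ H₃ h d n n' p (origin R₀) (first (ray R₂)) (next (ray R₂)) (terminal-bare R₂ end₂)
        (first (ray R₄)) (next (ray R₄)) (terminal-bare R₄ end₄) (first (ray R₀)) (next (ray R₀)) M₁ M₂ M₃

      formula : Af H ≈P common (Af H₁) (Af H₂) (Af H₃) (+ n) (+ n') +P xpow 1 (A H₂ (at h d))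
      formula k = trans (Af≡A H k) (trans (branchA k) (cong (λ t → t + xpow 1 (A H₂ (at h d)) k)
        (common-cong {t₁ = + n} {+ n'} (≈-sym (Af≡A H₁)) (≈-sym (Af≡A H₂)) (≈-sym (Af≡A H₃)) k)))

    long : ∀ q → p ≡ suc q → Af H ≈P common (Af H₁) (Af H₂) (Af H₃) (+ n) (+ n') +P xpow 2 (Af H₃)
    long q e k = trans (formula k) (cong (λ t → common (Af H₁) (Af H₂) (Af H₃) (+ n) (+ n') k + t)
      (trans (shift-cong (arm-long q e) k) (xpow-cong 2 (≈-sym (Af≡A H₃)) k)))

    short : p ≡ 0 → ∀ H₄ → IsH₄ H T T' T₃ H₄ → Af H ≈P common (Af H₁) (Af H₂) (Af H₃) (+ n) (+ n') +P (xpow 1 (Af H₂) -P xpow 2 (Af H₄))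
    short refl H₄ is₄ k = trans (formula k) (cong (λ t → common (Af H₁) (Af H₂) (Af H₃) (+ n) (+ n') k + t) (isolate {xpow 1 (A H₂ (at h d)) k} {xpow 1 (Af H₂) k} {xpow 2 (Af H₄) k} {xpow 2 A₄ k} (trans (sym (shift-+ (A H₂ (at h d)) (xpow 1 A₄) k))
        (trans (sym (shift-cong (arm-short refl H₄ q q' (into (r1 d) r (λ j j' → apart⁰ (r4 d) h d (r1 d) (r4 d) j j' pd z1 (φ-0 (r4 d)))
                                                                     (λ j j' → apart⁻ (r4 d) h d (r1 d) (r2 d) j j' pd z1 p2))
                                                       (into (r5 d) r' (λ j j' → apart⁻ (r5 d) h d (r5 d) (r4 d) j j' pd' (φ-0 (r5 d)) p4)
                                                                       (λ j j' → apart⁰ (r5 d) h d (r5 d) (r2 d) j j' pd' (φ-0 (r5 d)) p2')) M₄) k))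
          (xpow-cong 1 (≈-sym (Af≡A H₂)) k))) (xpow-cong 2 (≈-sym (Af≡A H₄)) k)))
      where
      A₄ = A H₄ every
      L = h ▸ d
      L∈ : χ H ∋ L
      L∈ = first (ray R₀)
      L-back : χ H ∋ L ▸ r3 d
      L-back = trans (cong (χ H) (▸-opposite h d)) (origin R₀)
      q q' : ℕ
      q = proj₁ (ray-exists H (r1 d) L L∈)
      q' = proj₁ (ray-exists H (r5 d) L L∈)
      r : Ray (χ H) (r1 d) L q
      r = proj₂ (ray-exists H (r1 d) L L∈)
      r' : Ray (χ H) (r5 d) L q'
      r' = proj₂ (ray-exists H (r5 d) L L∈)
      pd : φ (r4 d) (vec d) ≡ + 1
      pd = trans (cong (λ j → φ (r4 d) (vec j)) (sym (r6 d))) (φ-r2 (r4 d))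
      pd' : φ (r5 d) (vec d) ≡ + 1
      pd' = trans (cong (λ j → φ (r5 d) (vec j)) (sym (r6 d))) (φ-r1 (r5 d))
      p2 : φ (r4 d) (vec (r2 d)) ≡ -1ℤ
      p2 = trans (cong (λ j → φ (r4 d) (vec j)) (sym (cong r2 (r6 d)))) (φ-r4 (r4 d))
      z1 : φ (r4 d) (vec (r1 d)) ≡ 0ℤ
      z1 = trans (cong (λ j → φ (r4 d) (vec j)) (sym (cong r1 (r6 d)))) (φ-r3 (r4 d))
      p2' : φ (r5 d) (vec (r2 d)) ≡ 0ℤ
      p2' = trans (cong (λ j → φ (r5 d) (vec j)) (sym (cong r2 (r6 d)))) (φ-r3 (r5 d))
      p4 : φ (r5 d) (vec (r4 d)) ≡ -1ℤ
      p4 = trans (cong (λ j → φ (r5 d) (vec j)) (sym (r55 d))) (φ-r5′ (r5 d))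
      into : ∀ i {m} → Ray (χ H) i L m → (∀ j j' → along L i j ≢ along h (r4 d) j') → (∀ j j' → along L i j ≢ along h (r2 d) j') → Ray (χ H₂) i L m
      into i ri a₄ a₂ = Ray-⊆ (sub M₂) (λ j l → kept M₂ _ (ray-in ri j l) λ { (inj₁ (j' , _ , e)) → a₂ (suc j) j' e ; (inj₂ (j' , _ , e)) → a₄ (suc j) j' e }) ri
      isolate : ∀ {s a b c : ℤ} {w : ℤ} → s + w ≡ a → w ≡ b → s ≡ a - b
      isolate {s} {w = w} refl refl = lem s w
        where lem : ∀ s w → s ≡ s + w - w
              lem = solve-∀
      del : ∀ y → Deleted₄ H T₃ y → DeletedAt L d y
      del y = subst (λ c → DeletedAt c d y) (cellAt-along T₃ 1)
      del⁻ : ∀ y → DeletedAt L d y → Deleted₄ H T₃ y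
      del⁻ y = subst (λ c → DeletedAt c d y) (sym (cellAt-along T₃ 1))
      -- When t₃ = 0 the chain T₃ consists of `h` and `L`, so `H₄` is `H₂` without `L` and the two
      -- rays leaving it. The hexagon `L` itself is removed as a part of T₃, not through `Deleted₄`.
      M₄ : Minus H₄ H₂ (λ y → OnRay L (r1 d) q y ⊎ OnRay L (r5 d) q' y)
      M₄ = record
        { sub = λ y t → let ((m , nt) , _) = proj₁ (is₄ y) (χ⁻ t) in kept M₂ y (χ⁺ m) (λ { (inj₁ w) → nt (inj₁ (g y w)) ; (inj₂ w) → nt (inj₂ (inj₁ (g' y w))) })
        ; cut = λ { y (inj₁ (zero , _ , e)) → gone-L y e
                  ; y (inj₂ (zero , _ , e)) → gone-L y e
                  ; y (inj₁ (suc j , l , e)) → gone y (ray-deleted₁ L∈ L-back q q' r r' y j l e)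
                  ; y (inj₂ (suc j , l , e)) → gone y (ray-deleted₅ L∈ L-back q q' r r' y j l e) }
        ; kept = λ y t nk → χ⁺ (proj₂ (is₄ y) ((χ⁻ (sub M₂ y t) ,
            λ { (inj₁ w) → clash t (cut M₂ y (inj₁ (f y w)))
              ; (inj₂ (inj₁ w)) → clash t (cut M₂ y (inj₂ (f' y w)))
              ; (inj₂ (inj₂ w)) → on-T₃ y t nk (f₃ y w) }) , λ D → nk (deleted-ray L∈ L-back q q' r r' y (del y D)))) }
        where
        gone : ∀ y → DeletedAt L d y → χ H₄ ∌ y
        gone y D = χ-false (λ i → proj₂ (proj₁ (is₄ y) i) (del⁻ y D))
        gone-L : ∀ y → y ≡ L → χ H₄ ∌ y
        gone-L y e = χ-false (λ i → proj₂ (proj₁ (proj₁ (is₄ y) i)) (inj₂ (inj₂ (g₃ y (1 , s≤s z≤n , e)))))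
        on-T₃ : ∀ y → χ H₂ ∋ y → ¬ (OnRay L (r1 d) q y ⊎ OnRay L (r5 d) q' y) → OnRay h d 1 y → ⊥
        on-T₃ y t nk (zero , _ , e) = clash t (cut M₂ y (inj₁ (0 , z≤n , e)))
        on-T₃ y t nk (suc zero , _ , e) = nk (inj₁ (0 , z≤n , e))
        on-T₃ y t nk (suc (suc j) , s≤s () , _)

module Theorem {H : List Cell} (good : Good (χ H)) where
  open Chains {H} good
  open Final {H} good
  open Tails {H} good
  open Cases {H} good

  last-terminal : ∀ {s d n} → Terminal H (lastCell (chain s d (suc (suc n)))) → Terminal H (along s d (suc n))
  last-terminal {s} {d} {n} = subst (Terminal H) (cellAt-along (chain s d (suc (suc n))) (suc n))

  KinkFormula : List Cell → List Cell → List Cell → ℤ → Set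
  KinkFormula H₁ H₂ H₃ t₁ = Af H ≈P xpow 1 (Af H₂) +P xpow 1 (Af H₃) +P (xpow 1 (Af H₁) +P t₁ ·P xpow 2 (Af H₂) -P xpow 2 (Af H₃))

  single : ∀ s δ ℓ {h T₂ T₃ t₁} → t₁ ≡ + ℓ - + 2 → t₁ ≡ -1ℤ → LinChain H (chain s δ ℓ) → (∀ c → c ∈ H → InChain c (chain s δ ℓ)) → h ∈ H →
    SingleAt T₂ h → SingleAt T₃ h → ∀ H₂ H₃ → IsH₂ H (chain s δ ℓ) T₂ H₂ → IsH₃ H (chain s δ ℓ) T₂ T₃ H₃ → Af H ≈P xpow 1 (Af H₂) +P xpow 1 (Af H₃)
  single s δ zero refl ()
  single s δ (suc (suc n)) refl ()
  single s δ (suc zero) {h} {T₂} {T₃} _ _ lin all m s₂ s₃ H₂ H₃ is₂ is₃ k =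
    trans (Af≡A H k) (trans (singleA H₂ H₃ h (χ⁺ m) (λ i → χ-false (λ w → ▸-≢ h i (only _ w))) M₂ M₃ k)
      (sym (cong₂ _+_ (xpow-cong 1 (Af≡A H₂) k) (xpow-cong 1 (Af≡A H₃) k))))
    where
    T₁ = chain s δ 1
    at-s : ∀ x → InChain x T₁ → x ≡ s
    at-s x q with proj₁ (traces s δ 0) x q
    ... | zero , _ , e = e
    h≡s : h ≡ s
    h≡s = at-s h (all h m)
    only : ∀ x → x ∈ H → x ≡ h
    only x w = trans (at-s x (all x w)) (sym h≡s)
    in-T₁ : ∀ x → x ≡ h → InChain x T₁
    in-T₁ x e = proj₂ (traces s δ 0) x (0 , z≤n , trans e h≡s)
    at-h : ∀ {T} → SingleAt T h → ∀ x → InChain x T → x ≡ h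
    at-h {T} st x q with proj₁ (traces-single {T} d0 st) x q
    ... | zero , _ , e = e
    M₂ : Minus H₂ H (λ x → x ≡ h)
    M₂ = minus₂ {H} {T₁} {T₂} (λ x → x ≡ h) is₂ (λ x e → inj₁ (in-T₁ x e)) (λ { x (inj₁ q) → trans (at-s x q) (sym h≡s) ; x (inj₂ q) → at-h {T₂} s₂ x q })
    M₃ : Minus H₃ H (λ x → x ≡ h)
    M₃ = minus₃ {H} {T₁} {T₂} {T₃} (λ x → x ≡ h) is₃ (λ x e → inj₁ (in-T₁ x e))
      (λ { x (inj₁ q) → trans (at-s x q) (sym h≡s) ; x (inj₂ (inj₁ q)) → at-h {T₂} s₂ x q ; x (inj₂ (inj₂ q)) → at-h {T₃} s₃ x q })

  -- In case (a) `h` may be either end of T₁. An inner hexagon has two neighbours and is not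
  -- terminal, and a chain ending at `h` is read backwards.
  from-end : ∀ s δ n h → LinChain H (chain s δ (suc (suc n))) → InChain h (chain s δ (suc (suc n))) → Terminal H h →
    ∃[ d ] Traces (chain s δ (suc (suc n))) h d (suc n)
  from-end s δ n h lin ih term = locate (proj₁ (traces s δ (suc n)) h ih)
    where
    T₁ = chain s δ (suc (suc n))
    cells = lin-cell {s} {δ} lin
    locate : OnRay s δ (suc n) h → ∃[ d ] Traces T₁ h d (suc n)
    locate (zero , _ , refl) = δ , traces h δ (suc n)
    locate (suc j , l , e) = position (suc j ℕ.≟ suc n)
      where
      position : Dec (suc j ≡ suc n) → ∃[ d ] Traces T₁ h d (suc n)
      position (yes q) = r3 δ , fore , aft
        where
        e' : h ≡ along s δ (suc n)
        e' = trans e (cong (along s δ) q)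
        mirror : ∀ k → k ℕ.≤ suc n → along h (r3 δ) (suc n ℕ.∸ k) ≡ along s δ k
        mirror k l = trans (cong (λ c → along c (r3 δ) (suc n ℕ.∸ k)) (trans e' (cong (along s δ) (sym (ℕP.m+[n∸m]≡n l))))) (along-back s δ k (suc n ℕ.∸ k))
        fore : ∀ x → InChain x T₁ → OnRay h (r3 δ) (suc n) x
        fore x w = let (k , l , ex) = proj₁ (traces s δ (suc n)) x w in suc n ℕ.∸ k , ℕP.m∸n≤m (suc n) k , trans ex (sym (mirror k l))
        aft : ∀ x → OnRay h (r3 δ) (suc n) x → InChain x T₁
        aft x (k , l , ex) = proj₂ (traces s δ (suc n)) x (suc n ℕ.∸ k , ℕP.m∸n≤m (suc n) k ,
          trans ex (trans (cong (along h (r3 δ)) (sym (ℕP.m∸[m∸n]≡n l))) (mirror (suc n ℕ.∸ k) (ℕP.m∸n≤m (suc n) k))))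
      position (no ne) = clash ahead (only-nbr {h} {r3 δ} one′ behind′ δ (λ q → r3≢ δ (sym q)))
        where
        l' : suc j ℕ.< suc n
        l' = ℕP.≤∧≢⇒< l ne
        ahead : χ H ∋ h ▸ δ
        ahead = trans (cong (χ H) (trans (cong (λ p → p ▸ δ) e) (sym (along-suc s δ (suc j))))) (cells (suc (suc j)) (s≤s l'))
        behind′ : χ H ∋ h ▸ r3 δ
        behind′ = trans (cong (χ H) (trans (cong (λ p → p ▸ r3 δ) (trans e (along-suc s δ j))) (▸-opposite (along s δ j) δ))) (cells j (ℕP.m<n⇒m<1+n (ℕP.<⇒≤ l')))
        one′ : numNbrs H h ≡ 1
        one′ = terminal-one {h} s (cells 0 (s≤s z≤n)) (λ q → ℕP.1+n≢0 (along-inj s δ {suc j} {0} (trans (sym e) (sym q)))) term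

  caseA : ∀ {h T₁ T₂ T₃ t₁ t₂ t₃} → TailA H h T₁ T₂ T₃ t₁ t₂ t₃ → ∀ H₁ H₂ H₃ → IsH₁ H h T₁ T₂ H₁ → IsH₂ H T₁ T₂ H₂ → IsH₃ H T₁ T₂ T₃ H₃ →
    (t₁ ≡ -1ℤ → Af H ≈P xpow 1 (Af H₂) +P xpow 1 (Af H₃)) × (0ℤ ≤ t₁ → KinkFormula H₁ H₂ H₃ t₁)
  caseA {h} {chain s δ ℓ} {T₂} {T₃} {t₁} (lin , all , term , s₂ , s₃ , e₁ , _) H₁ H₂ H₃ is₁ is₂ is₃ =
    (λ e → single s δ ℓ {h} {T₂} {T₃} e₁ e lin all (proj₁ term) s₂ s₃ H₂ H₃ is₂ is₃) , λ nn → longer (tail-length ℓ t₁ e₁ nn)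
    where
    longer : ∃[ n ] (ℓ ≡ suc (suc n) × t₁ ≡ + n) → KinkFormula H₁ H₂ H₃ t₁
    longer (n , refl , refl) = line-Af (chain s δ (suc (suc n))) T₂ T₃ H₁ H₂ H₃ h d n (λ x t → proj₁ tr x (all x (χ⁻ t)))
        (λ x q → inH (proj₁ (traces s δ (suc n)) x (proj₂ tr x q))) tr s₂ s₃ is₁ is₂ is₃
      where
      D = from-end s δ n h lin (all h (proj₁ term)) term
      d = proj₁ D
      tr = proj₂ D
      inH : ∀ {x} → OnRay s δ (suc n) x → χ H ∋ x
      inH (k , l , e) = trans (cong (χ H) e) (lin-cell {s} {δ} lin k (s≤s l))

  caseB : ∀ {h T₁ T₂ T₃ t₁ t₂ t₃} → TailB H h T₁ T₂ T₃ t₁ t₂ t₃ → ∀ H₁ H₂ H₃ → IsH₁ H h T₁ T₂ H₁ → IsH₂ H T₁ T₂ H₂ → IsH₃ H T₁ T₂ T₃ H₃ →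
    KinkFormula H₁ H₂ H₃ t₁
  caseB {h} {chain _ d ℓ} {T₂} {chain _ s ℓ'} {t₁} {t₂} {t₃} ((_ , two , _) , mx , refl , term , mx' , refl , ne , s₂ , e₁ , _ , e₃ , nn₁ , nn₃) H₁ H₂ H₃ is₁ is₂ is₃ =
    lengths (tail-length ℓ t₁ e₁ nn₁) (tail-length ℓ' t₃ e₃ nn₃)
    where
    lengths : ∃[ n ] (ℓ ≡ suc (suc n) × t₁ ≡ + n) → ∃[ n ] (ℓ' ≡ suc (suc n) × t₃ ≡ + n) → KinkFormula H₁ H₂ H₃ t₁
    lengths (n , refl , refl) (n₃ , refl , refl) = orient (dirs d s) R' ne (traces h s (suc n₃)) is₃
      where
      R = max-ray {h} {d} mx
      R' = max-ray {h} {s} mx'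
      bare : Bare (χ H) (h ▸ d) d n
      bare = terminal-bare R (last-terminal {h} {d} {n} term)
      x₁ : χ H ∋ h ▸ d
      x₁ = ray-in (ray R) 0 (s≤s z≤n)
      T₁ = chain h d (suc (suc n))
      T₃ = chain h s (suc (suc n₃))
      h-dir : ∀ {i j} → i ≡ j → χ H ∌ h ▸ j → χ H ∌ h ▸ i
      h-dir e t = trans (cong (λ j → χ H (h ▸ j)) e) t
      -- Arms at 60° contradict `cata`, and arms at 180° the maximality of T₁. There remain 120° to
      -- either side, which are the two orientations of a kink.
      orient : ∀ {s'} → Dir d s' → MaxRay h s' (suc n₃) → ¬ (d ≡ s') → Traces T₃ h s' (suc n₃) → IsH₃ H T₁ T₂ T₃ H₃ → KinkFormula H₁ H₂ H₃ (+ n)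
      orient is0 _ ne _ _ = ⊥-elim (ne refl)
      orient is1 Q _ _ _ = clash (ray-in (ray Q) 0 (s≤s z≤n)) (cata good h d (origin R) x₁)
      orient is3 Q _ _ _ = clash (ray-in (ray Q) 0 (s≤s z≤n)) (gap R)
      orient is5 Q _ _ _ = clash (ray-in (ray Q) 0 (s≤s z≤n)) (cataL good h d (origin R) x₁)
      orient is2 Q _ tr is₃ = kink-Af (sideL d) T₁ T₂ T₃ H₁ H₂ H₃ h n (suc n₃) R bare (ray Q)
        (cata good h d (origin R) x₁) (gap R)
        (two-nbrs {h} {d} {r2 d} {r4 d} two x₁ (ray-in (ray Q) 0 (s≤s z≤n)) (λ e → r2≢ d (sym e)) (λ e → r2≢ (r4 d) (trans (r6 d) (sym e))) (λ e → r2≢ (r2 d) e))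
        (cataL good h d (origin R) x₁)
        (traces h d (suc n)) (traces-single {T₂} d s₂) tr is₁ is₂ is₃
      orient is4 Q _ tr is₃ = kink-Af (sideR d) T₁ T₂ T₃ H₁ H₂ H₃ h n (suc n₃) R bare (ray Q)
        (cataL good h d (origin R) x₁) (h-dir (cong r1 (r6 d)) (cata good h d (origin R) x₁))
        (h-dir (cong r2 (r6 d)) (two-nbrs {h} {d} {r4 d} {r2 d} two x₁ (ray-in (ray Q) 0 (s≤s z≤n)) (λ e → r2≢ (r4 d) (trans (r6 d) e)) (r2≢ d) (λ e → r2≢ (r2 d) (sym e))))
        (h-dir (cong r3 (r6 d)) (gap R))
        (traces h d (suc n)) (traces-single {T₂} d s₂) tr is₁ is₂ is₃

  BranchFormula : List Cell → List Cell → List Cell → ℤ → ℤ → Poly → Set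
  BranchFormula H₁ H₂ H₃ t₁ t₂ β = Af H ≈P common (Af H₁) (Af H₂) (Af H₃) t₁ t₂ +P β

  -- Relative to the direction `d` of T₃ the two tails leave `h` in the directions `r2 d` and
  -- `r4 d`, in either order. The formula is symmetric in the tails, so the second order follows by
  -- exchanging them.
  caseC : ∀ {h T₁ T₂ T₃ t₁ t₂ t₃} → TailC H h T₁ T₂ T₃ t₁ t₂ t₃ → ∀ H₁ H₂ H₃ H₄ →
    IsH₁ H h T₁ T₂ H₁ → IsH₂ H T₁ T₂ H₂ → IsH₃ H T₁ T₂ T₃ H₃ → IsH₄ H T₁ T₂ T₃ H₄ →
    (t₃ ≡ 0ℤ → BranchFormula H₁ H₂ H₃ t₁ t₂ (xpow 1 (Af H₂) -P xpow 2 (Af H₄))) × (+ 1 ≤ t₃ → BranchFormula H₁ H₂ H₃ t₁ t₂ (xpow 2 (Af H₃)))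
  caseC {h} {chain _ a ℓ₁} {chain _ b ℓ₂} {chain _ d ℓ₃} {t₁} {t₂} {t₃}
    (_ , mx₁ , refl , term₁ , mx₂ , refl , term₂ , mx₃ , refl , ab , ad , bd , e₁ , e₂ , e₃ , nn₁ , nn₂ , nn₃) H₁ H₂ H₃ H₄ is₁ is₂ is₃ is₄ =
    lengths (tail-length ℓ₁ t₁ e₁ nn₁) (tail-length ℓ₂ t₂ e₂ nn₂) (tail-length ℓ₃ t₃ e₃ nn₃)
    where
    Goal : Set
    Goal = (t₃ ≡ 0ℤ → BranchFormula H₁ H₂ H₃ t₁ t₂ (xpow 1 (Af H₂) -P xpow 2 (Af H₄))) × (+ 1 ≤ t₃ → BranchFormula H₁ H₂ H₃ t₁ t₂ (xpow 2 (Af H₃)))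
    lengths : ∃[ n ] (ℓ₁ ≡ suc (suc n) × t₁ ≡ + n) → ∃[ n ] (ℓ₂ ≡ suc (suc n) × t₂ ≡ + n) → ∃[ n ] (ℓ₃ ≡ suc (suc n) × t₃ ≡ + n) → Goal
    lengths (n , refl , refl) (n' , refl , refl) (p , refl , refl) = orient (dirs d a) (dirs d b) R₁ R₂ ab (λ e → ad (sym e)) (λ e → bd (sym e))
        (last-terminal {h} {a} {n} term₁) (last-terminal {h} {b} {n'} term₂) (traces h a (suc n)) (traces h b (suc n'))
      where
      T₁ = chain h a (suc (suc n))
      T₂ = chain h b (suc (suc n'))
      T₃ = chain h d (suc (suc p))
      R₁ = max-ray {h} {a} mx₁
      R₂ = max-ray {h} {b} mx₂
      R₃ = max-ray {h} {d} mx₃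
      near : ∀ {e m} → MaxRay h e (suc m) → χ H ∋ h ▸ e
      near Q = ray-in (ray Q) 0 (s≤s z≤n)
      data Fits : Fin 6 → Set where
        fit₂ : Fits (r2 d)
        fit₄ : Fits (r4 d)
      fits : ∀ {e m} → Dir d e → MaxRay h e (suc m) → ¬ (d ≡ e) → Fits e
      fits is0 _ ne = ⊥-elim (ne refl)
      fits is1 Q _ = clash (near Q) (cata good h d (origin R₃) (near R₃))
      fits is2 _ _ = fit₂
      fits is3 Q _ = clash (near Q) (gap R₃)
      fits is4 _ _ = fit₄
      fits is5 Q _ = clash (near Q) (cataL good h d (origin R₃) (near R₃))
      Input : Fin 6 → Fin 6 → Set
      Input e e' = Terminal H (along h e (suc n)) → Terminal H (along h e' (suc n')) → Traces T₁ h e (suc n) → Traces T₂ h e' (suc n') → Goal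
      pos : + 1 ≤ + p → ∃[ q ] p ≡ suc q
      pos (ℤ.+≤+ (s≤s {n = q} _)) = q , refl
      combine : (p ≡ 0 → BranchFormula H₁ H₂ H₃ (+ n) (+ n') (xpow 1 (Af H₂) -P xpow 2 (Af H₄))) →
        (∀ q → p ≡ suc q → BranchFormula H₁ H₂ H₃ (+ n) (+ n') (xpow 2 (Af H₃))) → Goal
      combine f g = (λ e → f (ℤP.+-injective e)) , λ l → let (q , e) = pos l in g q e
      swapped : ∀ {β} → Af H ≈P common (Af H₁) (Af H₂) (Af H₃) (+ n') (+ n) +P β → Af H ≈P common (Af H₁) (Af H₂) (Af H₃) (+ n) (+ n') +P β
      swapped {β} f k = trans (f k) (cong (λ t → t + β k) (common-swap {Af H₁} {Af H₂} {Af H₃} (+ n') (+ n) k))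
      dispatch : ∀ {e e'} → Fits e → Fits e' → ¬ (e ≡ e') → MaxRay h e (suc n) → MaxRay h e' (suc n') → Input e e'
      dispatch fit₂ fit₂ ne _ _ _ _ _ _ = ⊥-elim (ne refl)
      dispatch fit₄ fit₄ ne _ _ _ _ _ _ = ⊥-elim (ne refl)
      dispatch fit₂ fit₄ _ Q Q' t t' tr tr' = combine (λ e → C.short e H₄ is₄) C.long
        where module C = BranchCase T₁ T₂ H₁ H₂ H₃ h d n n' p Q t Q' t' R₃ tr tr' is₁ is₂ is₃
      dispatch fit₄ fit₂ _ Q Q' t t' tr tr' = combine (λ e → swapped {xpow 1 (Af H₂) -P xpow 2 (Af H₄)} (C.short e H₄ is₄′)) (λ q e → swapped {xpow 2 (Af H₃)} (C.long q e))
        where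
        is₁′ : IsH₁ H h T₂ T₁ H₁
        is₁′ c = (λ i → let (m , f) = proj₁ (is₁ c) i in m , λ w → f (swap w)) , (λ { (m , f) → proj₂ (is₁ c) (m , λ w → f (swap w)) })
        is₂′ : IsH₂ H T₂ T₁ H₂
        is₂′ c = (λ i → let (m , f) = proj₁ (is₂ c) i in m , λ w → f (swap w)) , (λ { (m , f) → proj₂ (is₂ c) (m , λ w → f (swap w)) })
        is₃′ : IsH₃ H T₂ T₁ T₃ H₃
        is₃′ c = (λ i → let (m , f) = proj₁ (is₃ c) i in m , λ w → f (⊎-swap₃ w)) , (λ { (m , f) → proj₂ (is₃ c) (m , λ w → f (⊎-swap₃ w)) })
        is₄′ : IsH₄ H T₂ T₁ T₃ H₄
        is₄′ c = (λ i → let ((m , f) , g) = proj₁ (is₄ c) i in (m , λ w → f (⊎-swap₃ w)) , g) , (λ { ((m , f) , g) → proj₂ (is₄ c) ((m , λ w → f (⊎-swap₃ w)) , g) })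
        module C = BranchCase T₂ T₁ H₁ H₂ H₃ h d n' n p Q' t' Q t R₃ tr' tr is₁′ is₂′ is₃′
      orient : ∀ {e e'} → Dir d e → Dir d e' → MaxRay h e (suc n) → MaxRay h e' (suc n') → ¬ (e ≡ e') → ¬ (d ≡ e) → ¬ (d ≡ e') → Input e e'
      orient D D' Q Q' ne nd nd' = dispatch (fits D Q nd) (fits D' Q' nd') ne Q Q'

theorem3p2 : (H : List Cell) → HexSystem H → Catacondensed H →
    (h : Cell) (T₁ T₂ T₃ : Chain) (t₁ t₂ t₃ : ℤ) →
    IsTail H h T₁ T₂ T₃ t₁ t₂ t₃ →
    (H₁ H₂ H₃ H₄ : List Cell) →
    IsH₁ H h T₁ T₂ H₁ → IsH₂ H T₁ T₂ H₂ → IsH₃ H T₁ T₂ T₃ H₃ →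
    IsH₄ H T₁ T₂ T₃ H₄ →
    (t₂ ≡ -1ℤ →
    (t₁ ≡ -1ℤ →
    Af H ≈P xpow 1 (Af H₂) +P xpow 1 (Af H₃))
    × (0ℤ ≤ t₁ →
    Af H ≈P xpow 1 (Af H₂) +P xpow 1 (Af H₃)
    +P (xpow 1 (Af H₁) +P t₁ ·P xpow 2 (Af H₂) -P xpow 2 (Af H₃))))
    × (0ℤ ≤ t₂ →
    (t₃ ≡ 0ℤ →
    Af H ≈P xpow 2 (Af H₁)
    +P (+ 3 ·P xpow 2 (Af H₂) +P (+ 2 * (t₁ + t₂)) ·P xpow 3 (Af H₂)
    +P (t₁ * t₂) ·P xpow 4 (Af H₂))
    -P xpow 3 (Af H₃)
    +P (xpow 1 (Af H₂) -P xpow 2 (Af H₄)))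
    × (+ 1 ≤ t₃ →
    Af H ≈P xpow 2 (Af H₁)
    +P (+ 3 ·P xpow 2 (Af H₂) +P (+ 2 * (t₁ + t₂)) ·P xpow 3 (Af H₂)
    +P (t₁ * t₂) ·P xpow 4 (Af H₂))
    -P xpow 3 (Af H₃)
    +P xpow 2 (Af H₃)))
theorem3p2 H hex cat h T₁ T₂ T₃ t₁ t₂ t₃ tail H₁ H₂ H₃ H₄ is₁ is₂ is₃ is₄ = result tail
  where
  open Theorem {H} (hex-good H hex cat)
  negative : ∀ {t : ℤ} → t ≡ -1ℤ → 0ℤ ≤ t → ⊥
  negative refl ()
  result : IsTail H h T₁ T₂ T₃ t₁ t₂ t₃ → _
  result (inj₁ tA@(_ , _ , _ , _ , _ , _ , e₂ , _)) = (λ _ → caseA {h} {T₁} {T₂} {T₃} tA H₁ H₂ H₃ is₁ is₂ is₃) , λ nn → ⊥-elim (negative e₂ nn)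
  result (inj₂ (inj₁ tB@(_ , _ , _ , _ , _ , _ , _ , _ , _ , e₂ , _ , nn₁ , _))) =
    (λ _ → (λ e → ⊥-elim (negative e nn₁)) , λ _ → caseB {h} {T₁} {T₂} {T₃} tB H₁ H₂ H₃ is₁ is₂ is₃) , λ nn → ⊥-elim (negative e₂ nn)
  result (inj₂ (inj₂ tC@(_ , _ , _ , _ , _ , _ , _ , _ , _ , _ , _ , _ , _ , _ , _ , _ , nn₂ , _))) =
    (λ e → ⊥-elim (negative e nn₂)) , λ _ → caseC {h} {T₁} {T₂} {T₃} tC H₁ H₂ H₃ H₄ is₁ is₂ is₃ is₄
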